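{- For every fixed $\epsilon>0$ there exists $d_0=d_0(\epsilon)$ such that for every fixed integer $d\ge d_0$, asymptotically almost surely a graph $G\in\mathcal{G}_{n,d}$ satisfies \[ n\left(1-(1+\epsilon)\frac{4\log d}{d}\right)\le Z(G)\le n\left(1-(1-\epsilon)\frac{\log d}{2d}\right). \]
   Context: $\mathcal{G}_{n,d}$ denotes the uniform probability space of (simple) $d$-regular graphs on $n$ labelled vertices, with $d$ fixed, $n\to\infty$, and $n$ even if $d$ is odd. An event holds asymptotically almost surely (a.a.s.) if its probability tends to $1$ as $n\to\infty$. $\log$ is the natural logarithm. Zero forcing: given a graph $G$ and an initial set $S$ of vertices coloured black (all others white), repeatedly, a black vertex with exactly one white neighbour forces that neighbour to become black; $S$ is a zero forcing set if eventually all vertices are black. $Z(G)$, the zero forcing number, is the minimum size of a zero forcing set of $G$. -}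

module Defs where

open import Data.Bool.Properties using () renaming (_≟_ to _≟ᵇ_)
open import Data.Fin using (Fin)
open import Data.Fin.Properties using (all?)
open import Data.Fin.Subset using (Subset; inside; outside; _∈_; _∉_; _∪_; ⁅_⁆; ⊤; ∣_∣)
open import Data.Fin.Subset.Properties using (_∈?_)
open import Data.Integer as ℤ using (+_; +≤+; +<+)
import Data.Integer.Properties as ℤ
open import Data.List using (List; []; _∷_; length; filter; cartesianProductWith)
open import Data.List.Relation.Binary.Sublist.Propositional using (_⊆_)
open import Data.List.Relation.Unary.All using (All)
open import Data.Nat as ℕ using (ℕ; zero; suc; NonZero; _⊔_; s≤s; z≤n)
open import Data.Nat.Divisibility using (_∣_)
import Data.Nat.Properties as ℕ
open import Data.Product using (∃; _×_; _,_)
open import Data.Rational as ℚ using (ℚ; mkℚ; 0ℚ; 1ℚ; ½; _+_; _-_; _*_; -_; _/_; 1/_; _≤_; _<_; toℚᵘ; fromℚᵘ)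
open import Data.Rational.Properties as ℚ hiding (_≟_)
import Data.Rational.Solver as ℚ
open import Data.Rational.Unnormalised as ℚᵘ using (mkℚᵘ; *≤*; *<*; *≡*)
import Data.Rational.Unnormalised.Properties as ℚᵘ
open import Data.Sum using (inj₁; inj₂)
open import Data.Vec using (Vec; []; _∷_; lookup)
open import Function using (it)
open import Relation.Binary.Construct.Closure.ReflexiveTransitive using (Star)
open import Relation.Binary.PropositionalEquality
open import Relation.Nullary using (¬_; Dec)
open import Relation.Nullary.Decidable using (_×-dec_; _→-dec_; ¬?)

------------------------------------------------------------------------
-- Rational preliminaries

ℕ→ℚ : ℕ → ℚ
ℕ→ℚ n = + n / 1

recip : (n : ℕ) → .{{_ : NonZero n}} → ℚ
recip n = + 1 / n

private
  open ℚ.+-*-Solver using (solve; _:=_; _:+_; _:*_; _:-_; con)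

  recipᵘ : ∀ k → toℚᵘ (recip (suc k)) ℚᵘ.≃ mkℚᵘ (+ 1) k
  recipᵘ k = toℚᵘ-fromℚᵘ (mkℚᵘ (+ 1) k)

  recip-anti : ∀ {i j} .{{_ : NonZero i}} .{{_ : NonZero j}} →
               i ℕ.≤ j → recip j ≤ recip i
  recip-anti {suc i} {suc j} i≤j = toℚᵘ-cancel-≤
    (ℚᵘ.≤-trans (ℚᵘ.≤-reflexive (recipᵘ j))
    (ℚᵘ.≤-trans (*≤* (ℤ.*-monoˡ-≤-nonNeg (+ 1) (+≤+ i≤j)))
      (ℚᵘ.≤-reflexive (ℚᵘ.≃-sym (recipᵘ i)))))

  archimedean : ∀ ε → 0ℚ < ε → ∃ λ N → recip (suc N) < ε
  archimedean ε@(mkℚ (+ zero)  b c) (ℚ.*<* (+<+ ()))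
  archimedean ε@(mkℚ (+ suc a) b c) _ = suc b , toℚᵘ-cancel-<
    (ℚᵘ.≤-<-trans (ℚᵘ.≤-reflexive (recipᵘ (suc b)))
      (*<* (+<+ (ℕ.<-≤-trans (s≤s (ℕ.≤-reflexive (ℕ.*-identityˡ (suc b))))
                             (ℕ.m≤n*m (suc (suc b)) (suc a))))))
  archimedean (mkℚ ℤ.-[1+ a ] b c) (ℚ.*<* ())

  ℕ→ℚ-suc : ∀ l → ℕ→ℚ (suc l) ≡ 1ℚ + ℕ→ℚ l
  ℕ→ℚ-suc l = toℚᵘ-injective (begin
    toℚᵘ (ℕ→ℚ (suc l))                   ≈⟨ toℚᵘ-fromℚᵘ (mkℚᵘ (+ suc l) 0) ⟩
    mkℚᵘ (+ suc l) 0                     ≈⟨ *≡* (cong (λ t → (+ 1 ℤ.+ t) ℤ.* + 1) (sym (ℤ.*-identityʳ (+ l)))) ⟩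
    ℚᵘ.1ℚᵘ ℚᵘ.+ mkℚᵘ (+ l) 0             ≈⟨ ℚᵘ.+-congʳ ℚᵘ.1ℚᵘ (ℚᵘ.≃-sym (toℚᵘ-fromℚᵘ (mkℚᵘ (+ l) 0))) ⟩
    toℚᵘ 1ℚ ℚᵘ.+ toℚᵘ (ℕ→ℚ l)            ≈⟨ ℚᵘ.≃-sym (toℚᵘ-homo-+ 1ℚ (ℕ→ℚ l)) ⟩
    toℚᵘ (1ℚ + ℕ→ℚ l)                    ∎)
    where open ℚᵘ.≃-Reasoning

  ℕ→ℚ*recip : ∀ d m .{{_ : NonZero d}} .{{_ : NonZero m}} .{{_ : NonZero (d ℕ.* m)}} →
              ℕ→ℚ d * recip (d ℕ.* m) ≡ recip m
  ℕ→ℚ*recip d@(suc d-1) m@(suc m-1) = toℚᵘ-injective (begin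
    toℚᵘ (ℕ→ℚ d * recip (d ℕ.* m))           ≈⟨ toℚᵘ-homo-* (ℕ→ℚ d) (recip (d ℕ.* m)) ⟩
    toℚᵘ (ℕ→ℚ d) ℚᵘ.* toℚᵘ (recip (d ℕ.* m)) ≈⟨ ℚᵘ.*-cong (toℚᵘ-fromℚᵘ (mkℚᵘ (+ d) 0)) (recipᵘ (m-1 ℕ.+ d-1 ℕ.* m)) ⟩
    mkℚᵘ (+ d) 0 ℚᵘ.* mkℚᵘ (+ 1) (m-1 ℕ.+ d-1 ℕ.* m) ≈⟨ *≡* (cong +_ eq) ⟩
    mkℚᵘ (+ 1) m-1                           ≈⟨ ℚᵘ.≃-sym (recipᵘ m-1) ⟩
    toℚᵘ (recip m)                           ∎)
    where
    open ℚᵘ.≃-Reasoning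
    eq : (d ℕ.* 1) ℕ.* m ≡ 1 ℕ.* (1 ℕ.* (d ℕ.* m))
    eq = trans (cong (ℕ._* m) (ℕ.*-identityʳ d))
           (sym (trans (ℕ.*-identityˡ (1 ℕ.* (d ℕ.* m))) (ℕ.*-identityˡ (d ℕ.* m))))

  ½-pos : ∀ {ε} → 0ℚ < ε → 0ℚ < ½ * ε
  ½-pos {ε} 0<ε = subst (_< ½ * ε) (*-zeroʳ ½) (*-monoʳ-<-pos ½ 0<ε)

  ½+½ : ∀ ε → ½ * ε + ½ * ε ≡ ε
  ½+½ ε = trans (sym (*-distribʳ-+ ε ½ ½)) (*-identityˡ ε)

  distance : ∀ {p q ε} → p ≤ q + ε → q ≤ p + ε → ℚ.∣ p - q ∣ ≤ ε
  distance {p} {q} {ε} p≤q+ε q≤p+ε with ∣p∣≡p∨∣p∣≡-p (p - q)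
  ... | inj₁ eq = subst₂ _≤_ (sym eq)
                    (solve 2 (λ q ε → (q :+ ε) :- q := ε) refl q ε)
                    (+-monoˡ-≤ (- q) p≤q+ε)
  ... | inj₂ eq = subst₂ _≤_
                    (trans (solve 2 (λ p q → q :- p := con 0ℚ :- (p :- q)) refl p q)
                      (trans (+-identityˡ _) (sym eq)))
                    (solve 2 (λ p ε → (p :+ ε) :- p := ε) refl p ε)
                    (+-monoˡ-≤ (- p) q≤p+ε)

------------------------------------------------------------------------
-- Cauchy real numbers

record ℝ : Set where
  constructor mkℝ
  field
    seq    : ℕ → ℚ
    cauchy : ∀ ε → 0ℚ < ε → ∃ λ N → ∀ m n → N ℕ.≤ m → N ℕ.≤ n →
             ℚ.∣ seq m - seq n ∣ < ε

open ℝ public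

infixl 6 _+ᴿ_ _-ᴿ_
infixl 7 _*ᴿ_ _/ᴿ_
infix  4 _≤ᴿ_ _<ᴿ_

_≤ᴿ_ : ℝ → ℝ → Set
x ≤ᴿ y = ∀ ε → 0ℚ < ε → ∃ λ N → ∀ n → N ℕ.≤ n → seq x n ≤ seq y n + ε

_<ᴿ_ : ℝ → ℝ → Set
x <ᴿ y = ∃ λ ε → 0ℚ < ε × ∃ λ N → ∀ n → N ℕ.≤ n → seq x n + ε ≤ seq y n

ℚ→ℝ : ℚ → ℝ
ℚ→ℝ q = mkℝ (λ _ → q) λ ε 0<ε → 0 , λ _ _ _ _ →
  subst (_< ε) (cong ℚ.∣_∣ (sym (+-inverseʳ q))) 0<ε

ℕ→ℝ : ℕ → ℝ
ℕ→ℝ n = ℚ→ℝ (ℕ→ℚ n)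

0ℝ 1ℝ : ℝ
0ℝ = ℚ→ℝ 0ℚ
1ℝ = ℚ→ℝ 1ℚ

_+ᴿ_ : ℝ → ℝ → ℝ
seq (x +ᴿ y) n = seq x n + seq y n
cauchy (x +ᴿ y) ε 0<ε =
  let N₁ , f = cauchy x (½ * ε) (½-pos 0<ε)
      N₂ , g = cauchy y (½ * ε) (½-pos 0<ε)
  in N₁ ⊔ N₂ , λ m n N≤m N≤n → begin-strict
    ℚ.∣ (seq x m + seq y m) - (seq x n + seq y n) ∣
      ≡⟨ cong ℚ.∣_∣ (solve 4 (λ a b c d → (a :+ b) :- (c :+ d) := (a :- c) :+ (b :- d)) refl
           (seq x m) (seq y m) (seq x n) (seq y n)) ⟩
    ℚ.∣ (seq x m - seq x n) + (seq y m - seq y n) ∣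
      ≤⟨ ∣p+q∣≤∣p∣+∣q∣ (seq x m - seq x n) (seq y m - seq y n) ⟩
    ℚ.∣ seq x m - seq x n ∣ + ℚ.∣ seq y m - seq y n ∣
      <⟨ +-mono-< (f m n (ℕ.m⊔n≤o⇒m≤o N₁ N₂ N≤m) (ℕ.m⊔n≤o⇒m≤o N₁ N₂ N≤n))
                  (g m n (ℕ.m⊔n≤o⇒n≤o N₁ N₂ N≤m) (ℕ.m⊔n≤o⇒n≤o N₁ N₂ N≤n)) ⟩
    ½ * ε + ½ * ε
      ≡⟨ ½+½ ε ⟩
    ε ∎
  where open ℚ.≤-Reasoning

-ᴿ_ : ℝ → ℝ
seq (-ᴿ x) n = - seq x n
cauchy (-ᴿ x) ε 0<ε = let N , f = cauchy x ε 0<ε in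
  N , λ m n N≤m N≤n → subst (_< ε)
    (trans (sym (∣-p∣≡∣p∣ (seq x m - seq x n)))
      (cong ℚ.∣_∣ (neg-distrib-+ (seq x m) (- seq x n))))
    (f m n N≤m N≤n)

_-ᴿ_ : ℝ → ℝ → ℝ
x -ᴿ y = x +ᴿ (-ᴿ y)

private
  bounded : ∀ x → ∃ λ B → 0ℚ < B × ∃ λ N → ∀ n → N ℕ.≤ n → ℚ.∣ seq x n ∣ ≤ B
  bounded x = let N , f = cauchy x 1ℚ (positive⁻¹ 1ℚ) in
    1ℚ + ℚ.∣ seq x N ∣ ,
    <-≤-trans (positive⁻¹ 1ℚ)
      (subst (_≤ 1ℚ + ℚ.∣ seq x N ∣) (+-identityʳ 1ℚ) (+-monoʳ-≤ 1ℚ (0≤∣p∣ (seq x N)))) ,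
    N , λ n N≤n → begin
      ℚ.∣ seq x n ∣
        ≡⟨ cong ℚ.∣_∣ (solve 2 (λ a b → a := (a :- b) :+ b) refl (seq x n) (seq x N)) ⟩
      ℚ.∣ (seq x n - seq x N) + seq x N ∣
        ≤⟨ ∣p+q∣≤∣p∣+∣q∣ (seq x n - seq x N) (seq x N) ⟩
      ℚ.∣ seq x n - seq x N ∣ + ℚ.∣ seq x N ∣
        ≤⟨ +-monoˡ-≤ ℚ.∣ seq x N ∣ (<⇒≤ (f n N N≤n ℕ.≤-refl)) ⟩
      1ℚ + ℚ.∣ seq x N ∣ ∎
    where open ℚ.≤-Reasoning


  scale : ∀ B ε → 0ℚ < B → 0ℚ < ε → ∃ λ δ → 0ℚ < δ × B * δ ≡ ε
  scale B ε 0<B 0<ε = 1/B * ε , positive⁻¹ _ , eq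
    where
    instance
      B-pos : ℚ.Positive B
      B-pos = ℚ.positive 0<B
      B≢0 : ℚ.NonZero B
      B≢0 = pos⇒nonZero B
    1/B : ℚ
    1/B = 1/ B
    instance
      ε-pos : ℚ.Positive ε
      ε-pos = ℚ.positive 0<ε
      1/B-pos : ℚ.Positive 1/B
      1/B-pos = 1/pos⇒pos B
      δ-pos : ℚ.Positive (1/B * ε)
      δ-pos = pos*pos⇒pos 1/B ε
    eq : B * (1/B * ε) ≡ ε
    eq = trans (sym (*-assoc B 1/B ε)) (trans (cong (_* ε) (*-inverseʳ B)) (*-identityˡ ε))

  product-< : ∀ {p q B δ} → 0ℚ < B → ℚ.∣ p ∣ ≤ B → ℚ.∣ q ∣ < δ → ℚ.∣ p * q ∣ < B * δ
  product-< {p} {q} {B} {δ} 0<B p≤B q<δ = begin-strict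
    ℚ.∣ p * q ∣         ≡⟨ ∣p*q∣≡∣p∣*∣q∣ p q ⟩
    ℚ.∣ p ∣ * ℚ.∣ q ∣   ≤⟨ *-monoʳ-≤-nonNeg ℚ.∣ q ∣ {{∣-∣-nonNeg q}} p≤B ⟩
    B * ℚ.∣ q ∣         <⟨ *-monoʳ-<-pos B {{ℚ.positive 0<B}} q<δ ⟩
    B * δ               ∎
    where open ℚ.≤-Reasoning

_*ᴿ_ : ℝ → ℝ → ℝ
seq (x *ᴿ y) n = seq x n * seq y n
cauchy (x *ᴿ y) ε 0<ε =
  let X , 0<X , N₁ , boundX = bounded x
      Y , 0<Y , N₂ , boundY = bounded y
      δ , 0<δ , Xδ = scale X (½ * ε) 0<X (½-pos 0<ε)
      η , 0<η , Yη = scale Y (½ * ε) 0<Y (½-pos 0<ε)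
      N₃ , f = cauchy x η 0<η
      N₄ , g = cauchy y δ 0<δ
      N₁₂ = N₁ ⊔ N₂ ; N₃₄ = N₃ ⊔ N₄
      ≤₁ = λ {k} (h : N₁₂ ⊔ N₃₄ ℕ.≤ k) → ℕ.m⊔n≤o⇒m≤o N₁ N₂ (ℕ.m⊔n≤o⇒m≤o N₁₂ N₃₄ h)
      ≤₂ = λ {k} (h : N₁₂ ⊔ N₃₄ ℕ.≤ k) → ℕ.m⊔n≤o⇒n≤o N₁ N₂ (ℕ.m⊔n≤o⇒m≤o N₁₂ N₃₄ h)
      ≤₃ = λ {k} (h : N₁₂ ⊔ N₃₄ ℕ.≤ k) → ℕ.m⊔n≤o⇒m≤o N₃ N₄ (ℕ.m⊔n≤o⇒n≤o N₁₂ N₃₄ h)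
      ≤₄ = λ {k} (h : N₁₂ ⊔ N₃₄ ℕ.≤ k) → ℕ.m⊔n≤o⇒n≤o N₃ N₄ (ℕ.m⊔n≤o⇒n≤o N₁₂ N₃₄ h)
  in N₁₂ ⊔ N₃₄ , λ m n N≤m N≤n → begin-strict
    ℚ.∣ seq x m * seq y m - seq x n * seq y n ∣
      ≡⟨ cong ℚ.∣_∣ (solve 4 (λ a b c d → (a :* b) :- (c :* d) := (a :* (b :- d)) :+ (d :* (a :- c)))
           refl (seq x m) (seq y m) (seq x n) (seq y n)) ⟩
    ℚ.∣ seq x m * (seq y m - seq y n) + seq y n * (seq x m - seq x n) ∣
      ≤⟨ ∣p+q∣≤∣p∣+∣q∣ (seq x m * (seq y m - seq y n)) (seq y n * (seq x m - seq x n)) ⟩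
    ℚ.∣ seq x m * (seq y m - seq y n) ∣ + ℚ.∣ seq y n * (seq x m - seq x n) ∣
      <⟨ +-mono-<
           (product-< {p = seq x m} 0<X (boundX m (≤₁ N≤m)) (g m n (≤₄ N≤m) (≤₄ N≤n)))
           (product-< {p = seq y n} 0<Y (boundY n (≤₂ N≤n)) (f m n (≤₃ N≤m) (≤₃ N≤n))) ⟩
    X * δ + Y * η
      ≡⟨ cong₂ _+_ Xδ Yη ⟩
    ½ * ε + ½ * ε
      ≡⟨ ½+½ ε ⟩
    ε ∎
  where open ℚ.≤-Reasoning

_/ᴿ_ : ℝ → (k : ℕ) → .{{_ : NonZero k}} → ℝ
x /ᴿ k = x *ᴿ ℚ→ℝ (recip k)

------------------------------------------------------------------------
-- The natural logarithm of a positive integer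

harmonic : ℕ → ℚ
harmonic zero    = 0ℚ
harmonic (suc k) = harmonic k + recip (suc k)

-- With m = i + 1,
--   harmonic (d m) - harmonic m = Σ_{1 ≤ j ≤ (d-1) m} (1/m) · 1 / (1 + j/m)
-- is the right Riemann sum of mesh 1/m for ∫₁ᵈ dt/t = log d.
logApprox : ℕ → ℕ → ℚ
logApprox d i = harmonic (d ℕ.* suc i) - harmonic (suc i)

private
  shift : ∀ q l h → h + ℕ→ℚ (suc l) * q ≡ (h + ℕ→ℚ l * q) + q
  shift q l h = trans (cong (λ t → h + t * q) (ℕ→ℚ-suc l))
    (solve 3 (λ q l h → h :+ (con 1ℚ :+ l) :* q := (h :+ l :* q) :+ q) refl q (ℕ→ℚ l) h)

  harmonic-≥ : ∀ q k l → (∀ j .{{_ : NonZero j}} → j ℕ.≤ k ℕ.+ l → q ≤ recip j) →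
               harmonic k + ℕ→ℚ l * q ≤ harmonic (k ℕ.+ l)
  harmonic-≥ q k zero    _ rewrite ℕ.+-identityʳ k =
    ≤-reflexive (trans (cong (λ t → harmonic k + t) (*-zeroˡ q)) (+-identityʳ (harmonic k)))
  harmonic-≥ q k (suc l) f rewrite ℕ.+-suc k l =
    ≤-trans (≤-reflexive (shift q l (harmonic k)))
      (+-mono-≤ (harmonic-≥ q k l (λ j j≤ → f j (ℕ.m≤n⇒m≤1+n j≤))) (f (suc (k ℕ.+ l)) ℕ.≤-refl))

  harmonic-≤ : ∀ q k l → (∀ j .{{_ : NonZero j}} → k ℕ.≤ j → recip j ≤ q) →
               harmonic (k ℕ.+ l) ≤ harmonic k + ℕ→ℚ l * q
  harmonic-≤ q k zero    _ rewrite ℕ.+-identityʳ k =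
    ≤-reflexive (sym (trans (cong (λ t → harmonic k + t) (*-zeroˡ q)) (+-identityʳ (harmonic k))))
  harmonic-≤ q k (suc l) f rewrite ℕ.+-suc k l =
    ≤-trans (+-mono-≤ (harmonic-≤ q k l f) (f (suc (k ℕ.+ l)) (ℕ.m≤n⇒m≤1+n (ℕ.m≤m+n k l))))
      (≤-reflexive (sym (shift q l (harmonic k))))

  module _ (d : ℕ) .{{_ : NonZero d}} where

    private
      dm≢0 : ∀ i → NonZero (d ℕ.* suc i)
      dm≢0 i = ℕ.m*n≢0 d (suc i)

      next : ∀ i → d ℕ.* suc i ℕ.+ d ≡ d ℕ.* suc (suc i)
      next i = trans (ℕ.+-comm (d ℕ.* suc i) d) (sym (ℕ.*-suc d (suc i)))

      block-≥ : ∀ i → harmonic (d ℕ.* suc i) + recip (suc (suc i)) ≤ harmonic (d ℕ.* suc (suc i))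
      block-≥ i = subst₂ (λ a b → harmonic (d ℕ.* suc i) + a ≤ harmonic b)
        (ℕ→ℚ*recip d (suc (suc i)) {{it}} {{it}} {{dm≢0 (suc i)}}) (next i)
        (harmonic-≥ (recip (d ℕ.* suc (suc i)) {{dm≢0 (suc i)}}) (d ℕ.* suc i) d
          (λ j j≤ → recip-anti {{it}} {{dm≢0 (suc i)}} (subst (j ℕ.≤_) (next i) j≤)))

      block-≤ : ∀ i → harmonic (d ℕ.* suc (suc i)) ≤ harmonic (d ℕ.* suc i) + recip (suc i)
      block-≤ i = subst₂ (λ a b → harmonic b ≤ harmonic (d ℕ.* suc i) + a)
        (ℕ→ℚ*recip d (suc i) {{it}} {{it}} {{dm≢0 i}}) (next i)
        (harmonic-≤ (recip (d ℕ.* suc i) {{dm≢0 i}}) (d ℕ.* suc i) d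
          (λ j ≤j → recip-anti {{dm≢0 i}} {{it}} ≤j))

    lower-step : ∀ i → logApprox d i ≤ logApprox d (suc i)
    lower-step i = subst (_≤ logApprox d (suc i))
      (solve 3 (λ a h r → (a :+ r) :- (h :+ r) := a :- h) refl
        (harmonic (d ℕ.* suc i)) (harmonic (suc i)) (recip (suc (suc i))))
      (+-monoˡ-≤ (- harmonic (suc (suc i))) (block-≥ i))

    upper-step : ∀ i → logApprox d (suc i) + recip (suc (suc i)) ≤ logApprox d i + recip (suc i)
    upper-step i = subst₂ _≤_
      (solve 3 (λ a h r → a :- h := (a :- (h :+ r)) :+ r) refl
        (harmonic (d ℕ.* suc (suc i))) (harmonic (suc i)) (recip (suc (suc i))))
      (solve 3 (λ a h r → (a :+ r) :- h := (a :- h) :+ r) refl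
        (harmonic (d ℕ.* suc i)) (harmonic (suc i)) (recip (suc i)))
      (+-monoˡ-≤ (- harmonic (suc i)) (block-≤ i))

    lower : ∀ i k → logApprox d i ≤ logApprox d (k ℕ.+ i)
    lower i zero    = ≤-refl
    lower i (suc k) = ≤-trans (lower i k) (lower-step (k ℕ.+ i))

    upper : ∀ i k → logApprox d (k ℕ.+ i) + recip (suc (k ℕ.+ i)) ≤ logApprox d i + recip (suc i)
    upper i zero    = ≤-refl
    upper i (suc k) = ≤-trans (upper-step (k ℕ.+ i)) (upper i k)

    p≤p+recip : ∀ p i → p ≤ p + recip (suc i)
    p≤p+recip p i = subst (_≤ p + recip (suc i)) (+-identityʳ p)
      (+-monoʳ-≤ p (nonNegative⁻¹ (recip (suc i)) {{normalize-nonNeg 1 (suc i)}}))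

    close : ∀ N m n → N ℕ.≤ m → N ℕ.≤ n → logApprox d m ≤ logApprox d n + recip (suc N)
    close N m n N≤m N≤n = begin
      logApprox d m                    ≡⟨ cong (logApprox d) (sym (ℕ.m∸n+n≡m N≤m)) ⟩
      logApprox d (m ℕ.∸ N ℕ.+ N)      ≤⟨ p≤p+recip _ (m ℕ.∸ N ℕ.+ N) ⟩
      logApprox d (m ℕ.∸ N ℕ.+ N) + recip (suc (m ℕ.∸ N ℕ.+ N))
                                       ≤⟨ upper N (m ℕ.∸ N) ⟩
      logApprox d N + recip (suc N)    ≤⟨ +-monoˡ-≤ (recip (suc N)) (lower N (n ℕ.∸ N)) ⟩
      logApprox d (n ℕ.∸ N ℕ.+ N) + recip (suc N)
                                       ≡⟨ cong (λ t → logApprox d t + recip (suc N)) (ℕ.m∸n+n≡m N≤n) ⟩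
      logApprox d n + recip (suc N)    ∎
      where open ℚ.≤-Reasoning

log : (d : ℕ) → .{{_ : NonZero d}} → ℝ
seq    (log d) = logApprox d
cauchy (log d) ε 0<ε = let N , r<ε = archimedean ε 0<ε in
  N , λ m n N≤m N≤n →
    ≤-<-trans (distance (close d N m n N≤m N≤n) (close d N n m N≤n N≤m)) r<ε

------------------------------------------------------------------------
-- Labelled graphs

-- A digraph on the vertex set Fin n, given by its out-neighbourhoods. The
-- table is first order, so propositionally distinct tables are exactly the
-- distinct labelled digraphs.
Digraph : ℕ → Set
Digraph n = Vec (Subset n) n

nbhd : ∀ {n} → Digraph n → Fin n → Subset n
nbhd = lookup

Simple : ∀ {n} → Digraph n → Set
Simple G = (∀ u → u ∉ nbhd G u) × (∀ u v → v ∈ nbhd G u → u ∈ nbhd G v)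

Regular : ∀ {n} → ℕ → Digraph n → Set
Regular d G = ∀ u → ∣ nbhd G u ∣ ≡ d

simple? : ∀ {n} (G : Digraph n) → Dec (Simple G)
simple? G = all? (λ u → ¬? (u ∈? nbhd G u))
      ×-dec all? (λ u → all? (λ v → (v ∈? nbhd G u) →-dec (u ∈? nbhd G v)))

regular? : ∀ {n} d (G : Digraph n) → Dec (Regular d G)
regular? d G = all? (λ u → ∣ nbhd G u ∣ ℕ.≟ d)

allVecs : ∀ {A : Set} → List A → (n : ℕ) → List (Vec A n)
allVecs xs zero    = [] ∷ []
allVecs xs (suc n) = cartesianProductWith _∷_ xs (allVecs xs n)

allDigraphs : (n : ℕ) → List (Digraph n)
allDigraphs n = allVecs (allVecs (inside ∷ outside ∷ []) n) n

-- Every simple d-regular graph on Fin n occurs exactly once in this list.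
𝒢 : (n d : ℕ) → List (Digraph n)
𝒢 n d = filter (λ G → simple? G ×-dec regular? d G) (allDigraphs n)

-- ℙ(G ∈ E) ≥ p for G uniform in 𝒢 n d. As E need not be decidable, this is
-- witnessed by a set of graphs in E containing a proportion at least p of 𝒢 n d;
-- sublists of the duplicate-free list 𝒢 n d are its subsets.
ProbabilityAtLeast : ∀ {n} (d : ℕ) → ℚ → (Digraph n → Set) → Set
ProbabilityAtLeast {n} d p E = ∃ λ A → A ⊆ 𝒢 n d × All E A ×
  p * ℕ→ℚ (length (𝒢 n d)) ≤ ℕ→ℚ (length A)

-- n ranges over the values admitted for the given d: n is even if d is odd.
AsymptoticallyAlmostSurely : (d : ℕ) → (∀ {n} → Digraph n → Set) → Set
AsymptoticallyAlmostSurely d E = ∀ δ → 0ℚ < δ → ∃ λ N → ∀ n → N ℕ.≤ n →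
  (¬ (2 ∣ d) → 2 ∣ n) → ProbabilityAtLeast {n} d (1ℚ - δ) E

------------------------------------------------------------------------
-- Zero forcing

-- B is the set of black vertices; v is the unique white neighbour of u.
data Forces {n} (G : Digraph n) : Subset n → Subset n → Set where
  force : ∀ {B u v} → u ∈ B → v ∈ nbhd G u → v ∉ B →
          (∀ w → w ∈ nbhd G u → w ∉ B → w ≡ v) →
          Forces G B (B ∪ ⁅ v ⁆)

ZeroForcingSet : ∀ {n} → Digraph n → Subset n → Set
ZeroForcingSet G S = Star (Forces G) S ⊤

IsZeroForcingNumber : ∀ {n} → Digraph n → ℕ → Set
IsZeroForcingNumber G z =
  (∃ λ S → ZeroForcingSet G S × ∣ S ∣ ≡ z) × (∀ S → ZeroForcingSet G S → z ℕ.≤ ∣ S ∣)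

{-# OPTIONS --safe #-}
module Submission where

open import Defs
open import Data.Bool using (Bool; true; false; _∧_; _∨_; not; _xor_)
open import Data.Bool.Properties using (∨-comm; ∧-comm)
open import Data.Empty using (⊥-elim)
open import Data.Fin using (Fin; zero; suc)
open import Data.Fin.Properties using (all?; any?) renaming (_≟_ to _≟ᶠ_)
open import Data.Fin.Subset using (Subset; ∣_∣; inside; outside; _∈_; _∉_; _⊆_; _∪_; _∩_; ∁; ⁅_⁆; ⊤; ⊥)
open import Data.Fin.Subset.Properties
open import Data.Integer as ℤ using ()
import Data.Integer.Properties as ℤ
open import Data.List using (List; []; _∷_; map; _++_; length; filter; cartesianProduct; cartesianProductWith; allFin)
open import Data.List.Membership.Propositional using () renaming (_∈_ to _∈ˡ_)
open import Data.List.Membership.Propositional.Properties using (∈-cartesianProductWith⁺)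
open import Data.List.Properties using (map-tabulate)
open import Data.List.Relation.Binary.Sublist.Propositional.Properties using (filter-⊆)
import Data.List.Relation.Unary.All as All
open import Data.List.Relation.Unary.All.Properties using (all-filter; filter⁺)
open import Data.List.Relation.Unary.Any as Any using (Any; here; there) renaming (any? to anyˡ?)
open import Data.Nat as ℕ using (ℕ; zero; suc; NonZero; >-nonZero; _≤_; _<_; _+_; _*_; _^_; _∸_; _!; _/_; _%_; z≤n; s≤s)
open import Data.Nat.DivMod using (m*[n/m]≡n; m/n*n≤m; m/n≤m; m*n/n≡m; m≡m%n+[m/n]*n; m%n<n; /-monoˡ-≤; /-monoʳ-≤)
open import Data.Nat.Divisibility using (_∣_; ∣-trans; m∣m*n; m≤n⇒m!∣n!)
open import Data.Nat.Properties
open import Data.Nat.Tactic.RingSolver using (solve-∀)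
open import Data.Product using (∃; _×_; _,_; proj₁; proj₂)
open import Data.Rational as ℚ using (ℚ; mkℚ; 0ℚ; 1ℚ; toℚᵘ)
import Data.Rational.Properties as ℚ
open import Data.Rational.Solver using (module +-*-Solver)
open import Data.Rational.Unnormalised as ℚᵘ using (mkℚᵘ; *≤*; *≡*)
import Data.Rational.Unnormalised.Properties as ℚᵘ
open import Data.Sum using (_⊎_; inj₁; inj₂)
open import Data.Vec as Vec using (Vec; []; _∷_; lookup; here; there)
open import Data.Vec.Properties using ([]=⇒lookup; lookup⇒[]=; lookup∘tabulate)
open import Function using (_∘_; id)
open import Level using (0ℓ)
open import Relation.Binary.Construct.Closure.ReflexiveTransitive using (Star; _◅_) renaming (ε to ε⋆)
open import Relation.Binary.PropositionalEquality
open import Relation.Nullary using (¬_; Dec; yes; no; does)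
open import Relation.Nullary.Decidable using (dec-true; _×-dec_; _→-dec_; ¬?; map′)
open import Relation.Unary using (Pred; Decidable)
open +-*-Solver using (solve; _:=_; _:+_; _:*_; _:-_; con)

-- Both bounds rest on one property of random regular graphs: a.a.s. no two disjoint sets A, B of
-- a ≈ 2(1+ε) n log d / d vertices are without edges between them.
--
-- Lower bound: the first a forcing vertices of a forcing process have no neighbours among the
-- vertices that are then still white, so fewer than 2a forces occur.
--
-- Upper bound: let U be the set of vertices that are neither chosen nor adjacent to a chosen
-- vertex. While |U| ≥ 2a, all but 2a vertices have a neighbour in U, so some vertex v has between 1
-- and about d|U|/n of them. Choose v, let it force one of these neighbours, and delete the others
-- from U. As |U| shrinks from n to 2a, this gives about (n/d)(H_d - H_{8 log d}) forces, twice as many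
-- as required.
--
-- The property: if N_t graphs have t edges between A and B, counting switchings gives
-- N_t λ ≤ N_{t+1} (t+1) with λ ≈ a²d/n, whence N_0 ≤ e^{-λ} |𝒢|, which beats the number of pairs
-- A, B. The constants e and log d enter only through (1+1/d)ᵈ and the harmonic number H_d.

-- Finite sums

-- The switchings act on the simple graphs themselves, so no random model conditioned on simplicity
-- enters, and the combinatorial part consists of inequalities between natural numbers. The number
-- of pairs is at most exp(2a log d + 2n/d). The union bound closes when λ = a²d/n exceeds this
-- exponent, which asks for a slightly above 2 n log d / d; the 2a vertices of a pair then give the
-- constant 4 of the theorem. The term 2n/d is of lower order, as a log d is about n log² d / d. The
-- levels are followed only up to t = T ≈ λ, where the gain λ/(t+1) falls to 1; the product of the
-- gains is (T+1)ᵀ/T!, about eᵀ. Replacing e by E = (1+1/d)ᵈ costs nothing: the three quantities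
-- T!/(T+1)ᵀ, (1+2/d)ⁿ and d²ᵃ are all bounded by powers of the same E, so only exponents have to be
-- compared. The real loss is that d ≤ Eʰ is known for an integer h just above H_d instead of log d;
-- as H_d exceeds log d by at most 1, this is absorbed by ε once d is large.

+-interchange : ∀ a b c d → (a + b) + (c + d) ≡ (a + c) + (b + d)
+-interchange = solve-∀

∑ : {A : Set} → List A → (A → ℕ) → ℕ
∑ []       f = 0
∑ (x ∷ xs) f = f x + ∑ xs f

module _ {A : Set} where

  ∑-cong : (xs : List A) {f g : A → ℕ} → (∀ x → f x ≡ g x) → ∑ xs f ≡ ∑ xs g
  ∑-cong []       f≡g = refl
  ∑-cong (x ∷ xs) f≡g = cong₂ _+_ (f≡g x) (∑-cong xs f≡g)

  ∑-mono : (xs : List A) {f g : A → ℕ} → (∀ x → f x ≤ g x) → ∑ xs f ≤ ∑ xs g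
  ∑-mono []       f≤g = z≤n
  ∑-mono (x ∷ xs) f≤g = +-mono-≤ (f≤g x) (∑-mono xs f≤g)

  ∑-+ : (xs : List A) (f g : A → ℕ) → ∑ xs (λ x → f x + g x) ≡ ∑ xs f + ∑ xs g
  ∑-+ []       f g = refl
  ∑-+ (x ∷ xs) f g = trans (cong (f x + g x +_) (∑-+ xs f g))
                           (+-interchange (f x) (g x) (∑ xs f) (∑ xs g))

  ∑-*ˡ : (xs : List A) (c : ℕ) (f : A → ℕ) → ∑ xs (λ x → c * f x) ≡ c * ∑ xs f
  ∑-*ˡ []       c f = sym (*-zeroʳ c)
  ∑-*ˡ (x ∷ xs) c f = trans (cong (c * f x +_) (∑-*ˡ xs c f)) (sym (*-distribˡ-+ c (f x) (∑ xs f)))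

  ∑-*ʳ : (xs : List A) (c : ℕ) (f : A → ℕ) → ∑ xs (λ x → f x * c) ≡ ∑ xs f * c
  ∑-*ʳ xs c f = trans (∑-cong xs (λ x → *-comm (f x) c)) (trans (∑-*ˡ xs c f) (*-comm c (∑ xs f)))

  ∑-const : (xs : List A) (c : ℕ) → ∑ xs (λ _ → c) ≡ length xs * c
  ∑-const []       c = refl
  ∑-const (x ∷ xs) c = cong (c +_) (∑-const xs c)

  ∑-zero : (xs : List A) → ∑ xs (λ _ → 0) ≡ 0
  ∑-zero xs = trans (∑-const xs 0) (*-zeroʳ (length xs))

  ∑-++ : (xs ys : List A) (f : A → ℕ) → ∑ (xs ++ ys) f ≡ ∑ xs f + ∑ ys f
  ∑-++ []       ys f = refl
  ∑-++ (x ∷ xs) ys f = trans (cong (f x +_) (∑-++ xs ys f)) (sym (+-assoc (f x) _ _))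

  ∑-map : {B : Set} (g : B → A) (ys : List B) (f : A → ℕ) → ∑ (map g ys) f ≡ ∑ ys (f ∘ g)
  ∑-map g []       f = refl
  ∑-map g (y ∷ ys) f = cong (f (g y) +_) (∑-map g ys f)

  ∑-bound : (xs : List A) {f w : A → ℕ} {K W : ℕ} →
            (∀ x → f x ≤ w x * K) → ∑ xs w ≤ W → ∑ xs f ≤ W * K
  ∑-bound xs {f} {w} {K} {W} f≤ w≤ = ≤-trans (∑-mono xs f≤)
    (≤-trans (≤-reflexive (∑-*ʳ xs K w)) (*-monoˡ-≤ K w≤))

∑-swap : {A B : Set} (xs : List A) (ys : List B) (f : A → B → ℕ) →
         ∑ xs (λ x → ∑ ys (f x)) ≡ ∑ ys (λ y → ∑ xs (λ x → f x y))
∑-swap []       ys f = sym (trans (∑-const ys 0) (*-zeroʳ (length ys)))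
∑-swap (x ∷ xs) ys f = trans (cong (∑ ys (f x) +_) (∑-swap xs ys f))
                             (sym (h ys))
  where
  h : ∀ zs → ∑ zs (λ y → f x y + ∑ xs (λ x → f x y)) ≡ ∑ zs (f x) + ∑ zs (λ y → ∑ xs (λ x → f x y))
  h [] = refl
  h (z ∷ zs) = trans (cong (_ +_) (h zs)) (+-interchange (f x z) _ _ _)

∑-cartesian : {A B C : Set} (g : A → B → C) (xs : List A) (ys : List B) (f : C → ℕ) →
              ∑ (cartesianProductWith g xs ys) f ≡ ∑ xs (λ x → ∑ ys (λ y → f (g x y)))
∑-cartesian g []       ys f = refl
∑-cartesian g (x ∷ xs) ys f = trans (∑-++ (map (g x) ys) _ f)
  (cong₂ _+_ (∑-map (g x) ys f) (∑-cartesian g xs ys f))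

⟦_⟧ : Bool → ℕ
⟦ false ⟧ = 0
⟦ true  ⟧ = 1

⟦⟧≤1 : ∀ b → ⟦ b ⟧ ≤ 1
⟦⟧≤1 false = z≤n
⟦⟧≤1 true  = s≤s z≤n

length-filter-∑ : {A : Set} {P : Pred A 0ℓ} (P? : Decidable P) (xs : List A) →
                  length (filter P? xs) ≡ ∑ xs (λ x → ⟦ does (P? x) ⟧)
length-filter-∑ P? [] = refl
length-filter-∑ P? (x ∷ xs) with does (P? x)
... | true  = cong suc (length-filter-∑ P? xs)
... | false = length-filter-∑ P? xs

V : ∀ n → List (Fin n)
V = allFin

∑-V-suc : ∀ {n} (f : Fin (suc n) → ℕ) → ∑ (V (suc n)) f ≡ f zero + ∑ (V n) (f ∘ suc)
∑-V-suc {n} f = cong (f zero +_) (trans (cong (λ l → ∑ l f) (sym (map-tabulate id suc))) (∑-map suc (V n) f))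

_==_ : ∀ {n} → Fin n → Fin n → Bool
u == v = does (u ≟ᶠ v)

∑-δ : ∀ {n} (p : Fin n) (f : Fin n → ℕ) → ∑ (V n) (λ i → ⟦ i == p ⟧ * f i) ≡ f p
∑-δ {suc n} zero f = trans (∑-V-suc (λ i → ⟦ i == zero ⟧ * f i))
  (trans (cong (f zero + 0 +_) (∑-zero (V n))) (trans (+-identityʳ _) (+-identityʳ _)))
∑-δ {suc n} (suc p) f = trans (∑-V-suc (λ i → ⟦ i == suc p ⟧ * f i)) (∑-δ p (f ∘ suc))

length-V : ∀ n → length (V n) ≡ n
length-V n = trans (trans (sym (*-identityʳ _)) (sym (∑-const (V n) 1))) (h n)
  where
  h : ∀ n → ∑ (V n) (λ _ → 1) ≡ n
  h zero = refl
  h (suc n) = trans (∑-V-suc {n} (λ _ → 1)) (cong suc (h n))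

∑-V-const : ∀ n c → ∑ (V n) (λ _ → c) ≡ n * c
∑-V-const n c = trans (∑-const (V n) c) (cong (_* c) (length-V n))

card-∑ : ∀ {n} (p : Subset n) → ∣ p ∣ ≡ ∑ (V n) (λ i → ⟦ lookup p i ⟧)
card-∑ [] = refl
card-∑ {suc n} (true ∷ p) = trans (cong suc (card-∑ p)) (sym (∑-V-suc (λ i → ⟦ lookup (true ∷ p) i ⟧)))
card-∑ {suc n} (false ∷ p) = trans (card-∑ p) (sym (∑-V-suc (λ i → ⟦ lookup (false ∷ p) i ⟧)))

-- Change of variables in sums over all digraphs

Preserves : {A : Set} → List A → (A → A) → Set
Preserves xs g = ∀ f → ∑ xs f ≡ ∑ xs (f ∘ g)

pointwise : ∀ {A : Set} {n} → (Fin n → A → A) → Vec A n → Vec A n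
pointwise g v = Vec.tabulate (λ i → g i (lookup v i))

allVecs-preserved : {A : Set} (xs : List A) → ∀ n (g : Fin n → A → A) →
                    (∀ i → Preserves xs (g i)) → Preserves (allVecs xs n) (pointwise g)
allVecs-preserved xs zero    g inv f = refl
allVecs-preserved xs (suc n) g inv f = begin
  ∑ (allVecs xs (suc n)) f
    ≡⟨ ∑-cartesian _∷_ xs (allVecs xs n) f ⟩
  ∑ xs (λ x → ∑ (allVecs xs n) (λ v → f (x ∷ v)))
    ≡⟨ inv zero (λ x → ∑ (allVecs xs n) (λ v → f (x ∷ v))) ⟩
  ∑ xs (λ x → ∑ (allVecs xs n) (λ v → f (g zero x ∷ v)))
    ≡⟨ ∑-cong xs (λ x → allVecs-preserved xs n (g ∘ suc) (inv ∘ suc) (λ v → f (g zero x ∷ v))) ⟩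
  ∑ xs (λ x → ∑ (allVecs xs n) (λ v → f (g zero x ∷ pointwise (g ∘ suc) v)))
    ≡⟨ ∑-cartesian _∷_ xs (allVecs xs n) (f ∘ pointwise g) ⟨
  ∑ (allVecs xs (suc n)) (f ∘ pointwise g) ∎
  where open ≡-Reasoning

_⊕_ : ∀ {n} → Digraph n → (Fin n → Fin n → Bool) → Digraph n
G ⊕ M = pointwise (λ u → pointwise (λ v b → b xor M u v)) G

-- `Preserves` expresses that a map permutes a list as a multiset. Toggling fixed entries flips bits
-- independently of each other and so permutes all tables; hence a switching with given endpoints is
-- injective, and its inverse on graphs need not be described.
allDigraphs-⊕ : ∀ {n} (M : Fin n → Fin n → Bool) → Preserves (allDigraphs n) (_⊕ M)
allDigraphs-⊕ {n} M = allVecs-preserved _ n (λ u → pointwise (λ v b → b xor M u v))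
  (λ u → allVecs-preserved _ n (λ v b → b xor M u v) (λ v → bit (M u v)))
  where
  bit : ∀ c → Preserves (inside ∷ outside ∷ []) (_xor c)
  bit false f = refl
  bit true  f = trans (cong (f true +_) (+-identityʳ _))
    (trans (+-comm (f true) (f false)) (cong (f false +_) (sym (+-identityʳ _))))

true≢false : ∀ {b} → b ≡ true → ¬ (b ≡ false)
true≢false refl ()

≢true⇒≡false : ∀ {b} → ¬ (b ≡ true) → b ≡ false
≢true⇒≡false {false} _ = refl
≢true⇒≡false {true}  h = ⊥-elim (h refl)

not-true : ∀ {b} → not b ≡ true → b ≡ false
not-true {false} _ = refl

∧-true : ∀ {a b} → a ∧ b ≡ true → a ≡ true × b ≡ true
∧-true {true} h = refl , h

∧-intro : ∀ {a b} → a ≡ true → b ≡ true → a ∧ b ≡ true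
∧-intro refl refl = refl

∨-true : ∀ {a b} → a ∨ b ≡ true → a ≡ true ⊎ b ≡ true
∨-true {true}  h = inj₁ refl
∨-true {false} h = inj₂ h

∨-false : ∀ {a b} → a ∨ b ≡ false → a ≡ false × b ≡ false
∨-false {false} h = refl , h

⟦⟧-mono : ∀ {a b} → (a ≡ true → b ≡ true) → ⟦ a ⟧ ≤ ⟦ b ⟧
⟦⟧-mono {false}         h = z≤n
⟦⟧-mono {true}  {true}  h = s≤s z≤n
⟦⟧-mono {true}  {false} h with h refl
... | ()

does-true : {P : Set} (P? : Dec P) → does P? ≡ true → P
does-true (yes p) _ = p

==-true : ∀ {n} {u v : Fin n} → (u == v) ≡ true → u ≡ v
==-true {u = u} {v} = does-true (u ≟ᶠ v)

==-refl : ∀ {n} (u : Fin n) → (u == u) ≡ true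
==-refl u = dec-true (u ≟ᶠ u) refl

-- Adjacency matrices

module _ {n : ℕ} where

  darts : List (Fin n × Fin n)
  darts = cartesianProduct (V n) (V n)

  ∑-darts : (f : Fin n × Fin n → ℕ) → ∑ darts f ≡ ∑ (V n) (λ u → ∑ (V n) (λ v → f (u , v)))
  ∑-darts = ∑-cartesian _,_ (V n) (V n)

  adj : Digraph n → Fin n → Fin n → Bool
  adj G u v = lookup (lookup G u) v

  lookup-pointwise : {A : Set} (g : Fin n → A → A) (v : Vec A n) (i : Fin n) →
                     lookup (pointwise g v) i ≡ g i (lookup v i)
  lookup-pointwise g v i = lookup∘tabulate (λ i → g i (lookup v i)) i

  adj-⊕ : ∀ G M u v → adj (G ⊕ M) u v ≡ adj G u v xor M u v
  adj-⊕ G M u v = trans (cong (λ r → lookup r v) (lookup-pointwise (λ u → pointwise (λ v b → b xor M u v)) G u))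
                        (lookup-pointwise (λ v b → b xor M u v) (lookup G u) v)

  Irreflexive Symmetric : Digraph n → Set
  Irreflexive G = ∀ u → adj G u u ≡ false
  Symmetric G = ∀ u v → adj G u v ≡ adj G v u

  simple⇒irreflexive : ∀ {G} → Simple G → Irreflexive G
  simple⇒irreflexive {G} s u = ≢true⇒≡false (λ h → proj₁ s u (lookup⇒[]= u (lookup G u) h))

  simple⇒symmetric : ∀ {G} → Simple G → Symmetric G
  simple⇒symmetric {G} s u v with adj G u v in e | adj G v u in e′
  ... | true  | true  = refl
  ... | false | false = refl
  ... | true  | false = ⊥-elim (true≢false ([]=⇒lookup (proj₂ s u v (lookup⇒[]= v _ e))) e′)
  ... | false | true  = ⊥-elim (true≢false ([]=⇒lookup (proj₂ s v u (lookup⇒[]= u _ e′))) e)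

  simple⇐ : ∀ {G} → Irreflexive G → Symmetric G → Simple G
  simple⇐ irr sym′ = (λ u h → true≢false ([]=⇒lookup h) (irr u)) ,
    λ u v h → lookup⇒[]= u _ (trans (sym′ v u) ([]=⇒lookup h))

  deg : Digraph n → Fin n → ℕ
  deg G u = ∑ (V n) (λ v → ⟦ adj G u v ⟧)

  regular⇒deg : ∀ {d G} → Regular d G → ∀ u → deg G u ≡ d
  regular⇒deg {G = G} r u = trans (sym (card-∑ (lookup G u))) (r u)

  deg⇒regular : ∀ {d G} → (∀ u → deg G u ≡ d) → Regular d G
  deg⇒regular {G = G} r u = trans (card-∑ (lookup G u)) (r u)

  -- The degree of a vertex and the number of crossing edges are both of this form for suitable `c`,
  -- so one computation shows how a switching changes either of them.
  weight : (Fin n → Fin n → ℕ) → (Fin n → Fin n → Bool) → ℕ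
  weight c g = ∑ (V n) (λ u → ∑ (V n) (λ v → c u v * ⟦ g u v ⟧))

  edge : Fin n → Fin n → Fin n → Fin n → Bool
  edge p q u v = ((u == p) ∧ (v == q)) ∨ ((u == q) ∧ (v == p))

  edge-true : ∀ p q u v → edge p q u v ≡ true → (u ≡ p × v ≡ q) ⊎ (u ≡ q × v ≡ p)
  edge-true p q u v h with ∨-true {(u == p) ∧ (v == q)} h
  ... | inj₁ h′ = let l , r = ∧-true {u == p} h′ in inj₁ (==-true l , ==-true r)
  ... | inj₂ h′ = let l , r = ∧-true {u == q} h′ in inj₂ (==-true l , ==-true r)

  edge-sym : ∀ p q u v → edge p q u v ≡ edge p q v u
  edge-sym p q u v = trans (∨-comm ((u == p) ∧ (v == q)) _)
    (cong₂ _∨_ (∧-comm (u == q) (v == p)) (∧-comm (u == p) (v == q)))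

  edge-irr : ∀ {p q} → ¬ (p ≡ q) → ∀ u → edge p q u u ≡ false
  edge-irr {p} {q} p≢q u = ≢true⇒≡false λ h → p≢q (f (edge-true p q u u h))
    where
    f : ∀ {p q} → (u ≡ p × u ≡ q) ⊎ (u ≡ q × u ≡ p) → p ≡ q
    f (inj₁ (refl , refl)) = refl
    f (inj₂ (refl , refl)) = refl

  edge-overlap : ∀ p q r s u v → edge p q u v ≡ true → edge r s u v ≡ true →
                 (p ≡ r × q ≡ s) ⊎ (p ≡ s × q ≡ r)
  edge-overlap p q r s u v h h′ with edge-true p q u v h | edge-true r s u v h′
  ... | inj₁ (refl , refl) | inj₁ (refl , refl) = inj₁ (refl , refl)
  ... | inj₁ (refl , refl) | inj₂ (refl , refl) = inj₂ (refl , refl)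
  ... | inj₂ (refl , refl) | inj₁ (refl , refl) = inj₂ (refl , refl)
  ... | inj₂ (refl , refl) | inj₂ (refl , refl) = inj₁ (refl , refl)

  -- Since p and q differ, the two orientations exclude each other, and the disjunction turns into a
  -- sum.
  ⟦edge⟧ : ∀ {p q} → ¬ (p ≡ q) → ∀ u v →
           ⟦ edge p q u v ⟧ ≡ ⟦ u == p ⟧ * ⟦ v == q ⟧ + ⟦ u == q ⟧ * ⟦ v == p ⟧
  ⟦edge⟧ {p} {q} p≢q u v with u == p in e₁ | v == q | u == q in e₂ | v == p
  ... | true  | true  | true  | _     = ⊥-elim (p≢q (trans (sym (==-true {u = u} e₁)) (==-true {u = u} e₂)))
  ... | true  | true  | false | _     = refl
  ... | true  | false | true  | true  = refl
  ... | true  | false | true  | false = refl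
  ... | true  | false | false | _     = refl
  ... | false | _     | true  | true  = refl
  ... | false | _     | true  | false = refl
  ... | false | _     | false | _     = refl

  weight-edge : ∀ c {p q} → ¬ (p ≡ q) → weight c (edge p q) ≡ c p q + c q p
  weight-edge c {p} {q} p≢q = begin
    weight c (edge p q)
      ≡⟨ ∑-cong (V n) (λ u → trans (∑-cong (V n) (λ v → trans (cong (c u v *_) (⟦edge⟧ p≢q u v))
           (expand (c u v) ⟦ u == p ⟧ ⟦ v == q ⟧ ⟦ u == q ⟧ ⟦ v == p ⟧)))
           (trans (∑-+ (V n) _ _) (cong₂ _+_ (row u p q) (row u q p)))) ⟩
    ∑ (V n) (λ u → ⟦ u == p ⟧ * c u q + ⟦ u == q ⟧ * c u p)
      ≡⟨ ∑-+ (V n) _ _ ⟩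
    ∑ (V n) (λ u → ⟦ u == p ⟧ * c u q) + ∑ (V n) (λ u → ⟦ u == q ⟧ * c u p)
      ≡⟨ cong₂ _+_ (∑-δ p (λ u → c u q)) (∑-δ q (λ u → c u p)) ⟩
    c p q + c q p ∎
    where
    open ≡-Reasoning
    expand : ∀ c s t s′ t′ → c * (s * t + s′ * t′) ≡ s * (t * c) + s′ * (t′ * c)
    expand = solve-∀
    row : ∀ u p q → ∑ (V n) (λ v → ⟦ u == p ⟧ * (⟦ v == q ⟧ * c u v)) ≡ ⟦ u == p ⟧ * c u q
    row u p q = trans (∑-*ˡ (V n) ⟦ u == p ⟧ _) (cong (⟦ u == p ⟧ *_) (∑-δ q (c u)))

-- One entry of the adjacency matrix when e₁, e₂, e₃ are deleted and f₁, f₂, f₃ inserted.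
switch-bit : ∀ g e₁ e₂ e₃ f₁ f₂ f₃ →
  (e₁ ∨ e₂ ∨ e₃ ≡ true → g ≡ true) → (f₁ ∨ f₂ ∨ f₃ ≡ true → g ≡ false) →
  ¬ (e₁ ≡ true × e₂ ≡ true) → ¬ (e₁ ≡ true × e₃ ≡ true) → ¬ (e₂ ≡ true × e₃ ≡ true) →
  ¬ (f₁ ≡ true × f₂ ≡ true) → ¬ (f₁ ≡ true × f₃ ≡ true) → ¬ (f₂ ≡ true × f₃ ≡ true) →
  ⟦ g xor ((e₁ ∨ e₂ ∨ e₃) ∨ (f₁ ∨ f₂ ∨ f₃)) ⟧ + (⟦ e₁ ⟧ + ⟦ e₂ ⟧ + ⟦ e₃ ⟧) ≡ ⟦ g ⟧ + (⟦ f₁ ⟧ + ⟦ f₂ ⟧ + ⟦ f₃ ⟧)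
switch-bit true  e₁    e₂    e₃    true  _     _     _ f _ _ _ _ _ _ with f refl
... | ()
switch-bit true  e₁    e₂    e₃    false true  _     _ f _ _ _ _ _ _ with f refl
... | ()
switch-bit true  e₁    e₂    e₃    false false true  _ f _ _ _ _ _ _ with f refl
... | ()
switch-bit true  false false false false false false _ _ _ _ _ _ _ _ = refl
switch-bit true  true  false false false false false _ _ _ _ _ _ _ _ = refl
switch-bit true  false true  false false false false _ _ _ _ _ _ _ _ = refl
switch-bit true  false false true  false false false _ _ _ _ _ _ _ _ = refl
switch-bit true  true  true  _     false false false _ _ n _ _ _ _ _ = ⊥-elim (n (refl , refl))
switch-bit true  true  false true  false false false _ _ _ n _ _ _ _ = ⊥-elim (n (refl , refl))
switch-bit true  false true  true  false false false _ _ _ _ n _ _ _ = ⊥-elim (n (refl , refl))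
switch-bit false true  _     _     _     _     _     e _ _ _ _ _ _ _ with e refl
... | ()
switch-bit false false true  _     _     _     _     e _ _ _ _ _ _ _ with e refl
... | ()
switch-bit false false false true  _     _     _     e _ _ _ _ _ _ _ with e refl
... | ()
switch-bit false false false false false false false _ _ _ _ _ _ _ _ = refl
switch-bit false false false false true  false false _ _ _ _ _ _ _ _ = refl
switch-bit false false false false false true  false _ _ _ _ _ _ _ _ = refl
switch-bit false false false false false false true  _ _ _ _ _ _ _ _ = refl
switch-bit false false false false true  true  _     _ _ _ _ _ n _ _ = ⊥-elim (n (refl , refl))
switch-bit false false false false true  false true  _ _ _ _ _ _ n _ = ⊥-elim (n (refl , refl))
switch-bit false false false false false true  true  _ _ _ _ _ _ _ n = ⊥-elim (n (refl , refl))

-- Switchings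

-- Three edges ax, by, zw are replaced by ab, xz, yw, where a ∈ A and b ∈ B. As z and w avoid
-- A ∪ B, exactly one edge between A and B is gained; replacing just ax, by by ab, xy could
-- gain two.
module Switching {n : ℕ} (A B : Fin n → Bool)
  (disjoint : ∀ u → A u ≡ true → B u ≡ false) where

  D : List (Fin n × Fin n)
  D = darts {n}

  C : Fin n → Bool
  C u = not (A u) ∧ not (B u)

  crossing : Digraph n → ℕ
  crossing G = ∑ D λ (u , v) → ⟦ A u ∧ B v ∧ adj G u v ⟧

  -- The far end of a dart in `α` avoids B and that of a dart in `β` avoids A, so none of the
  -- deleted edges crosses between A and B.
  α β γ : Digraph n → Fin n × Fin n → Bool
  α G (a , x) = A a ∧ not (B x) ∧ adj G a x
  β G (b , y) = B b ∧ not (A y) ∧ adj G b y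
  γ G (z , w) = C z ∧ C w ∧ adj G z w

  -- The ways in which an inserted pair fails to be a new edge: it is an edge already, or it is a
  -- loop. The pair ab cannot be a loop, as A and B are disjoint.
  κ₁ κ₂ κ₃ : Digraph n → Fin n × Fin n → Fin n × Fin n → Bool
  κ₁ G (a , x) (b , y) = adj G a b
  κ₂ G (a , x) (z , w) = adj G x z ∨ (x == z)
  κ₃ G (b , y) (z , w) = adj G y w ∨ (y == w)

  -- `reverse` records only the inserted edges, as seen in the switched graph. Forgetting the other
  -- conditions is harmless, because switchings into a graph are counted from above only.
  valid reverse : Digraph n → Fin n × Fin n → Fin n × Fin n → Fin n × Fin n → Bool
  valid G p q r = α G p ∧ β G q ∧ γ G r ∧ not (κ₁ G p q) ∧ not (κ₂ G p r) ∧ not (κ₃ G q r)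
  reverse G (a , x) (b , y) (z , w) = (A a ∧ B b ∧ adj G a b) ∧ adj G x z ∧ adj G y w

  toggle : Fin n × Fin n → Fin n × Fin n → Fin n × Fin n → Fin n → Fin n → Bool
  toggle (a , x) (b , y) (z , w) u v =
    (edge a x u v ∨ edge b y u v ∨ edge z w u v) ∨ (edge a b u v ∨ edge x z u v ∨ edge y w u v)

  module _ {G : Digraph n} (irr : Irreflexive G) (symm : Symmetric G)
           {a x b y z w : Fin n} (ok : valid G (a , x) (b , y) (z , w) ≡ true) where

    private
      M = toggle (a , x) (b , y) (z , w)
      g = adj G

      αt = proj₁ (∧-true {α G (a , x)} ok)
      ok₁ = proj₂ (∧-true {α G (a , x)} ok)
      βt = proj₁ (∧-true {β G (b , y)} ok₁)
      ok₂ = proj₂ (∧-true {β G (b , y)} ok₁)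
      γt = proj₁ (∧-true {γ G (z , w)} ok₂)
      ok₃ = proj₂ (∧-true {γ G (z , w)} ok₂)
      ok₄ = proj₂ (∧-true {not (κ₁ G (a , x) (b , y))} ok₃)

      Aa = proj₁ (∧-true {A a} αt)
      Bx = not-true (proj₁ (∧-true {not (B x)} (proj₂ (∧-true {A a} αt))))
      ax = proj₂ (∧-true {not (B x)} (proj₂ (∧-true {A a} αt)))
      Bb = proj₁ (∧-true {B b} βt)
      Ay = not-true (proj₁ (∧-true {not (A y)} (proj₂ (∧-true {B b} βt))))
      by = proj₂ (∧-true {not (A y)} (proj₂ (∧-true {B b} βt)))
      Cz = proj₁ (∧-true {C z} γt)
      Cw = proj₁ (∧-true {C w} (proj₂ (∧-true {C z} γt)))
      zw = proj₂ (∧-true {C w} (proj₂ (∧-true {C z} γt)))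
      Az = not-true (proj₁ (∧-true {not (A z)} Cz))
      Bz = not-true (proj₂ (∧-true {not (A z)} Cz))
      Aw = not-true (proj₁ (∧-true {not (A w)} Cw))
      Bw = not-true (proj₂ (∧-true {not (A w)} Cw))
      ab = not-true (proj₁ (∧-true {not (κ₁ G (a , x) (b , y))} ok₃))
      κ₂f = not-true (proj₁ (∧-true {not (κ₂ G (a , x) (z , w))} ok₄))
      κ₃f = not-true (proj₂ (∧-true {not (κ₂ G (a , x) (z , w))} ok₄))
      xz = proj₁ (∨-false {adj G x z} κ₂f)
      yw = proj₁ (∨-false {adj G y w} κ₃f)

      Ba : B a ≡ false
      Ba = disjoint a Aa
      Ab : A b ≡ false
      Ab = ≢true⇒≡false (λ h → true≢false Bb (disjoint b h))

      sep : ∀ {P : Fin n → Bool} {u v} → P u ≡ true → P v ≡ false → ¬ (u ≡ v)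
      sep p q refl = true≢false p q

      adj≢ : ∀ {u v} → adj G u v ≡ true → ¬ (u ≡ v)
      adj≢ {u} h refl = true≢false h (irr u)

      a≢x = adj≢ ax
      b≢y = adj≢ by
      z≢w = adj≢ zw
      a≢b = sep {A} Aa Ab
      x≢z : ¬ (x ≡ z)
      x≢z refl = true≢false (==-refl x) (proj₂ (∨-false {adj G x x} κ₂f))
      y≢w : ¬ (y ≡ w)
      y≢w refl = true≢false (==-refl y) (proj₂ (∨-false {adj G y y} κ₃f))

      apart : ∀ (p q r s u v : Fin n) → ¬ (p ≡ r × q ≡ s) → ¬ (p ≡ s × q ≡ r) →
              ¬ (edge p q u v ≡ true × edge r s u v ≡ true)
      apart p q r s u v h h′ (e , e′) with edge-overlap p q r s u v e e′
      ... | inj₁ k = h k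
      ... | inj₂ k = h′ k

      edge⇒ : ∀ p q u v {c} → g p q ≡ c → edge p q u v ≡ true → g u v ≡ c
      edge⇒ p q u v e h with edge-true p q u v h
      ... | inj₁ (refl , refl) = e
      ... | inj₂ (refl , refl) = trans (symm u v) e

      one-of : ∀ {e₁ e₂ e₃ c} {t : Bool} → (e₁ ≡ true → t ≡ c) → (e₂ ≡ true → t ≡ c) → (e₃ ≡ true → t ≡ c) →
               e₁ ∨ e₂ ∨ e₃ ≡ true → t ≡ c
      one-of {true}          h₁ h₂ h₃ _ = h₁ refl
      one-of {false} {true}  h₁ h₂ h₃ _ = h₂ refl
      one-of {false} {false} h₁ h₂ h₃ e = h₃ e

      -- With z ≠ w known, this is the only way left for the inserted edges xz and yw to coincide.
      -- It would make the deleted edge zw equal to the non-edge xz.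
      wx⇒ : ¬ (x ≡ w × z ≡ y)
      wx⇒ (refl , refl) = true≢false zw (trans (symm y x) xz)

    switch-adj : ∀ u v →
      ⟦ adj (G ⊕ M) u v ⟧ + (⟦ edge a x u v ⟧ + ⟦ edge b y u v ⟧ + ⟦ edge z w u v ⟧)
      ≡ ⟦ adj G u v ⟧ + (⟦ edge a b u v ⟧ + ⟦ edge x z u v ⟧ + ⟦ edge y w u v ⟧)
    switch-adj u v = trans (cong (λ t → ⟦ t ⟧ + (⟦ edge a x u v ⟧ + ⟦ edge b y u v ⟧ + ⟦ edge z w u v ⟧)) (adj-⊕ G M u v))
      (switch-bit (g u v) (edge a x u v) (edge b y u v) (edge z w u v) (edge a b u v) (edge x z u v) (edge y w u v)
        (one-of (edge⇒ a x u v ax) (edge⇒ b y u v by) (edge⇒ z w u v zw))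
        (one-of (edge⇒ a b u v ab) (edge⇒ x z u v xz) (edge⇒ y w u v yw))
        (apart a x b y u v (a≢b ∘ proj₁) (sep {A} Aa Ay ∘ proj₁))
        (apart a x z w u v (sep {A} Aa Az ∘ proj₁) (sep {A} Aa Aw ∘ proj₁))
        (apart b y z w u v (sep {B} Bb Bz ∘ proj₁) (sep {B} Bb Bw ∘ proj₁))
        (apart a b x z u v (a≢x ∘ proj₁) (sep {A} Aa Az ∘ proj₁))
        (apart a b y w u v (sep {A} Aa Ay ∘ proj₁) (sep {A} Aa Aw ∘ proj₁))
        (apart x z y w u v (z≢w ∘ proj₂) wx⇒))

    switch-irreflexive : Irreflexive (G ⊕ M)
    switch-irreflexive u rewrite adj-⊕ G M u u | irr u
      | edge-irr a≢x u | edge-irr b≢y u | edge-irr z≢w u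
      | edge-irr a≢b u | edge-irr x≢z u | edge-irr y≢w u = refl

    switch-symmetric : Symmetric (G ⊕ M)
    switch-symmetric u v rewrite adj-⊕ G M u v | adj-⊕ G M v u | symm u v
      | edge-sym a x u v | edge-sym b y u v | edge-sym z w u v
      | edge-sym a b u v | edge-sym x z u v | edge-sym y w u v = refl

    switch-weight : ∀ c →
      weight c (adj (G ⊕ M)) + ((c a x + c x a) + (c b y + c y b) + (c z w + c w z))
      ≡ weight c (adj G) + ((c a b + c b a) + (c x z + c z x) + (c y w + c w y))
    switch-weight c = begin
      weight c (adj (G ⊕ M)) + ((c a x + c x a) + (c b y + c y b) + (c z w + c w z))
        ≡⟨ cong (weight c (adj (G ⊕ M)) +_) (cong₂ _+_ (cong₂ _+_ (weight-edge c a≢x) (weight-edge c b≢y)) (weight-edge c z≢w)) ⟨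
      weight c (adj (G ⊕ M)) + (weight c (edge a x) + weight c (edge b y) + weight c (edge z w))
        ≡⟨ collect (adj (G ⊕ M)) (edge a x) (edge b y) (edge z w) ⟨
      ∑ (V n) (λ u → ∑ (V n) (λ v → c u v * (⟦ adj (G ⊕ M) u v ⟧ + (⟦ edge a x u v ⟧ + ⟦ edge b y u v ⟧ + ⟦ edge z w u v ⟧))))
        ≡⟨ ∑-cong (V n) (λ u → ∑-cong (V n) (λ v → cong (c u v *_) (switch-adj u v))) ⟩
      ∑ (V n) (λ u → ∑ (V n) (λ v → c u v * (⟦ adj G u v ⟧ + (⟦ edge a b u v ⟧ + ⟦ edge x z u v ⟧ + ⟦ edge y w u v ⟧))))
        ≡⟨ collect (adj G) (edge a b) (edge x z) (edge y w) ⟩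
      weight c (adj G) + (weight c (edge a b) + weight c (edge x z) + weight c (edge y w))
        ≡⟨ cong (weight c (adj G) +_) (cong₂ _+_ (cong₂ _+_ (weight-edge c a≢b) (weight-edge c x≢z)) (weight-edge c y≢w)) ⟩
      weight c (adj G) + ((c a b + c b a) + (c x z + c z x) + (c y w + c w y)) ∎
      where
      open ≡-Reasoning
      sum₂ : (f : Fin n → Fin n → ℕ) → ℕ
      sum₂ f = ∑ (V n) (λ u → ∑ (V n) (f u))
      sum₂-+ : ∀ f h → sum₂ (λ u v → f u v + h u v) ≡ sum₂ f + sum₂ h
      sum₂-+ f h = trans (∑-cong (V n) (λ u → ∑-+ (V n) (f u) (h u))) (∑-+ (V n) _ _)
      collect : ∀ g e₁ e₂ e₃ → ∑ (V n) (λ u → ∑ (V n) (λ v → c u v * (⟦ g u v ⟧ + (⟦ e₁ u v ⟧ + ⟦ e₂ u v ⟧ + ⟦ e₃ u v ⟧))))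
                ≡ weight c g + (weight c e₁ + weight c e₂ + weight c e₃)
      collect g e₁ e₂ e₃ = trans (∑-cong (V n) (λ u → ∑-cong (V n) (λ v →
          distrib (c u v) ⟦ g u v ⟧ ⟦ e₁ u v ⟧ ⟦ e₂ u v ⟧ ⟦ e₃ u v ⟧)))
        (trans (sum₂-+ _ _) (cong (weight c g +_) (trans (sum₂-+ _ _) (cong (_+ weight c e₃) (sum₂-+ _ _)))))
        where
        distrib : ∀ c p q r s → c * (p + (q + r + s)) ≡ c * p + (c * q + c * r + c * s)
        distrib = solve-∀

    -- Each of the six endpoints belongs to one deleted and one inserted edge. The identity is one
    -- between sums of indicators, so coincidences among the endpoints do no harm.
    switch-deg : ∀ u₀ → deg (G ⊕ M) u₀ ≡ deg G u₀
    switch-deg u₀ = +-cancelʳ-≡ _ _ _ (subst₂ (λ s t → s + R ≡ t + R) (row (G ⊕ M)) (row G)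
      (trans (switch-weight c) (cong (weight c (adj G) +_)
        (shuffle ⟦ a == u₀ ⟧ ⟦ x == u₀ ⟧ ⟦ b == u₀ ⟧ ⟦ y == u₀ ⟧ ⟦ z == u₀ ⟧ ⟦ w == u₀ ⟧))))
      where
      c : Fin n → Fin n → ℕ
      c u _ = ⟦ u == u₀ ⟧
      R = (c a x + c x a) + (c b y + c y b) + (c z w + c w z)
      row : ∀ G → weight c (adj G) ≡ deg G u₀
      row G = trans (∑-cong (V n) (λ u → ∑-*ˡ (V n) ⟦ u == u₀ ⟧ _)) (∑-δ u₀ (deg G))
      shuffle : ∀ a x b y z w → (a + b) + (x + z) + (y + w) ≡ (a + x) + (b + y) + (z + w)
      shuffle = solve-∀

    switch-crossing : crossing (G ⊕ M) ≡ suc (crossing G)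
    switch-crossing = begin
      crossing (G ⊕ M)                       ≡⟨ as-weight (G ⊕ M) ⟩
      weight c (adj (G ⊕ M))                 ≡⟨ +-identityʳ _ ⟨
      weight c (adj (G ⊕ M)) + 0             ≡⟨ cong (weight c (adj (G ⊕ M)) +_) removed ⟨
      weight c (adj (G ⊕ M)) + ((c a x + c x a) + (c b y + c y b) + (c z w + c w z))
                                             ≡⟨ switch-weight c ⟩
      weight c (adj G) + ((c a b + c b a) + (c x z + c z x) + (c y w + c w y))
                                             ≡⟨ cong (weight c (adj G) +_) added ⟩
      weight c (adj G) + 1                   ≡⟨ +-comm _ 1 ⟩
      suc (weight c (adj G))                 ≡⟨ cong suc (as-weight G) ⟨
      suc (crossing G)                       ∎
      where
      open ≡-Reasoning
      c : Fin n → Fin n → ℕ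
      c u v = ⟦ A u ∧ B v ⟧
      mult : ∀ p q r → ⟦ p ∧ q ∧ r ⟧ ≡ ⟦ p ∧ q ⟧ * ⟦ r ⟧
      mult true  true  r = sym (+-identityʳ ⟦ r ⟧)
      mult true  false r = refl
      mult false q     r = refl
      as-weight : ∀ G → crossing G ≡ weight c (adj G)
      as-weight G = trans (∑-darts {n} _)
        (∑-cong (V n) (λ u → ∑-cong (V n) (λ v → mult (A u) (B v) (adj G u v))))
      removed : (c a x + c x a) + (c b y + c y b) + (c z w + c w z) ≡ 0
      removed rewrite Aa | Ba | Bx | Bb | Ab | Ay | Az | Bz | Aw with A x | B y
      ... | true  | _ = refl
      ... | false | _ = refl
      added : (c a b + c b a) + (c x z + c z x) + (c y w + c w y) ≡ 1
      added rewrite Aa | Ba | Bx | Bb | Ab | Ay | Az | Bz | Aw with A x | B y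
      ... | true  | _ = refl
      ... | false | _ = refl

    switch-reverse : reverse (G ⊕ M) (a , x) (b , y) (z , w) ≡ true
    switch-reverse = ∧-intro (∧-intro Aa (∧-intro Bb (gain ab (inserted a b (self a b)))))
      (∧-intro (gain xz (inserted′ x z (self x z))) (gain yw (inserted″ y w (self y w))))
      where
      self : ∀ p q → edge p q p q ≡ true
      self p q rewrite ==-refl p | ==-refl q = refl
      or : ∀ s {t} → t ≡ true → s ∨ t ≡ true
      or true  _ = refl
      or false h = h
      inserted : ∀ u v → edge a b u v ≡ true → M u v ≡ true
      inserted u v h = or (edge a x u v ∨ edge b y u v ∨ edge z w u v) (cong (_∨ (edge x z u v ∨ edge y w u v)) h)
      inserted′ : ∀ u v → edge x z u v ≡ true → M u v ≡ true
      inserted′ u v h = or (edge a x u v ∨ edge b y u v ∨ edge z w u v) (or (edge a b u v) (cong (_∨ edge y w u v) h))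
      inserted″ : ∀ u v → edge y w u v ≡ true → M u v ≡ true
      inserted″ u v h = or (edge a x u v ∨ edge b y u v ∨ edge z w u v) (or (edge a b u v) (or (edge x z u v) h))
      gain : ∀ {u v} → adj G u v ≡ false → M u v ≡ true → adj (G ⊕ M) u v ≡ true
      gain {u} {v} h k = trans (adj-⊕ G M u v) (cong₂ _xor_ h k)

-- Counting the switchings out of and into a graph

≤-product : ∀ {x y x′ y′} → (x ≡ true → y ≡ true → x′ ≡ true × y′ ≡ true) → ⟦ x ⟧ * ⟦ y ⟧ ≤ ⟦ x′ ⟧ * ⟦ y′ ⟧
≤-product {false}         h = z≤n
≤-product {true}  {false} h = z≤n
≤-product {true}  {true}  h with h refl refl
... | refl , refl = ≤-refl

∑-darts-flip : ∀ {n} (f : Fin n → Fin n → ℕ) →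
               ∑ darts (λ (u , v) → f u v) ≡ ∑ darts (λ (u , v) → f v u)
∑-darts-flip {n} f = trans (∑-darts {n} _) (trans (∑-swap (V n) (V n) f) (sym (∑-darts {n} _)))

module Counting {n : ℕ} (d a : ℕ) (A B : Fin n → Bool)
  (disjoint : ∀ u → A u ≡ true → B u ≡ false)
  (∣A∣≡a : ∑ (V n) (λ u → ⟦ A u ⟧) ≡ a) (∣B∣≡a : ∑ (V n) (λ u → ⟦ B u ⟧) ≡ a) where

  open Switching A B disjoint

  -- One summand for each of `κ₁`, `κ₂`, `κ₃`. A conflict leaves at most d² choices for the second
  -- dart, respectively (d+1)d for the third, so for a of order n this is of order n² against the n³
  -- triples in total.
  collisions : ℕ
  collisions = (a * d) * ((d * d) * (n * d)) + ((a * d) * ((a * d) * (suc d * d)) + (a * d) * ((a * d) * (suc d * d)))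

  ∑³ : (Fin n × Fin n → Fin n × Fin n → Fin n × Fin n → ℕ) → ℕ
  ∑³ f = ∑ D λ p → ∑ D λ q → ∑ D (f p q)

  module _ {G : Digraph n} (symm : Symmetric G) (deg≡d : ∀ u → deg G u ≡ d) where

    ∑-weighted : ∀ f → ∑ D (λ (u , v) → f u * ⟦ adj G u v ⟧) ≡ ∑ (V n) f * d
    ∑-weighted f = trans (∑-darts {n} _)
      (trans (∑-cong (V n) (λ u → trans (∑-*ˡ (V n) (f u) _) (cong (f u *_) (deg≡d u)))) (∑-*ʳ (V n) d f))

    ∑-weighted′ : ∀ f → ∑ D (λ (u , v) → f v * ⟦ adj G u v ⟧) ≡ ∑ (V n) f * d
    ∑-weighted′ f = trans (∑-darts-flip (λ u v → f v * ⟦ adj G u v ⟧))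
      (trans (∑-cong D (λ (u , v) → cong (λ t → f u * ⟦ t ⟧) (symm v u))) (∑-weighted f))

    ∑-adj : ∑ D (λ (u , v) → ⟦ adj G u v ⟧) ≡ n * d
    ∑-adj = trans (∑-cong D (λ (u , v) → sym (+-identityʳ ⟦ adj G u v ⟧)))
      (trans (∑-weighted (λ _ → 1)) (cong (_* d) (trans (∑-V-const n 1) (*-identityʳ n))))

    private
      split-bit : ∀ s t g → ⟦ s ∧ not t ∧ g ⟧ + ⟦ s ∧ t ∧ g ⟧ ≡ ⟦ s ⟧ * ⟦ g ⟧
      split-bit false t     g = refl
      split-bit true  true  g = sym (+-identityʳ ⟦ g ⟧)
      split-bit true  false g = refl

    ∑-α : ∑ D (λ p → ⟦ α G p ⟧) + crossing G ≡ a * d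
    ∑-α = begin
      ∑ D (λ p → ⟦ α G p ⟧) + crossing G
        ≡⟨ ∑-+ D _ _ ⟨
      ∑ D (λ (u , v) → ⟦ A u ∧ not (B v) ∧ adj G u v ⟧ + ⟦ A u ∧ B v ∧ adj G u v ⟧)
        ≡⟨ ∑-cong D (λ (u , v) → split-bit (A u) (B v) (adj G u v)) ⟩
      ∑ D (λ (u , v) → ⟦ A u ⟧ * ⟦ adj G u v ⟧)
        ≡⟨ ∑-weighted (λ u → ⟦ A u ⟧) ⟩
      ∑ (V n) (λ u → ⟦ A u ⟧) * d
        ≡⟨ cong (_* d) ∣A∣≡a ⟩
      a * d ∎
      where open ≡-Reasoning

    ∑-β : ∑ D (λ p → ⟦ β G p ⟧) + crossing G ≡ a * d
    ∑-β = begin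
      ∑ D (λ p → ⟦ β G p ⟧) + crossing G
        ≡⟨ cong (∑ D (λ p → ⟦ β G p ⟧) +_) (∑-darts-flip (λ u v → ⟦ A u ∧ B v ∧ adj G u v ⟧)) ⟩
      ∑ D (λ p → ⟦ β G p ⟧) + ∑ D (λ (u , v) → ⟦ A v ∧ B u ∧ adj G v u ⟧)
        ≡⟨ ∑-+ D _ _ ⟨
      ∑ D (λ (u , v) → ⟦ B u ∧ not (A v) ∧ adj G u v ⟧ + ⟦ A v ∧ B u ∧ adj G v u ⟧)
        ≡⟨ ∑-cong D (λ (u , v) → trans (cong (⟦ B u ∧ not (A v) ∧ adj G u v ⟧ +_)
             (trans (cong (λ t → ⟦ A v ∧ B u ∧ t ⟧) (symm v u)) (swap-bit (A v) (B u) (adj G u v))))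
             (split-bit (B u) (A v) (adj G u v))) ⟩
      ∑ D (λ (u , v) → ⟦ B u ⟧ * ⟦ adj G u v ⟧)
        ≡⟨ ∑-weighted (λ u → ⟦ B u ⟧) ⟩
      ∑ (V n) (λ u → ⟦ B u ⟧) * d
        ≡⟨ cong (_* d) ∣B∣≡a ⟩
      a * d ∎
      where
      open ≡-Reasoning
      swap-bit : ∀ s t g → ⟦ s ∧ t ∧ g ⟧ ≡ ⟦ t ∧ s ∧ g ⟧
      swap-bit true  true  g = refl
      swap-bit true  false g = refl
      swap-bit false true  g = refl
      swap-bit false false g = refl

    -- A dart outside `γ` starts or ends at one of the 2a vertices of A and B, and each of these has
    -- d darts in either direction.
    ∑-γ : n * d ≤ ∑ D (λ r → ⟦ γ G r ⟧) + 4 * (a * d)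
    ∑-γ = begin
      n * d
        ≡⟨ ∑-adj ⟨
      ∑ D (λ (u , v) → ⟦ adj G u v ⟧)
        ≤⟨ ∑-mono D (λ (u , v) → outside-bit (A u) (B u) (A v) (B v) (adj G u v)) ⟩
      ∑ D (λ (u , v) → ⟦ γ G (u , v) ⟧ + ((⟦ A u ⟧ + ⟦ B u ⟧) * ⟦ adj G u v ⟧ + (⟦ A v ⟧ + ⟦ B v ⟧) * ⟦ adj G u v ⟧))
        ≡⟨ trans (∑-+ D _ _) (cong (∑ D (λ r → ⟦ γ G r ⟧) +_) (trans (∑-+ D _ _)
             (cong₂ _+_ (trans (∑-weighted AB) (cong (_* d) ∣AB∣)) (trans (∑-weighted′ AB) (cong (_* d) ∣AB∣))))) ⟩
      ∑ D (λ r → ⟦ γ G r ⟧) + ((a + a) * d + (a + a) * d)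
        ≡⟨ cong (∑ D (λ r → ⟦ γ G r ⟧) +_) (four a d) ⟩
      ∑ D (λ r → ⟦ γ G r ⟧) + 4 * (a * d) ∎
      where
      open ≤-Reasoning
      AB : Fin n → ℕ
      AB u = ⟦ A u ⟧ + ⟦ B u ⟧
      ∣AB∣ : ∑ (V n) AB ≡ a + a
      ∣AB∣ = trans (∑-+ (V n) _ _) (cong₂ _+_ ∣A∣≡a ∣B∣≡a)
      four : ∀ a d → (a + a) * d + (a + a) * d ≡ 4 * (a * d)
      four = solve-∀
      outside-bit : ∀ s t s′ t′ g → ⟦ g ⟧ ≤ ⟦ (not s ∧ not t) ∧ (not s′ ∧ not t′) ∧ g ⟧ + ((⟦ s ⟧ + ⟦ t ⟧) * ⟦ g ⟧ + (⟦ s′ ⟧ + ⟦ t′ ⟧) * ⟦ g ⟧)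
      outside-bit _     _     _     _     false = z≤n
      outside-bit true  _     _     _     true  = s≤s z≤n
      outside-bit false true  _     _     true  = s≤s z≤n
      outside-bit false false true  _     true  = s≤s z≤n
      outside-bit false false false true  true  = s≤s z≤n
      outside-bit false false false false true  = s≤s z≤n

    private
      α≤ : ∑ D (λ p → ⟦ α G p ⟧) ≤ a * d
      α≤ = m+n≤o⇒m≤o _ (≤-reflexive ∑-α)

      β≤ : ∑ D (λ p → ⟦ β G p ⟧) ≤ a * d
      β≤ = m+n≤o⇒m≤o _ (≤-reflexive ∑-β)

      bit₁ : ∀ s t g → ⟦ s ∧ t ∧ g ⟧ ≤ ⟦ g ⟧
      bit₁ false t     g = z≤n
      bit₁ true  false g = z≤n
      bit₁ true  true  g = ≤-refl

      γ≤adj : ∀ z w → ⟦ γ G (z , w) ⟧ ≤ ⟦ adj G z w ⟧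
      γ≤adj z w = bit₁ (C z) (C w) (adj G z w)

      γ≤ : ∑ D (λ r → ⟦ γ G r ⟧) ≤ n * d
      γ≤ = ≤-trans (∑-mono D (λ (z , w) → γ≤adj z w)) (≤-reflexive ∑-adj)

      near : ∀ x → ∑ (V n) (λ z → ⟦ adj G x z ∨ (x == z) ⟧) ≤ suc d
      near x = begin
        ∑ (V n) (λ z → ⟦ adj G x z ∨ (x == z) ⟧)       ≤⟨ ∑-mono (V n) (λ z → or-bit (adj G x z) z) ⟩
        ∑ (V n) (λ z → ⟦ adj G x z ⟧ + ⟦ z == x ⟧ * 1) ≡⟨ ∑-+ (V n) _ _ ⟩
        deg G x + ∑ (V n) (λ z → ⟦ z == x ⟧ * 1)       ≡⟨ cong₂ _+_ (deg≡d x) (∑-δ x (λ _ → 1)) ⟩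
        d + 1                                          ≡⟨ +-comm d 1 ⟩
        suc d                                          ∎
        where
        open ≤-Reasoning
        or-bit : ∀ s z → ⟦ s ∨ (x == z) ⟧ ≤ ⟦ s ⟧ + ⟦ z == x ⟧ * 1
        or-bit true  z = s≤s z≤n
        or-bit false z = ≤-trans (⟦⟧-mono {x == z} {z == x} (λ h → trans (cong (z ==_) (==-true {u = x} h)) (==-refl z)))
                                 (≤-reflexive (sym (*-identityʳ _)))

      collision₁ : ∑³ (λ p q r → ⟦ α G p ⟧ * ((⟦ β G q ⟧ * ⟦ κ₁ G p q ⟧) * ⟦ γ G r ⟧)) ≤ (a * d) * ((d * d) * (n * d))
      collision₁ = ∑-bound D (λ p → begin
          ∑ D (λ q → ∑ D (λ r → ⟦ α G p ⟧ * ((⟦ β G q ⟧ * ⟦ κ₁ G p q ⟧) * ⟦ γ G r ⟧)))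
            ≡⟨ trans (∑-cong D (λ q → ∑-*ˡ D ⟦ α G p ⟧ _)) (∑-*ˡ D ⟦ α G p ⟧ _) ⟩
          ⟦ α G p ⟧ * ∑ D (λ q → ∑ D (λ r → (⟦ β G q ⟧ * ⟦ κ₁ G p q ⟧) * ⟦ γ G r ⟧))
            ≤⟨ *-monoʳ-≤ ⟦ α G p ⟧ (∑-bound D (λ q → ≤-trans (≤-reflexive (∑-*ˡ D (⟦ β G q ⟧ * ⟦ κ₁ G p q ⟧) _))
                 (*-monoʳ-≤ (⟦ β G q ⟧ * ⟦ κ₁ G p q ⟧) γ≤)) (two-step p)) ⟩
          ⟦ α G p ⟧ * ((d * d) * (n * d)) ∎) α≤
        where
        open ≤-Reasoning
        two-step : ∀ p → ∑ D (λ q → ⟦ β G q ⟧ * ⟦ κ₁ G p q ⟧) ≤ d * d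
        two-step (a , x) = ≤-trans (≤-reflexive (∑-darts {n} _)) (∑-bound (V n) {w = λ b → ⟦ adj G a b ⟧}
          (λ b → ≤-trans (≤-reflexive (∑-*ʳ (V n) ⟦ adj G a b ⟧ _)) (≤-trans
            (*-monoˡ-≤ ⟦ adj G a b ⟧ (≤-trans (∑-mono (V n) (λ y → bit₁ (B b) (not (A y)) (adj G b y))) (≤-reflexive (deg≡d b))))
            (≤-reflexive (*-comm d ⟦ adj G a b ⟧))))
          (≤-reflexive (deg≡d a)))

      collision : ∀ {κ : Fin n × Fin n → Fin n × Fin n → Fin n × Fin n → ℕ} →
                  (∀ p q → ∑ D (λ r → ⟦ γ G r ⟧ * κ p q r) ≤ suc d * d) →
                  ∑³ (λ p q r → ⟦ α G p ⟧ * (⟦ β G q ⟧ * (⟦ γ G r ⟧ * κ p q r))) ≤ (a * d) * ((a * d) * (suc d * d))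
      collision {κ} h = ∑-bound D (λ p → begin
          ∑ D (λ q → ∑ D (λ r → ⟦ α G p ⟧ * (⟦ β G q ⟧ * (⟦ γ G r ⟧ * κ p q r))))
            ≡⟨ trans (∑-cong D (λ q → ∑-*ˡ D ⟦ α G p ⟧ _)) (∑-*ˡ D ⟦ α G p ⟧ _) ⟩
          ⟦ α G p ⟧ * ∑ D (λ q → ∑ D (λ r → ⟦ β G q ⟧ * (⟦ γ G r ⟧ * κ p q r)))
            ≤⟨ *-monoʳ-≤ ⟦ α G p ⟧ (∑-bound D (λ q → ≤-trans (≤-reflexive (∑-*ˡ D ⟦ β G q ⟧ _))
                 (*-monoʳ-≤ ⟦ β G q ⟧ (h p q))) β≤) ⟩
          ⟦ α G p ⟧ * ((a * d) * (suc d * d)) ∎) α≤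
        where open ≤-Reasoning

      collision₂ : ∀ p → ∑ D (λ r → ⟦ γ G r ⟧ * ⟦ κ₂ G p r ⟧) ≤ suc d * d
      collision₂ (a , x) = ≤-trans (≤-reflexive (∑-darts {n} _)) (∑-bound (V n) {w = λ z → ⟦ adj G x z ∨ (x == z) ⟧}
        (λ z → ≤-trans (≤-reflexive (∑-*ʳ (V n) ⟦ adj G x z ∨ (x == z) ⟧ _)) (≤-trans
          (*-monoˡ-≤ ⟦ adj G x z ∨ (x == z) ⟧ (≤-trans (∑-mono (V n) (γ≤adj z)) (≤-reflexive (deg≡d z))))
          (≤-reflexive (*-comm d _))))
        (near x))

      collision₃ : ∀ q → ∑ D (λ r → ⟦ γ G r ⟧ * ⟦ κ₃ G q r ⟧) ≤ suc d * d
      collision₃ (b , y) = ≤-trans (≤-reflexive (trans (∑-darts-flip (λ z w → ⟦ γ G (z , w) ⟧ * ⟦ adj G y w ∨ (y == w) ⟧)) (∑-darts {n} _)))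
        (∑-bound (V n) {w = λ w → ⟦ adj G y w ∨ (y == w) ⟧}
        (λ w → ≤-trans (≤-reflexive (∑-*ʳ (V n) ⟦ adj G y w ∨ (y == w) ⟧ _)) (≤-trans
          (*-monoˡ-≤ ⟦ adj G y w ∨ (y == w) ⟧ (≤-trans (∑-mono (V n) (λ z → γ≤adj z w))
            (≤-reflexive (trans (∑-cong (V n) (λ z → cong ⟦_⟧ (symm z w))) (deg≡d w)))))
          (≤-reflexive (*-comm d _))))
        (near y))

      bit-union : ∀ s t u c₁ c₂ c₃ → ⟦ s ⟧ * (⟦ t ⟧ * ⟦ u ⟧) ≤ ⟦ s ∧ t ∧ u ∧ not c₁ ∧ not c₂ ∧ not c₃ ⟧
        + (⟦ s ⟧ * ((⟦ t ⟧ * ⟦ c₁ ⟧) * ⟦ u ⟧) + (⟦ s ⟧ * (⟦ t ⟧ * (⟦ u ⟧ * ⟦ c₂ ⟧)) + ⟦ s ⟧ * (⟦ t ⟧ * (⟦ u ⟧ * ⟦ c₃ ⟧))))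
      bit-union false _     _     _     _     _     = z≤n
      bit-union true  false _     _     _     _     = z≤n
      bit-union true  true  false _     _     _     = z≤n
      bit-union true  true  true  true  _     _     = s≤s z≤n
      bit-union true  true  true  false true  _     = s≤s z≤n
      bit-union true  true  true  false false true  = s≤s z≤n
      bit-union true  true  true  false false false = s≤s z≤n

      ∑³-+ : ∀ f h → ∑³ (λ p q r → f p q r + h p q r) ≡ ∑³ f + ∑³ h
      ∑³-+ f h = trans (∑-cong D (λ p → trans (∑-cong D (λ q → ∑-+ D _ _)) (∑-+ D _ _))) (∑-+ D _ _)

    valid-count : ∑ D (λ p → ⟦ α G p ⟧) * (∑ D (λ q → ⟦ β G q ⟧) * ∑ D (λ r → ⟦ γ G r ⟧))
                  ≤ ∑³ (λ p q r → ⟦ valid G p q r ⟧) + collisions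
    valid-count = begin
      ∑ D (λ p → ⟦ α G p ⟧) * (∑ D (λ q → ⟦ β G q ⟧) * ∑ D (λ r → ⟦ γ G r ⟧))
        ≡⟨ ∑-*ʳ D _ (λ p → ⟦ α G p ⟧) ⟨
      ∑ D (λ p → ⟦ α G p ⟧ * (∑ D (λ q → ⟦ β G q ⟧) * ∑ D (λ r → ⟦ γ G r ⟧)))
        ≡⟨ ∑-cong D (λ p → trans (cong (⟦ α G p ⟧ *_) (trans (sym (∑-*ʳ D _ (λ q → ⟦ β G q ⟧)))
             (∑-cong D (λ q → sym (∑-*ˡ D ⟦ β G q ⟧ (λ r → ⟦ γ G r ⟧))))))
             (sym (trans (∑-cong D (λ q → ∑-*ˡ D ⟦ α G p ⟧ (λ r → ⟦ β G q ⟧ * ⟦ γ G r ⟧)))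
                         (∑-*ˡ D ⟦ α G p ⟧ _)))) ⟩
      ∑³ (λ p q r → ⟦ α G p ⟧ * (⟦ β G q ⟧ * ⟦ γ G r ⟧))
        ≤⟨ ∑-mono D (λ p → ∑-mono D (λ q → ∑-mono D (λ r →
             bit-union (α G p) (β G q) (γ G r) (κ₁ G p q) (κ₂ G p r) (κ₃ G q r)))) ⟩
      ∑³ (λ p q r → ⟦ valid G p q r ⟧ + (f₁ p q r + (f₂ p q r + f₃ p q r)))
        ≡⟨ trans (∑³-+ (λ p q r → ⟦ valid G p q r ⟧) (λ p q r → f₁ p q r + (f₂ p q r + f₃ p q r)))
             (cong (∑³ (λ p q r → ⟦ valid G p q r ⟧) +_) (trans (∑³-+ f₁ (λ p q r → f₂ p q r + f₃ p q r))
               (cong (∑³ f₁ +_) (∑³-+ f₂ f₃)))) ⟩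
      ∑³ (λ p q r → ⟦ valid G p q r ⟧) + (∑³ f₁ + (∑³ f₂ + ∑³ f₃))
        ≤⟨ +-monoʳ-≤ (∑³ (λ p q r → ⟦ valid G p q r ⟧)) (+-mono-≤ collision₁
             (+-mono-≤ (collision (λ p q → collision₂ p)) (collision (λ p q → collision₃ q)))) ⟩
      ∑³ (λ p q r → ⟦ valid G p q r ⟧) + collisions ∎
      where
      open ≤-Reasoning
      f₁ f₂ f₃ : Fin n × Fin n → Fin n × Fin n → Fin n × Fin n → ℕ
      f₁ p q r = ⟦ α G p ⟧ * ((⟦ β G q ⟧ * ⟦ κ₁ G p q ⟧) * ⟦ γ G r ⟧)
      f₂ p q r = ⟦ α G p ⟧ * (⟦ β G q ⟧ * (⟦ γ G r ⟧ * ⟦ κ₂ G p r ⟧))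
      f₃ p q r = ⟦ α G p ⟧ * (⟦ β G q ⟧ * (⟦ γ G r ⟧ * ⟦ κ₃ G q r ⟧))

    -- Once the crossing edge ab is fixed, xz and yw are two arbitrary darts, with nd choices each.
    reverse-count : ∑³ (λ p q r → ⟦ reverse G p q r ⟧) ≤ crossing G * ((n * d) * (n * d))
    reverse-count = begin
      ∑³ (λ p q r → ⟦ reverse G p q r ⟧)
        ≡⟨ ∑-cong D (λ (a , x) → ∑-cong D (λ (b , y) → trans (∑-darts {n} _)
             (trans (∑-cong (V n) (λ z → ∑-cong (V n) (λ w → mult (A a ∧ B b ∧ adj G a b) (adj G x z) (adj G y w))))
               (inner (⟦ A a ∧ B b ∧ adj G a b ⟧) x y)))) ⟩
      ∑ D (λ (a , x) → ∑ D (λ (b , y) → ⟦ A a ∧ B b ∧ adj G a b ⟧ * (d * d)))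
        ≡⟨ ∑-cong D (λ (a , x) → trans (∑-darts {n} _)
             (trans (∑-cong (V n) (λ b → trans (∑-V-const n _) (move n ⟦ A a ∧ B b ∧ adj G a b ⟧ d))) (∑-*ʳ (V n) (n * (d * d)) _))) ⟩
      ∑ D (λ (a , x) → ∑ (V n) (λ b → ⟦ A a ∧ B b ∧ adj G a b ⟧) * (n * (d * d)))
        ≡⟨ trans (∑-darts {n} _) (trans (∑-cong (V n) (λ a → ∑-V-const n _)) (∑-*ˡ (V n) n _)) ⟩
      n * ∑ (V n) (λ a → ∑ (V n) (λ b → ⟦ A a ∧ B b ∧ adj G a b ⟧) * (n * (d * d)))
        ≡⟨ cong (n *_) (trans (∑-*ʳ (V n) (n * (d * d)) _) (cong (_* (n * (d * d))) (sym (∑-darts {n} _)))) ⟩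
      n * (crossing G * (n * (d * d)))
        ≡⟨ final n (crossing G) d ⟩
      crossing G * ((n * d) * (n * d)) ∎
      where
      open ≤-Reasoning
      mult : ∀ e s t → ⟦ e ∧ s ∧ t ⟧ ≡ ⟦ e ⟧ * (⟦ s ⟧ * ⟦ t ⟧)
      mult false s     t = refl
      mult true  false t = refl
      mult true  true  t = sym (trans (+-identityʳ _) (+-identityʳ _))
      inner : ∀ e x y → ∑ (V n) (λ z → ∑ (V n) (λ w → e * (⟦ adj G x z ⟧ * ⟦ adj G y w ⟧))) ≡ e * (d * d)
      inner e x y = trans (∑-cong (V n) (λ z → trans (∑-*ˡ (V n) e _) (cong (e *_)
          (trans (∑-*ˡ (V n) ⟦ adj G x z ⟧ _) (cong (⟦ adj G x z ⟧ *_) (deg≡d y))))))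
        (trans (∑-*ˡ (V n) e _) (cong (e *_) (trans (∑-*ʳ (V n) d _) (cong (_* d) (deg≡d x)))))
      move : ∀ n e d → n * (e * (d * d)) ≡ e * (n * (d * d))
      move = solve-∀
      final : ∀ n e d → n * (e * (n * (d * d))) ≡ e * ((n * d) * (n * d))
      final = solve-∀

-- Comparison of consecutive levels

module Levels {n : ℕ} (d a T : ℕ) .{{_ : NonZero ((n * d) * (n * d))}} (A B : Fin n → Bool)
  (disjoint : ∀ u → A u ≡ true → B u ≡ false)
  (∣A∣≡a : ∑ (V n) (λ u → ⟦ A u ⟧) ≡ a) (∣B∣≡a : ∑ (V n) (λ u → ⟦ B u ⟧) ≡ a) where

  open Switching A B disjoint
  open Counting d a A B disjoint ∣A∣≡a ∣B∣≡a

  member : Digraph n → Bool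
  member G = does (simple? G ×-dec regular? d G)

  level : ℕ → Digraph n → Bool
  level t G = member G ∧ does (crossing G ℕ.≟ t)

  N : ℕ → ℕ
  N t = ∑ (allDigraphs n) (λ G → ⟦ level t G ⟧)

  private
    K = (n * d) * (n * d)
    Dart = Fin n × Fin n
    Gs = allDigraphs n

  level-true : ∀ t G → level t G ≡ true → (Simple G × Regular d G) × crossing G ≡ t
  level-true t G h = let l , r = ∧-true {member G} h in
    does-true (simple? G ×-dec regular? d G) l , does-true (crossing G ℕ.≟ t) r

  level-intro : ∀ t G → Simple G → Regular d G → crossing G ≡ t → level t G ≡ true
  level-intro t G s r c = ∧-intro (dec-true (simple? G ×-dec regular? d G) (s , r)) (dec-true (crossing G ℕ.≟ t) c)

  -- For fixed darts p, q, r the toggle does not depend on G, so after the change of variables G ↦ G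
  -- ⊕ toggle the claim holds term by term.
  switch : ∀ t p q r → ∑ Gs (λ G → ⟦ level t G ⟧ * ⟦ valid G p q r ⟧) ≤
                       ∑ Gs (λ G → ⟦ level (suc t) G ⟧ * ⟦ reverse G p q r ⟧)
  switch t p@(a , x) q@(b , y) r@(z , w) = ≤-trans
    (∑-mono Gs (λ G → ≤-product {level t G} {valid G p q r} (λ h ok →
      let (s , reg) , c = level-true t G h
          irr = simple⇒irreflexive {G = G} s
          symm = simple⇒symmetric {G = G} s
          G′ = G ⊕ toggle p q r
      in level-intro (suc t) G′
           (simple⇐ {G = G′} (switch-irreflexive {G} irr symm {a} {x} {b} {y} {z} {w} ok)
                             (switch-symmetric {G} irr symm {a} {x} {b} {y} {z} {w} ok))
           (deg⇒regular {G = G′} (λ u → trans (switch-deg {G} irr symm {a} {x} {b} {y} {z} {w} ok u) (regular⇒deg {G = G} reg u)))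
           (trans (switch-crossing {G} irr symm {a} {x} {b} {y} {z} {w} ok) (cong suc c))
       , switch-reverse {G} irr symm {a} {x} {b} {y} {z} {w} ok)))
    (≤-reflexive (sym (allDigraphs-⊕ (toggle p q r) (λ G → ⟦ level (suc t) G ⟧ * ⟦ reverse G p q r ⟧))))

  private
    exchange : ∀ (c : Digraph n → ℕ) (f : Digraph n → Dart → Dart → Dart → ℕ) →
               ∑ Gs (λ G → c G * ∑³ (f G)) ≡ ∑³ (λ p q r → ∑ Gs (λ G → c G * f G p q r))
    exchange c f = begin
      ∑ Gs (λ G → c G * ∑³ (f G))
        ≡⟨ ∑-cong Gs (λ G → sym (trans (∑-cong D (λ p → trans (∑-cong D (λ q → ∑-*ˡ D (c G) _)) (∑-*ˡ D (c G) _)))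
             (∑-*ˡ D (c G) _))) ⟩
      ∑ Gs (λ G → ∑³ (λ p q r → c G * f G p q r))
        ≡⟨ ∑-swap Gs D _ ⟩
      ∑ D (λ p → ∑ Gs (λ G → ∑ D λ q → ∑ D λ r → c G * f G p q r))
        ≡⟨ ∑-cong D (λ p → trans (∑-swap Gs D _) (∑-cong D (λ q → ∑-swap Gs D _))) ⟩
      ∑³ (λ p q r → ∑ Gs (λ G → c G * f G p q r)) ∎
      where open ≡-Reasoning

    ⟦⟧*-mono : ∀ b {k l} → (b ≡ true → k ≤ l) → ⟦ b ⟧ * k ≤ ⟦ b ⟧ * l
    ⟦⟧*-mono false h = z≤n
    ⟦⟧*-mono true  h = *-monoʳ-≤ 1 (h refl)

  module _ (enough : ∀ s g → a * d ≤ s + T → n * d ≤ g + 4 * (a * d) →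
                     suc T * ((n * d) * (n * d)) + collisions ≤ s * (s * g)) where

    -- In `enough`, `s` stands for the number of darts in `α`, which is also the number in `β`, and
    -- `g` for the number in `γ`. Thus T + 1 serves as λ at every graph with at most T crossing
    -- edges.
    many-switches : ∀ t G → t ≤ T → level t G ≡ true → suc T * K ≤ ∑³ (λ p q r → ⟦ valid G p q r ⟧)
    many-switches t G t≤T h = +-cancelʳ-≤ collisions _ _ (begin
      suc T * K + collisions
        ≤⟨ enough (∑ D (λ p → ⟦ α G p ⟧)) (∑ D (λ r → ⟦ γ G r ⟧))
             (≤-trans (≤-reflexive (sym (∑-α {G} symm dg))) (+-monoʳ-≤ (∑ D (λ p → ⟦ α G p ⟧)) (≤-trans (≤-reflexive c) t≤T)))
             (∑-γ {G} symm dg) ⟩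
      ∑ D (λ p → ⟦ α G p ⟧) * (∑ D (λ p → ⟦ α G p ⟧) * ∑ D (λ r → ⟦ γ G r ⟧))
        ≡⟨ cong (λ s → ∑ D (λ p → ⟦ α G p ⟧) * (s * ∑ D (λ r → ⟦ γ G r ⟧)))
             (+-cancelʳ-≡ (crossing G) _ _ (trans (∑-α {G} symm dg) (sym (∑-β {G} symm dg)))) ⟩
      ∑ D (λ p → ⟦ α G p ⟧) * (∑ D (λ q → ⟦ β G q ⟧) * ∑ D (λ r → ⟦ γ G r ⟧))
        ≤⟨ valid-count {G} symm dg ⟩
      ∑³ (λ p q r → ⟦ valid G p q r ⟧) + collisions ∎)
      where
      open ≤-Reasoning
      props = level-true t G h
      symm = simple⇒symmetric {G = G} (proj₁ (proj₁ props))
      dg = regular⇒deg {G = G} (proj₂ (proj₁ props))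
      c = proj₂ props

    -- Double counting: a graph on level t has at least (T+1)K switchings, while a graph on level
    -- t+1 arises from at most (t+1)K of them; the common factor K = (nd)² cancels.
    level-step : ∀ t → t ≤ T → N t * suc T ≤ N (suc t) * suc t
    level-step t t≤T = *-cancelʳ-≤ (N t * suc T) (N (suc t) * suc t) K (begin
      N t * suc T * K
        ≡⟨ trans (*-assoc (N t) (suc T) K) (sym (∑-*ʳ Gs (suc T * K) _)) ⟩
      ∑ Gs (λ G → ⟦ level t G ⟧ * (suc T * K))
        ≤⟨ ∑-mono Gs (λ G → ⟦⟧*-mono (level t G) (many-switches t G t≤T)) ⟩
      ∑ Gs (λ G → ⟦ level t G ⟧ * ∑³ (λ p q r → ⟦ valid G p q r ⟧))
        ≡⟨ exchange (λ G → ⟦ level t G ⟧) (λ G p q r → ⟦ valid G p q r ⟧) ⟩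
      ∑³ (λ p q r → ∑ Gs (λ G → ⟦ level t G ⟧ * ⟦ valid G p q r ⟧))
        ≤⟨ ∑-mono D (λ p → ∑-mono D (λ q → ∑-mono D (λ r → switch t p q r))) ⟩
      ∑³ (λ p q r → ∑ Gs (λ G → ⟦ level (suc t) G ⟧ * ⟦ reverse G p q r ⟧))
        ≡⟨ exchange (λ G → ⟦ level (suc t) G ⟧) (λ G p q r → ⟦ reverse G p q r ⟧) ⟨
      ∑ Gs (λ G → ⟦ level (suc t) G ⟧ * ∑³ (λ p q r → ⟦ reverse G p q r ⟧))
        ≤⟨ ∑-mono Gs (λ G → ⟦⟧*-mono (level (suc t) G) (λ h →
             let (s , reg) , c = level-true (suc t) G h in
             ≤-trans (reverse-count {G} (simple⇒symmetric {G = G} s) (regular⇒deg {G = G} reg)) (≤-reflexive (cong (_* K) c)))) ⟩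
      ∑ Gs (λ G → ⟦ level (suc t) G ⟧ * (suc t * K))
        ≡⟨ trans (∑-*ʳ Gs (suc t * K) _) (sym (*-assoc (N (suc t)) (suc t) K)) ⟩
      N (suc t) * suc t * K ∎)
      where open ≤-Reasoning

    level-chain : ∀ t → t ≤ T → N 0 * suc T ^ t ≤ N t * t !
    level-chain zero    _ = ≤-refl
    level-chain (suc t) t<T = begin
      N 0 * (suc T * suc T ^ t)      ≡⟨ rearrange (N 0) (suc T) (suc T ^ t) ⟩
      N 0 * suc T ^ t * suc T        ≤⟨ *-monoˡ-≤ (suc T) (level-chain t (<⇒≤ t<T)) ⟩
      N t * t ! * suc T              ≡⟨ rearrange′ (N t) (t !) (suc T) ⟩
      N t * suc T * t !              ≤⟨ *-monoˡ-≤ (t !) (level-step t (<⇒≤ t<T)) ⟩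
      N (suc t) * suc t * t !        ≡⟨ *-assoc (N (suc t)) (suc t) (t !) ⟩
      N (suc t) * (suc t * t !)      ∎
      where
      open ≤-Reasoning
      rearrange : ∀ a b c → a * (b * c) ≡ a * c * b
      rearrange = solve-∀
      rearrange′ : ∀ a b c → a * b * c ≡ a * c * b
      rearrange′ = solve-∀

    -- Up to T every step gains a factor (T+1)/(t+1) ≥ 1; there the chain stops and the level is
    -- bounded by the number of all graphs.
    hole-bound : N 0 * suc T ^ T ≤ length (𝒢 n d) * T !
    hole-bound = ≤-trans (level-chain T ≤-refl) (*-monoˡ-≤ (T !) (begin
      N T                           ≤⟨ ∑-mono Gs (λ G → ⟦⟧-mono {level T G} (λ h → proj₁ (∧-true {member G} h))) ⟩
      ∑ Gs (λ G → ⟦ member G ⟧)     ≡⟨ length-filter-∑ (λ G → simple? G ×-dec regular? d G) Gs ⟨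
      length (𝒢 n d)                ∎))
      where open ≤-Reasoning

-- Powers and factorials

^-*-distrib : ∀ m n o → (m * n) ^ o ≡ m ^ o * n ^ o
^-*-distrib m n zero    = refl
^-*-distrib m n (suc o) = trans (cong (m * n *_) (^-*-distrib m n o)) ([m*n]*[o*p]≡[m*o]*[n*p] m n (m ^ o) (n ^ o))

^-cancelˡ-≤ : ∀ m n o .{{_ : NonZero o}} → m ^ o ≤ n ^ o → m ≤ n
^-cancelˡ-≤ m n o h = ≮⇒≥ (λ n<m → <⇒≱ (^-monoˡ-< o n<m) h)

-- Bernoulli's inequality (1 - 1/(y+1))ᵐ⁺¹ ≥ 1 - (m+1)/(y+1) with denominators cleared.
bernoulli : ∀ y m → suc y ^ suc m ≤ y ^ suc m + suc m * suc y ^ m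
bernoulli y zero = ≤-reflexive (eq y)
  where
  eq : ∀ y → suc y * 1 ≡ y * 1 + 1 * 1
  eq = solve-∀
bernoulli y (suc m) = begin
  suc y * suc y ^ suc m                                              ≤⟨ *-monoʳ-≤ (suc y) (bernoulli y m) ⟩
  suc y * (y ^ suc m + suc m * suc y ^ m)                            ≡⟨ expand y (y ^ suc m) (suc m) (suc y ^ m) ⟩
  y * y ^ suc m + (y ^ suc m + suc m * (suc y * suc y ^ m))
    ≤⟨ +-monoʳ-≤ (y * y ^ suc m) (+-monoˡ-≤ (suc m * (suc y * suc y ^ m)) (^-monoˡ-≤ (suc m) (n≤1+n y))) ⟩
  y * y ^ suc m + (suc y ^ suc m + suc m * (suc y * suc y ^ m))      ∎
  where
  open ≤-Reasoning
  expand : ∀ y p k q → suc y * (p + k * q) ≡ y * p + (p + k * (suc y * q))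
  expand = solve-∀

-- (1 + 1/j)ʲ ≤ (1 + 1/(j+1))ʲ⁺¹, by Bernoulli's inequality for 1 - 1/(j+1)².
e-step : ∀ i → let j = suc i in suc j ^ j * suc j ^ suc j ≤ j ^ j * suc (suc j) ^ suc j
e-step i = *-cancelˡ-≤ j (+-cancelʳ-≤ (s ^ j * s ^ suc j) _ _ (begin
    j * (s ^ j * s ^ suc j) + s ^ j * s ^ suc j
      ≡⟨ collect j (s ^ j * s ^ suc j) ⟩
    s * (s ^ j * s ^ suc j)
      ≡⟨ trans (sym (*-assoc s (s ^ j) (s ^ suc j))) (trans (sym (^-*-distrib s s (suc j))) (cong (_^ suc j) (square j))) ⟩
    suc y ^ suc j
      ≤⟨ bernoulli y j ⟩
    y ^ suc j + suc j * suc y ^ j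
      ≡⟨ cong₂ _+_ (trans (^-*-distrib j (suc (suc j)) (suc j)) (*-assoc j (j ^ j) (suc (suc j) ^ suc j)))
           (trans (cong (λ t → s * t ^ j) (sym (square j))) (trans (cong (s *_) (^-*-distrib s s j)) (rotate s (s ^ j)))) ⟩
    j * (j ^ j * suc (suc j) ^ suc j) + s ^ j * s ^ suc j ∎))
  where
  open ≤-Reasoning
  j = suc i
  s = suc j
  y = j * suc (suc j)
  square : ∀ j → suc j * suc j ≡ suc (j * suc (suc j))
  square = solve-∀
  collect : ∀ j p → j * p + p ≡ suc j * p
  collect = solve-∀
  rotate : ∀ s p → s * (p * p) ≡ p * (s * p)
  rotate = solve-∀

-- The monotonicity of (1 + 1/j)ʲ in j with denominators cleared, by iterating `e-step`.
e-mono : ∀ {i k} → suc i ≤ k → suc (suc i) ^ suc i * k ^ k ≤ suc i ^ suc i * suc k ^ k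
e-mono {i} h with m≤n⇒∃[o]m+o≡n h
... | o , refl = go o
  where
  j = suc i
  open ≤-Reasoning
  go : ∀ o → suc j ^ j * (j + o) ^ (j + o) ≤ j ^ j * suc (j + o) ^ (j + o)
  go zero rewrite +-identityʳ i = ≤-reflexive (*-comm (suc j ^ j) (j ^ j))
  go (suc o) rewrite +-suc i o = *-cancelʳ-≤ _ _ (k ^ k * s ^ k) (begin
    suc j ^ j * (s ^ s) * (k ^ k * s ^ k)
      ≡⟨ regroup (suc j ^ j) (s ^ s) (k ^ k) (s ^ k) ⟩
    (suc j ^ j * k ^ k) * (s ^ k * s ^ s)
      ≤⟨ *-mono-≤ (go o) (e-step (i + o)) ⟩
    (j ^ j * s ^ k) * (k ^ k * suc s ^ s)
      ≡⟨ regroup′ (j ^ j) (s ^ k) (k ^ k) (suc s ^ s) ⟩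
    j ^ j * suc s ^ s * (k ^ k * s ^ k) ∎)
    where
    k = suc (i + o)
    s = suc k
    instance
      nz : NonZero (k ^ k * s ^ k)
      nz = m*n≢0 _ _ {{m^n≢0 k k}} {{m^n≢0 s k}}
    regroup : ∀ a b c d → a * b * (c * d) ≡ (a * c) * (d * b)
    regroup = solve-∀
    regroup′ : ∀ a b c d → (a * b) * (c * d) ≡ a * d * (c * b)
    regroup′ = solve-∀

n!≤[1+n]^n : ∀ n → n ! ≤ suc n ^ n
n!≤[1+n]^n zero    = ≤-refl
n!≤[1+n]^n (suc n) = *-mono-≤ (n≤1+n (suc n)) (≤-trans (n!≤[1+n]^n n) (^-monoˡ-≤ n (n≤1+n (suc n))))

module _ (e : ℕ) where

  private
    d = suc e
    x = d ^ d
    y = suc d ^ d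

  -- T! ≤ (T+1)ᵀ / Eᵏ for T = d + k and E = (1 + 1/d)ᵈ = y/x.
  factorial-bound : ∀ k → (d + k) ! * y ^ k ≤ suc (d + k) ^ (d + k) * x ^ k
  factorial-bound zero rewrite +-identityʳ e = *-monoˡ-≤ 1 (n!≤[1+n]^n d)
  factorial-bound (suc k) rewrite +-suc e k = begin
    (t * (T !)) * (y * y ^ k)         ≡⟨ regroup t (T !) y (y ^ k) ⟩
    (T ! * y ^ k) * (t * y)           ≤⟨ *-monoˡ-≤ (t * y) (factorial-bound k) ⟩
    (t ^ T * x ^ k) * (t * y)         ≡⟨ regroup′ (t ^ T) (x ^ k) t y ⟩
    -- Passing from T to t = T + 1 multiplies (T+1)ᵀ/T! by (1+1/t)ᵗ, which is at least E only
    -- because t ≥ d. This is why the induction starts at T = d and the exponent is k instead of T.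
    (y * t ^ t) * x ^ k               ≤⟨ *-monoˡ-≤ (x ^ k) (e-mono {e} {t} (m≤n⇒m≤1+n (m≤m+n d k))) ⟩
    (x * suc t ^ t) * x ^ k           ≡⟨ regroup″ x (suc t ^ t) (x ^ k) ⟩
    suc t ^ t * (x * x ^ k)           ∎
    where
    open ≤-Reasoning
    T = suc (e + k)
    t = suc T
    regroup : ∀ t f y z → (t * f) * (y * z) ≡ (f * z) * (t * y)
    regroup = solve-∀
    regroup′ : ∀ p q t y → (p * q) * (t * y) ≡ (y * (t * p)) * q
    regroup′ = solve-∀
    regroup″ : ∀ x p q → (x * p) * q ≡ p * (x * q)
    regroup″ = solve-∀

  -- E is at least its analogue (1+1/1)¹ = 2. Spare factors E thereby become factors 2, which make
  -- the failure probability small.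
  twice : 2 * x ≤ y
  twice = ≤-trans (e-mono {0} {d} (s≤s z≤n)) (≤-reflexive (+-identityʳ y))

-- scaled Q m = Q · Hₘ when Q is divisible by 1, …, m.
scaled : ℕ → ℕ → ℕ
scaled Q zero    = 0
scaled Q (suc m) = scaled Q m + Q / suc m

-- m + 1 ≤ E^{Hₘ} for E = (1 + 1/d)ᵈ and m ≤ d: telescope m + 1 = ∏ (1 + 1/j) and use (1 + 1/j)ʲ ≤ E.
≤-exp-harmonic : ∀ d Q → (∀ j → j < d → suc j ∣ Q) → ∀ m → m ≤ d →
                 suc m ^ Q * (d ^ d) ^ scaled Q m ≤ (suc d ^ d) ^ scaled Q m
≤-exp-harmonic d Q div zero    _   = ≤-reflexive (trans (*-identityʳ (1 ^ Q)) (^-zeroˡ Q))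
≤-exp-harmonic d Q div (suc m) m<d = *-cancelˡ-≤ (s ^ Q) (begin
    s ^ Q * (suc s ^ Q * x ^ (P + c))
      ≡⟨ cong (λ t → s ^ Q * (suc s ^ Q * t)) (^-distribˡ-+-* x P c) ⟩
    s ^ Q * (suc s ^ Q * (x ^ P * x ^ c))
      ≡⟨ regroup (s ^ Q) (suc s ^ Q) (x ^ P) (x ^ c) ⟩
    (s ^ Q * x ^ P) * (suc s ^ Q * x ^ c)
      ≤⟨ *-mono-≤ (≤-exp-harmonic d Q div m (<⇒≤ m<d)) factor ⟩
    y ^ P * (s ^ Q * y ^ c)
      ≡⟨ regroup′ (y ^ P) (s ^ Q) (y ^ c) ⟩
    s ^ Q * (y ^ P * y ^ c)
      ≡⟨ cong (s ^ Q *_) (^-distribˡ-+-* y P c) ⟨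
    s ^ Q * y ^ (P + c) ∎)
  where
  open ≤-Reasoning
  s = suc m
  c = Q / s
  P = scaled Q m
  x = d ^ d
  y = suc d ^ d
  instance
    nz : NonZero (s ^ Q)
    nz = m^n≢0 s Q
  power : ∀ b z → (b ^ s * z) ^ c ≡ b ^ Q * z ^ c
  power b z = trans (^-*-distrib (b ^ s) z c) (cong (_* z ^ c) (trans (^-*-assoc b s c) (cong (b ^_) (m*[n/m]≡n (div m m<d)))))
  factor : suc s ^ Q * x ^ c ≤ s ^ Q * y ^ c
  factor = subst₂ _≤_ (power (suc s) x) (power s y) (^-monoˡ-≤ c (e-mono {m} {d} m<d))
  regroup : ∀ a b c d → a * (b * (c * d)) ≡ (a * c) * (b * d)
  regroup = solve-∀
  regroup′ : ∀ a b c → a * (b * c) ≡ b * (a * c)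
  regroup′ = solve-∀

-- The Q-th root of the preceding bound, with H_d rounded up to the integer h. Working with Q-th
-- powers keeps the exponents integral until then.
≤-exp : ∀ d Q h .{{_ : NonZero Q}} → (∀ j → j < d → suc j ∣ Q) → scaled Q d ≤ h * Q →
        d * (d ^ d) ^ h ≤ (suc d ^ d) ^ h
≤-exp d Q h div P≤hQ = ^-cancelˡ-≤ _ _ Q (begin
  (d * x ^ h) ^ Q                         ≡⟨ trans (^-*-distrib d (x ^ h) Q) (cong (d ^ Q *_) (exponent x)) ⟩
  d ^ Q * (x ^ P * x ^ r)                 ≡⟨ *-assoc (d ^ Q) (x ^ P) (x ^ r) ⟨
  d ^ Q * x ^ P * x ^ r                   ≤⟨ *-mono-≤ (≤-trans (*-monoˡ-≤ (x ^ P) (^-monoˡ-≤ Q (n≤1+n d)))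
                                               (≤-exp-harmonic d Q div d ≤-refl)) (^-monoˡ-≤ r (^-monoˡ-≤ d (n≤1+n d))) ⟩
  y ^ P * y ^ r                           ≡⟨ exponent y ⟨
  (y ^ h) ^ Q                             ∎)
  where
  open ≤-Reasoning
  x = d ^ d
  y = suc d ^ d
  P = scaled Q d
  r = h * Q ∸ P
  exponent : ∀ z → (z ^ h) ^ Q ≡ z ^ P * z ^ r
  exponent z = trans (^-*-assoc z h Q) (trans (cong (z ^_) (sym (m+[n∸m]≡n P≤hQ))) (^-distribˡ-+-* z P r))

module _ (e : ℕ) where

  private
    d = suc e
    x = d ^ d
    y = suc d ^ d

  -- From d(d+2) ≤ (d+1)² it follows that 1 + 2/d ≤ (1+1/d)², whence (1+2/d)ⁿ ≤ (1+1/d)²ⁿ ≤ Eᶜ.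
  [2+d]^n-bound : ∀ n c → 2 * n ≤ d * c → (2 + d) ^ n * x ^ c ≤ d ^ n * y ^ c
  [2+d]^n-bound n c 2n≤dc = *-cancelˡ-≤ (d ^ n) {{m^n≢0 d n}} (begin
    d ^ n * ((2 + d) ^ n * x ^ c)
      ≡⟨ trans (sym (*-assoc (d ^ n) ((2 + d) ^ n) (x ^ c))) (cong₂ _*_ (sym (^-*-distrib d (2 + d) n)) (split d)) ⟩
    (d * (2 + d)) ^ n * (d ^ (2 * n) * d ^ r)
      ≤⟨ *-mono-≤ (^-monoˡ-≤ n (≤-trans (n≤1+n _) (≤-reflexive (square d)))) (*-monoʳ-≤ (d ^ (2 * n)) (^-monoˡ-≤ r (n≤1+n d))) ⟩
    (suc d ^ 2) ^ n * (d ^ (2 * n) * suc d ^ r)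
      ≡⟨ cong₂ (λ s t → s * (t * suc d ^ r)) (^-*-assoc (suc d) 2 n) (double d n) ⟩
    suc d ^ (2 * n) * (d ^ n * d ^ n * suc d ^ r)
      ≡⟨ regroup (suc d ^ (2 * n)) (d ^ n) (suc d ^ r) ⟩
    d ^ n * (d ^ n * (suc d ^ (2 * n) * suc d ^ r))
      ≡⟨ cong (λ t → d ^ n * (d ^ n * t)) (split (suc d)) ⟨
    d ^ n * (d ^ n * y ^ c) ∎)
    where
    open ≤-Reasoning
    r = d * c ∸ 2 * n
    split : ∀ b → (b ^ d) ^ c ≡ b ^ (2 * n) * b ^ r
    split b = trans (^-*-assoc b d c) (trans (cong (b ^_) (sym (m+[n∸m]≡n 2n≤dc))) (^-distribˡ-+-* b (2 * n) r))
    square : ∀ d → suc (d * (2 + d)) ≡ suc d * (suc d * 1)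
    square = solve-∀
    double : ∀ b n → b ^ (2 * n) ≡ b ^ n * b ^ n
    double b n = trans (cong (b ^_) (cong (n +_) (+-identityʳ n))) (^-distribˡ-+-* b n n)
    regroup : ∀ p q r → p * (q * q * r) ≡ q * (q * (p * r))
    regroup = solve-∀

  -- With E = (1 + 1/d)ᵈ, a fixed pair of sets is a hole with probability at most E^{-k}, the number
  -- of pairs is at most d²ᵃ (1 + 2/d)ⁿ, and d ≤ Eʰ.
  exponent-balance : ∀ {bad L n a h c g k} → let T = d + k in
    bad * suc T ^ T * d ^ n ≤ L * T ! * ((2 + d) ^ n * d ^ (2 * a)) →
    d * x ^ h ≤ y ^ h → 2 * n ≤ d * c → c + h * (2 * a) + g ≤ k → bad * 2 ^ g ≤ L
  exponent-balance {bad} {L} {n} {a} {h} {c} {g} {k} union d≤Eʰ 2n≤dc c≤k = *-cancelʳ-≤ _ _ (x ^ m) {{x^≢0 m}} (begin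
    bad * 2 ^ g * x ^ m                ≡⟨ cong (bad * 2 ^ g *_) (^-distribˡ-+-* x g r) ⟩
    bad * 2 ^ g * (x ^ g * x ^ r)      ≡⟨ regroup₃ bad (2 ^ g) (x ^ g) (x ^ r) ⟩
    bad * (2 ^ g * x ^ g * x ^ r)      ≡⟨ cong (λ t → bad * (t * x ^ r)) (^-*-distrib 2 x g) ⟨
    bad * ((2 * x) ^ g * x ^ r)
      -- Of the m = g + r factors E that are left over, g are bounded below by 2 and r by 1.
      ≤⟨ *-monoʳ-≤ bad (*-mono-≤ (^-monoˡ-≤ g (twice e)) (^-monoˡ-≤ r (^-monoˡ-≤ d (n≤1+n d)))) ⟩
    bad * (y ^ g * y ^ r)              ≡⟨ cong (bad *_) (^-distribˡ-+-* y g r) ⟨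
    bad * y ^ m                        ≤⟨ cancelled ⟩
    L * x ^ m                          ∎)
    where
    open ≤-Reasoning
    T = d + k
    u = h * (2 * a)
    s = c + u
    r = k ∸ (s + g)
    m = g + r
    k≡ : k ≡ s + m
    k≡ = trans (sym (m+[n∸m]≡n c≤k)) (+-assoc s g r)
    x^≢0 : ∀ i → NonZero (x ^ i)
    x^≢0 i = m^n≢0 x i {{m^n≢0 d d}}
    y^≢0 : ∀ i → NonZero (y ^ i)
    y^≢0 i = m^n≢0 y i {{m^n≢0 (suc d) d}}
    W = suc T ^ T
    regroup₁ : ∀ b w p yk xc xu → b * yk * (xc * xu) * (w * p) ≡ (b * w * p) * (yk * (xc * xu))
    regroup₁ = solve-∀
    regroup₂ : ∀ l f p q yk xc xu → (l * f * (p * q)) * (yk * (xc * xu)) ≡ l * ((f * yk) * ((p * xc) * (q * xu)))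
    regroup₂ = solve-∀
    regroup₃ : ∀ b p q r → b * p * (q * r) ≡ b * (p * q * r)
    regroup₃ = solve-∀
    regroup₄ : ∀ l w xk p yc yu → l * ((w * xk) * ((p * yc) * yu)) ≡ l * xk * (yc * yu) * (w * p)
    regroup₄ = solve-∀
    regroup₅ : ∀ b p q r → b * p * (q * r) ≡ b * (q * p) * r
    regroup₅ = solve-∀
    d²ᵃ : d ^ (2 * a) * x ^ u ≤ y ^ u
    d²ᵃ = subst₂ _≤_ (trans (^-*-distrib d (x ^ h) (2 * a)) (cong (d ^ (2 * a) *_) (^-*-assoc x h (2 * a))))
                     (^-*-assoc y h (2 * a)) (^-monoˡ-≤ (2 * a) d≤Eʰ)
    -- With E = y/x this reads bad · Eᵏ ≤ L · Eᶜ⁺ᵘ. It is the product of the bounds on T!, (2+d)ⁿ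
    -- and d²ᵃ, from which the left-hand factors of `union` are cancelled.
    uncancelled : bad * y ^ k * (x ^ c * x ^ u) ≤ L * x ^ k * (y ^ c * y ^ u)
    uncancelled = *-cancelʳ-≤ _ _ (W * d ^ n) {{m*n≢0 W (d ^ n) {{m^n≢0 (suc T) T}} {{m^n≢0 d n}}}} (begin
      bad * y ^ k * (x ^ c * x ^ u) * (W * d ^ n)
        ≡⟨ regroup₁ bad W (d ^ n) (y ^ k) (x ^ c) (x ^ u) ⟩
      (bad * W * d ^ n) * (y ^ k * (x ^ c * x ^ u))
        ≤⟨ *-monoˡ-≤ (y ^ k * (x ^ c * x ^ u)) union ⟩
      (L * T ! * ((2 + d) ^ n * d ^ (2 * a))) * (y ^ k * (x ^ c * x ^ u))
        ≡⟨ regroup₂ L (T !) ((2 + d) ^ n) (d ^ (2 * a)) (y ^ k) (x ^ c) (x ^ u) ⟩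
      L * ((T ! * y ^ k) * (((2 + d) ^ n * x ^ c) * (d ^ (2 * a) * x ^ u)))
        ≤⟨ *-monoʳ-≤ L (*-mono-≤ (factorial-bound e k) (*-mono-≤ ([2+d]^n-bound n c 2n≤dc) d²ᵃ)) ⟩
      L * ((W * x ^ k) * ((d ^ n * y ^ c) * y ^ u))
        ≡⟨ regroup₄ L W (x ^ k) (d ^ n) (y ^ c) (y ^ u) ⟩
      L * x ^ k * (y ^ c * y ^ u) * (W * d ^ n) ∎)
    cancelled : bad * y ^ m ≤ L * x ^ m
    cancelled = *-cancelʳ-≤ _ _ (x ^ s * y ^ s) {{m*n≢0 _ _ {{x^≢0 s}} {{y^≢0 s}}}} (begin
      bad * y ^ m * (x ^ s * y ^ s)        ≡⟨ regroup₅′ bad (y ^ m) (x ^ s) (y ^ s) ⟩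
      bad * (y ^ s * y ^ m) * x ^ s
        ≡⟨ cong₂ (λ p q → bad * p * q) (trans (sym (^-distribˡ-+-* y s m)) (cong (y ^_) (sym k≡))) (^-distribˡ-+-* x c u) ⟩
      bad * y ^ k * (x ^ c * x ^ u)        ≤⟨ uncancelled ⟩
      L * x ^ k * (y ^ c * y ^ u)
        ≡⟨ cong₂ (λ p q → L * p * q) (trans (cong (x ^_) k≡) (^-distribˡ-+-* x s m)) (sym (^-distribˡ-+-* y c u)) ⟩
      L * (x ^ s * x ^ m) * y ^ s          ≡⟨ regroup₅ L (x ^ m) (x ^ s) (y ^ s) ⟨
      L * x ^ m * (x ^ s * y ^ s)          ∎)
      where
      regroup₅′ : ∀ b p q r → b * p * (q * r) ≡ b * (r * p) * q
      regroup₅′ = solve-∀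

-- The union bound over pairs of disjoint vertex sets

-- A word assigns a letter to every vertex and so encodes an ordered pair of sets, 𝒸 marking the
-- vertices in neither. Disjointness is built in, and the pairs form a list over which `∑` can run.
data Letter : Set where
  𝒶 𝒷 𝒸 : Letter

isA isB : Letter → Bool
isA 𝒶 = true
isA 𝒷 = false
isA 𝒸 = false
isB 𝒶 = false
isB 𝒷 = true
isB 𝒸 = false

isA⇒¬isB : ∀ l → isA l ≡ true → isB l ≡ false
isA⇒¬isB 𝒶 _ = refl

letters : List Letter
letters = 𝒶 ∷ 𝒷 ∷ 𝒸 ∷ []

∈-letters : ∀ l → l ∈ˡ letters
∈-letters 𝒶 = here refl
∈-letters 𝒷 = there (here refl)
∈-letters 𝒸 = there (there (here refl))

words : ∀ n → List (Vec Letter n)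
words = allVecs letters

∈-words : ∀ {n} (w : Vec Letter n) → w ∈ˡ words n
∈-words []      = here refl
∈-words (l ∷ w) = ∈-cartesianProductWith⁺ _∷_ (∈-letters l) (∈-words w)

occurrences : (Letter → Bool) → ∀ {n} → Vec Letter n → ℕ
occurrences P {n} w = ∑ (V n) (λ u → ⟦ P (lookup w u) ⟧)

private
  -- The weights of all words sum to (2 + d)ⁿ, and a word with a letters 𝒶 and 𝒷 each weighs dⁿ⁻²ᵃ.
  wt : ℕ → ∀ {n} → Vec Letter n → ℕ
  wt d []      = 1
  wt d (𝒸 ∷ w) = d * wt d w
  wt d (𝒶 ∷ w) = wt d w
  wt d (𝒷 ∷ w) = wt d w

  ∑-wt : ∀ d n → ∑ (words n) (wt d) ≡ (2 + d) ^ n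
  ∑-wt d zero    = refl
  ∑-wt d (suc n) = trans (∑-cartesian _∷_ letters (words n) (wt d))
    (trans (cong (λ t → S + (S + (t + 0))) (∑-*ˡ (words n) d (wt d)))
      (trans (collect S d) (cong ((2 + d) *_) (∑-wt d n))))
    where
    S = ∑ (words n) (wt d)
    collect : ∀ S d → S + (S + (d * S + 0)) ≡ (2 + d) * S
    collect = solve-∀

  wt-balance : ∀ d {n} (w : Vec Letter n) → wt d w * d ^ (occurrences isA w + occurrences isB w) ≡ d ^ n
  wt-balance d [] = refl
  wt-balance d {suc n} (l ∷ w) = trans
    (cong₂ (λ i j → wt d (l ∷ w) * d ^ (i + j)) (∑-V-suc (λ u → ⟦ isA (lookup (l ∷ w) u) ⟧)) (∑-V-suc (λ u → ⟦ isB (lookup (l ∷ w) u) ⟧)))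
    (go l)
    where
    i = occurrences isA w
    j = occurrences isB w
    rotate : ∀ a b c → a * (b * c) ≡ b * (a * c)
    rotate = solve-∀
    first : wt d w * d ^ suc (i + j) ≡ d ^ suc n
    first = trans (rotate (wt d w) d (d ^ (i + j))) (cong (d *_) (wt-balance d w))
    go : ∀ l → wt d (l ∷ w) * d ^ ((⟦ isA l ⟧ + i) + (⟦ isB l ⟧ + j)) ≡ d ^ suc n
    go 𝒶 = first
    go 𝒷 = trans (cong (λ t → wt d w * d ^ t) (+-suc i j)) first
    go 𝒸 = trans (*-assoc d (wt d w) (d ^ (i + j))) (cong (d *_) (wt-balance d w))

∑-filter : {A : Set} {P : Pred A 0ℓ} (P? : Decidable P) (xs : List A) (f : A → ℕ) →
           ∑ (filter P? xs) f ≡ ∑ xs (λ x → ⟦ does (P? x) ⟧ * f x)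
∑-filter P? [] f = refl
∑-filter P? (x ∷ xs) f with does (P? x)
... | true  = cong₂ _+_ (sym (+-identityʳ (f x))) (∑-filter P? xs f)
... | false = ∑-filter P? xs f

any-∑ : {A : Set} {P : Pred A 0ℓ} (P? : Decidable P) (xs : List A) →
        ⟦ does (anyˡ? P? xs) ⟧ ≤ ∑ xs (λ x → ⟦ does (P? x) ⟧)
any-∑ P? [] = z≤n
any-∑ P? (x ∷ xs) with does (P? x)
... | true  = s≤s z≤n
... | false = any-∑ P? xs

NoHole : ∀ {n} → ℕ → Digraph n → Set
NoHole {n} a G = (p q : Subset n) → ∣ p ∣ ≡ a → ∣ q ∣ ≡ a → (∀ {u} → u ∈ p → u ∉ q) →
                 ¬ (∀ {u v} → u ∈ p → v ∈ q → v ∉ nbhd G u)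

module _ {n : ℕ} where

  crossingʷ : Vec Letter n → Digraph n → ℕ
  crossingʷ w = Switching.crossing (λ u → isA (lookup w u)) (λ u → isB (lookup w u))
    (λ u → isA⇒¬isB (lookup w u))

  Balanced : ℕ → Vec Letter n → Set
  Balanced a w = occurrences isA w ≡ a × occurrences isB w ≡ a

  balanced? : ∀ a w → Dec (Balanced a w)
  balanced? a w = (occurrences isA w ℕ.≟ a) ×-dec (occurrences isB w ℕ.≟ a)

  Hole : ℕ → Digraph n → Vec Letter n → Set
  Hole a G w = Balanced a w × crossingʷ w G ≡ 0

  hole? : ∀ a G w → Dec (Hole a G w)
  hole? a G w = balanced? a w ×-dec (crossingʷ w G ℕ.≟ 0)

  -- Deciding the existence of a hole by search through all words allows the good graphs to be
  -- filtered out of `𝒢 n d`; the result is the sublist that `ProbabilityAtLeast` asks for.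
  holed? : ∀ a G → Dec (Any (Hole a G) (words n))
  holed? a G = anyˡ? (hole? a G) (words n)

  ¬holed⇒noHole : ∀ {a G} → ¬ Any (Hole a G) (words n) → NoHole a G
  ¬holed⇒noHole {a} {G} ¬hole p q ∣p∣ ∣q∣ disj empty = ¬hole (Any.map (λ { refl → (countA , countB) , none }) (∈-words w))
    where
    letter : Bool → Bool → Letter
    letter true  _     = 𝒶
    letter false true  = 𝒷
    letter false false = 𝒸
    w : Vec Letter n
    w = Vec.tabulate (λ u → letter (lookup p u) (lookup q u))
    isA-letter : ∀ s t → isA (letter s t) ≡ s
    isA-letter true  t     = refl
    isA-letter false true  = refl
    isA-letter false false = refl
    isB-letter : ∀ s t → ¬ (s ≡ true × t ≡ true) → isB (letter s t) ≡ t
    isB-letter true  true  h = ⊥-elim (h (refl , refl))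
    isB-letter true  false h = refl
    isB-letter false true  h = refl
    isB-letter false false h = refl
    look : ∀ u → lookup w u ≡ letter (lookup p u) (lookup q u)
    look = lookup∘tabulate (λ u → letter (lookup p u) (lookup q u))
    A≡ : ∀ u → isA (lookup w u) ≡ lookup p u
    A≡ u = trans (cong isA (look u)) (isA-letter (lookup p u) (lookup q u))
    B≡ : ∀ u → isB (lookup w u) ≡ lookup q u
    B≡ u = trans (cong isB (look u)) (isB-letter (lookup p u) (lookup q u)
      (λ (s , t) → disj (lookup⇒[]= u p s) (lookup⇒[]= u q t)))
    countA : occurrences isA w ≡ a
    countA = trans (∑-cong (V n) (λ u → cong ⟦_⟧ (A≡ u))) (trans (sym (card-∑ p)) ∣p∣)
    countB : occurrences isB w ≡ a
    countB = trans (∑-cong (V n) (λ u → cong ⟦_⟧ (B≡ u))) (trans (sym (card-∑ q)) ∣q∣)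
    zero-bit : ∀ s t g → ¬ (s ≡ true × t ≡ true × g ≡ true) → ⟦ s ∧ t ∧ g ⟧ ≡ 0
    zero-bit true  true  true  h = ⊥-elim (h (refl , refl , refl))
    zero-bit true  true  false h = refl
    zero-bit true  false g     h = refl
    zero-bit false t     g     h = refl
    none : crossingʷ w G ≡ 0
    none = trans (∑-cong darts (λ (u , v) → zero-bit _ _ _ (λ (s , t , g) →
      empty {u} {v} (lookup⇒[]= u p (trans (sym (A≡ u)) s)) (lookup⇒[]= v q (trans (sym (B≡ v)) t)) (lookup⇒[]= v _ g))))
      (∑-zero (darts {n}))

  #holed : ℕ → ℕ → ℕ
  #holed d a = ∑ (𝒢 n d) (λ G → ⟦ does (holed? a G) ⟧)

  -- The switching bound for one balanced word, summed over these words. Comparing their weights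
  -- with the total weight takes the place of an estimate of a multinomial coefficient.
  union-bound : ∀ d a T .{{_ : NonZero ((n * d) * (n * d))}} →
    (∀ s g → a * d ≤ s + T → n * d ≤ g + 4 * (a * d) →
      suc T * ((n * d) * (n * d)) + ((a * d) * ((d * d) * (n * d)) +
        ((a * d) * ((a * d) * (suc d * d)) + (a * d) * ((a * d) * (suc d * d)))) ≤ s * (s * g)) →
    #holed d a * suc T ^ T * d ^ n ≤ length (𝒢 n d) * T ! * ((2 + d) ^ n * d ^ (2 * a))
  union-bound d a T enough = begin
    #holed d a * X * d ^ n
      ≤⟨ *-monoˡ-≤ (d ^ n) (*-monoˡ-≤ X (∑-mono (𝒢 n d) (λ G → any-∑ (hole? a G) (words n)))) ⟩
    ∑ (𝒢 n d) (λ G → ∑ (words n) (λ w → ⟦ does (hole? a G w) ⟧)) * X * d ^ n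
      ≡⟨ cong (λ t → t * X * d ^ n) (∑-swap (𝒢 n d) (words n) _) ⟩
    ∑ (words n) (λ w → ∑ (𝒢 n d) (λ G → ⟦ does (hole? a G w) ⟧)) * X * d ^ n
      ≡⟨ cong (_* d ^ n) (∑-*ʳ (words n) X _) ⟨
    ∑ (words n) (λ w → ∑ (𝒢 n d) (λ G → ⟦ does (hole? a G w) ⟧) * X) * d ^ n
      ≤⟨ *-monoˡ-≤ (d ^ n) (∑-mono (words n) per-word) ⟩
    ∑ (words n) (λ w → ⟦ does (balanced? a w) ⟧ * (L * F)) * d ^ n
      ≡⟨ cong (_* d ^ n) (∑-*ʳ (words n) (L * F) _) ⟩
    ∑ (words n) (λ w → ⟦ does (balanced? a w) ⟧) * (L * F) * d ^ n
      ≡⟨ regroup (∑ (words n) (λ w → ⟦ does (balanced? a w) ⟧)) (L * F) (d ^ n) ⟩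
    L * F * (∑ (words n) (λ w → ⟦ does (balanced? a w) ⟧) * d ^ n)
      ≤⟨ *-monoʳ-≤ (L * F) balanced-words ⟩
    L * F * ((2 + d) ^ n * d ^ (2 * a)) ∎
    where
    open ≤-Reasoning
    X = suc T ^ T
    L = length (𝒢 n d)
    F = T !
    regroup : ∀ s l p → s * l * p ≡ l * (s * p)
    regroup = solve-∀
    ∧-bit : ∀ m b h → ⟦ m ⟧ * ⟦ b ∧ h ⟧ ≡ ⟦ b ⟧ * ⟦ m ∧ h ⟧
    ∧-bit true  true  h = refl
    ∧-bit true  false h = refl
    ∧-bit false true  h = refl
    ∧-bit false false h = refl
    per-word : ∀ w → ∑ (𝒢 n d) (λ G → ⟦ does (hole? a G w) ⟧) * X ≤ ⟦ does (balanced? a w) ⟧ * (L * F)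
    per-word w = ≤-trans (≤-reflexive (trans (cong (_* X) (trans
        (∑-filter (λ G → simple? G ×-dec regular? d G) (allDigraphs n) _)
        (trans (∑-cong (allDigraphs n) (λ G → ∧-bit (does (simple? G ×-dec regular? d G)) (does (balanced? a w)) (does (crossingʷ w G ℕ.≟ 0))))
          (∑-*ˡ (allDigraphs n) ⟦ does (balanced? a w) ⟧ _))))
        (*-assoc ⟦ does (balanced? a w) ⟧ _ X)))
      (bounded (balanced? a w))
      where
      bounded : (b : Dec (Balanced a w)) →
        ⟦ does b ⟧ * (∑ (allDigraphs n) (λ G → ⟦ does (simple? G ×-dec regular? d G) ∧ does (crossingʷ w G ℕ.≟ 0) ⟧) * X) ≤ ⟦ does b ⟧ * (L * F)
      bounded (no _) = z≤n
      bounded (yes (∣A∣ , ∣B∣)) = *-monoʳ-≤ 1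
        (Levels.hole-bound d a T (λ u → isA (lookup w u)) (λ u → isB (lookup w u)) (λ u → isA⇒¬isB (lookup w u)) ∣A∣ ∣B∣ enough)
    balanced-words : ∑ (words n) (λ w → ⟦ does (balanced? a w) ⟧) * d ^ n ≤ (2 + d) ^ n * d ^ (2 * a)
    balanced-words = begin
      ∑ (words n) (λ w → ⟦ does (balanced? a w) ⟧) * d ^ n
        ≡⟨ ∑-*ʳ (words n) (d ^ n) _ ⟨
      ∑ (words n) (λ w → ⟦ does (balanced? a w) ⟧ * d ^ n)
        ≤⟨ ∑-mono (words n) (λ w → weigh w (balanced? a w)) ⟩
      ∑ (words n) (λ w → wt d w * d ^ (2 * a))
        ≡⟨ trans (∑-*ʳ (words n) (d ^ (2 * a)) (wt d)) (cong (_* d ^ (2 * a)) (∑-wt d n)) ⟩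
      (2 + d) ^ n * d ^ (2 * a) ∎
      where
      weigh : ∀ w (b : Dec (Balanced a w)) → ⟦ does b ⟧ * d ^ n ≤ wt d w * d ^ (2 * a)
      weigh w (no _) = z≤n
      weigh w (yes (∣A∣ , ∣B∣)) = ≤-reflexive (trans (+-identityʳ (d ^ n)) (trans (sym (wt-balance d w))
        (cong (λ t → wt d w * d ^ t) (cong₂ _+_ ∣A∣ (trans ∣B∣ (sym (+-identityʳ a)))))))

-- Zero forcing

∣p∪⁅x⁆∣ : ∀ {n} {p : Subset n} {x} → x ∉ p → ∣ p ∪ ⁅ x ⁆ ∣ ≡ suc ∣ p ∣
∣p∪⁅x⁆∣ {p = true  ∷ p} {zero}  x∉p = ⊥-elim (x∉p here)
∣p∪⁅x⁆∣ {p = false ∷ p} {zero}  x∉p = cong (suc ∘ ∣_∣) (∪-identityʳ p)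
∣p∪⁅x⁆∣ {p = true  ∷ p} {suc x} x∉p = cong suc (∣p∪⁅x⁆∣ (x∉p ∘ there))
∣p∪⁅x⁆∣ {p = false ∷ p} {suc x} x∉p = ∣p∪⁅x⁆∣ (x∉p ∘ there)

∁-∪-⁅⁆ : ∀ {n} {p : Subset n} {x} → x ∉ p → ∁ (p ∪ ⁅ x ⁆) ∪ ⁅ x ⁆ ≡ ∁ p
∁-∪-⁅⁆ {p = true  ∷ p} {zero}  x∉p = ⊥-elim (x∉p here)
∁-∪-⁅⁆ {p = false ∷ p} {zero}  x∉p = cong (true ∷_) (trans (∪-identityʳ _) (cong ∁ (∪-identityʳ p)))
∁-∪-⁅⁆ {p = true  ∷ p} {suc x} x∉p = cong (false ∷_) (∁-∪-⁅⁆ (x∉p ∘ there))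
∁-∪-⁅⁆ {p = false ∷ p} {suc x} x∉p = cong (true ∷_) (∁-∪-⁅⁆ (x∉p ∘ there))

subset-of-size : ∀ {n} (p : Subset n) k → k ≤ ∣ p ∣ → ∃ λ q → q ⊆ p × ∣ q ∣ ≡ k
subset-of-size []          zero    _ = [] , id , refl
subset-of-size (false ∷ p) k       h = let q , q⊆p , ∣q∣ = subset-of-size p k h in
  false ∷ q , (λ { (there x) → there (q⊆p x) }) , ∣q∣
subset-of-size (true ∷ p) zero    _ = let q , q⊆p , ∣q∣ = subset-of-size p 0 z≤n in
  false ∷ q , (λ { (there x) → there (q⊆p x) }) , ∣q∣
subset-of-size (true ∷ p) (suc k) (s≤s h) = let q , q⊆p , ∣q∣ = subset-of-size p k h in
  true ∷ q , (λ { here → here ; (there x) → there (q⊆p x) }) , cong suc ∣q∣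

∣p∣≤∣p∩∁q∣+∣q∣ : ∀ {n} (p q : Subset n) → ∣ p ∣ ≤ ∣ p ∩ ∁ q ∣ + ∣ q ∣
∣p∣≤∣p∩∁q∣+∣q∣ []          []          = z≤n
∣p∣≤∣p∩∁q∣+∣q∣ (true  ∷ p) (false ∷ q) = s≤s (∣p∣≤∣p∩∁q∣+∣q∣ p q)
∣p∣≤∣p∩∁q∣+∣q∣ (false ∷ p) (false ∷ q) = ∣p∣≤∣p∩∁q∣+∣q∣ p q
∣p∣≤∣p∩∁q∣+∣q∣ (true  ∷ p) (true  ∷ q) = ≤-trans (s≤s (∣p∣≤∣p∩∁q∣+∣q∣ p q)) (≤-reflexive (sym (+-suc _ _)))
∣p∣≤∣p∩∁q∣+∣q∣ (false ∷ p) (true  ∷ q) = ≤-trans (∣p∣≤∣p∩∁q∣+∣q∣ p q) (+-monoʳ-≤ ∣ p ∩ ∁ q ∣ (n≤1+n ∣ q ∣))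

∣∁p∣+∣p∣ : ∀ {n} (p : Subset n) → ∣ ∁ p ∣ + ∣ p ∣ ≡ n
∣∁p∣+∣p∣ p = trans (cong (_+ ∣ p ∣) (∣∁p∣≡n∸∣p∣ p)) (m∸n+n≡m (∣p∣≤n p))

least : {P : ℕ → Set} → (∀ z → Dec (P z)) → ∀ n → P n → ∃ λ z → P z × (∀ z′ → P z′ → z ≤ z′)
least {P} P? n Pn = go n 0 (λ _ ()) (subst P (sym (+-identityʳ n)) Pn)
  where
  go : ∀ k z → (∀ z′ → z′ < z → ¬ P z′) → P (k + z) → ∃ λ z → P z × (∀ z′ → P z′ → z ≤ z′)
  go k z none Pkz with P? z
  ... | yes Pz = z , Pz , λ z′ Pz′ → ≮⇒≥ (λ z′<z → none z′ z′<z Pz′)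
  go zero    z none Pkz | no ¬Pz = ⊥-elim (¬Pz Pkz)
  go (suc k) z none Pkz | no ¬Pz = go k (suc z) next (subst P (sym (+-suc k z)) Pkz)
    where
    next : ∀ z′ → z′ < suc z → ¬ P z′
    next z′ (s≤s z′≤z) Pz′ with m≤n⇒m<n∨m≡n z′≤z
    ... | inj₁ z′<z = none z′ z′<z Pz′
    ... | inj₂ refl = ¬Pz Pz′

module _ {n : ℕ} (G : Digraph n) where

  ForcedBy : Subset n → Fin n → Fin n → Set
  ForcedBy S u v = u ∈ S × v ∈ nbhd G u × v ∉ S × (∀ w → w ∈ nbhd G u → w ∉ S → w ≡ v)

  forcedBy? : ∀ S u v → Dec (ForcedBy S u v)
  forcedBy? S u v = (u ∈? S) ×-dec (v ∈? nbhd G u) ×-dec ¬? (v ∈? S) ×-dec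
    all? (λ w → (w ∈? nbhd G u) →-dec (¬? (w ∈? S) →-dec (w ≟ᶠ v)))

  -- Search through all possible forces, by recursion on a bound `k` for the number of white
  -- vertices, which every force lowers. This decision makes the minimum in `zeroForcingNumber`
  -- exist constructively.
  zeroForcingSet? : ∀ S → Dec (ZeroForcingSet G S)
  zeroForcingSet? S = go n S (m≤n+m n ∣ S ∣)
    where
    go : ∀ k S → n ≤ ∣ S ∣ + k → Dec (ZeroForcingSet G S)
    go zero S full = yes (subst (λ T → Star (Forces G) S T)
      (∣p∣≡n⇒p≡⊤ (≤-antisym (∣p∣≤n S) (≤-trans full (≤-reflexive (+-identityʳ ∣ S ∣))))) ε⋆)
    go (suc k) S room with any? (λ u → any? (λ v → via u v))
      where
      via : ∀ u v → Dec (ForcedBy S u v × ZeroForcingSet G (S ∪ ⁅ v ⁆))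
      via u v with forcedBy? S u v
      ... | no ¬f = no (¬f ∘ proj₁)
      ... | yes f@(_ , _ , v∉S , _) = map′ (f ,_) proj₂ (go k (S ∪ ⁅ v ⁆)
        (≤-trans room (≤-reflexive (trans (+-suc ∣ S ∣ k) (cong (_+ k) (sym (∣p∪⁅x⁆∣ v∉S)))))))
    ... | yes (u , v , (u∈S , v∈N , v∉S , unique) , rest) = yes (force u∈S v∈N v∉S unique ◅ rest)
    ... | no ¬step with ∣ S ∣ ℕ.≟ n
    ...   | yes full = yes (subst (λ T → Star (Forces G) S T) (∣p∣≡n⇒p≡⊤ full) ε⋆)
    ...   | no ¬full = no λ where
              ε⋆ → ¬full (∣⊤∣≡n n)
              (force {u = u} {v} u∈S v∈N v∉S unique ◅ rest) → ¬step (u , v , (u∈S , v∈N , v∉S , unique) , rest)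

  zeroForcingNumber : ∃ (IsZeroForcingNumber G)
  zeroForcingNumber =
    let z , attained , minimal = least (λ z → anySubset? (λ S → zeroForcingSet? S ×-dec (∣ S ∣ ℕ.≟ z))) n (⊤ , ε⋆ , ∣⊤∣≡n n)
    in z , attained , λ S zfs → minimal ∣ S ∣ (S , zfs , refl)

  -- A′ collects the forcing vertices: once u has forced, all its neighbours are black.
  forcing-prefix : ∀ j {B} (A : Subset n) → A ⊆ B → (∀ {u v} → u ∈ A → v ∈ nbhd G u → v ∈ B) →
    Star (Forces G) B ⊤ → ∣ B ∣ + j ≤ n →
    ∃ λ A′ → ∃ λ B′ → ∣ A′ ∣ ≡ j + ∣ A ∣ × ∣ B′ ∣ ≡ ∣ B ∣ + j ×
      A′ ⊆ B′ × (∀ {u v} → u ∈ A′ → v ∈ nbhd G u → v ∈ B′)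
  forcing-prefix zero {B} A A⊆B closed _ _ = A , B , refl , sym (+-identityʳ ∣ B ∣) , A⊆B , closed
  forcing-prefix (suc j) A A⊆B closed ε⋆ h =
    ⊥-elim (<⇒≱ (m<m+n ∣ ⊤ {n} ∣ (s≤s z≤n)) (≤-trans h (≤-reflexive (sym (∣⊤∣≡n n)))))
  forcing-prefix (suc j) {B} A A⊆B closed (force {u = u} {v} u∈B v∈N v∉B unique ◅ rest) h =
    let A′ , B′ , ∣A′∣ , ∣B′∣ , A′⊆B′ , closed′ =
          forcing-prefix j (A ∪ ⁅ u ⁆) sub closed₁ rest
            (≤-trans (≤-reflexive (trans (cong (_+ j) (∣p∪⁅x⁆∣ v∉B)) (sym (+-suc ∣ B ∣ j)))) h)
    in A′ , B′ , trans ∣A′∣ (trans (cong (j +_) (∣p∪⁅x⁆∣ u∉A)) (+-suc j ∣ A ∣)) ,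
       trans ∣B′∣ (trans (cong (_+ j) (∣p∪⁅x⁆∣ v∉B)) (sym (+-suc ∣ B ∣ j))) , A′⊆B′ , closed′
    where
    -- A vertex that has already forced has only black neighbours, so no vertex forces twice and
    -- every force contributes a new element.
    u∉A : u ∉ A
    u∉A u∈A = v∉B (closed u∈A v∈N)
    sub : A ∪ ⁅ u ⁆ ⊆ B ∪ ⁅ v ⁆
    sub x∈ with x∈p∪q⁻ A ⁅ u ⁆ x∈
    ... | inj₁ x∈A = p⊆p∪q ⁅ v ⁆ (A⊆B x∈A)
    ... | inj₂ x∈u rewrite x∈⁅y⁆⇒x≡y u x∈u = p⊆p∪q ⁅ v ⁆ u∈B
    closed₁ : ∀ {x y} → x ∈ A ∪ ⁅ u ⁆ → y ∈ nbhd G x → y ∈ B ∪ ⁅ v ⁆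
    closed₁ {x} {y} x∈ y∈ with x∈p∪q⁻ A ⁅ u ⁆ x∈
    ... | inj₁ x∈A = p⊆p∪q ⁅ v ⁆ (closed x∈A y∈)
    ... | inj₂ x∈u with y ∈? B
    ...   | yes y∈B = p⊆p∪q ⁅ v ⁆ y∈B
    ...   | no  y∉B rewrite unique y (subst (λ t → y ∈ nbhd G t) (x∈⁅y⁆⇒x≡y u x∈u) y∈) y∉B = q⊆p∪q B ⁅ v ⁆ (x∈⁅x⁆ v)

  zeroForcingSet-large : ∀ {a S} → NoHole a G → ZeroForcingSet G S → n < ∣ S ∣ + 2 * a
  zeroForcingSet-large {a} {S} noHole zfs = ≰⇒> contradict
    where
    contradict : ¬ (∣ S ∣ + 2 * a ≤ n)
    contradict h =
      let S+a≤n = ≤-trans (+-monoʳ-≤ ∣ S ∣ (m≤m+n a (a + 0))) h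
          A , B , ∣A∣ , ∣B∣ , A⊆B , closed = forcing-prefix a {S} ⊥ (λ x → ⊥-elim (∉⊥ x)) (λ x → ⊥-elim (∉⊥ x)) zfs S+a≤n
          -- After a forces |S| + a vertices are black, so the assumption |S| + 2a ≤ n leaves a
          -- white ones for the second set of the hole.
          a≤white = +-cancelˡ-≤ (∣ B ∣) _ _ (≤-trans (≤-reflexive (trans (cong (_+ a) ∣B∣) (double ∣ S ∣ a)))
                      (≤-trans h (≤-reflexive (sym (trans (+-comm (∣ B ∣) _) (∣∁p∣+∣p∣ B))))))
          q , q⊆ , ∣q∣ = subset-of-size (∁ B) a a≤white
      in noHole A q (trans ∣A∣ (trans (cong (a +_) (∣⊥∣≡0 n)) (+-identityʳ a))) ∣q∣
           (λ x∈A x∈q → x∈∁p⇒x∉p (q⊆ x∈q) (A⊆B x∈A))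
           (λ u∈A v∈q v∈N → x∈∁p⇒x∉p (q⊆ v∈q) (closed u∈A v∈N))
      where
      double : ∀ s a → s + a + a ≡ s + 2 * a
      double = solve-∀

-- The greedy construction of a zero forcing set

module Greedy {n : ℕ} {G : Digraph n} (irr : Irreflexive G) (symm : Symmetric G)
  {d : ℕ} (deg≡d : ∀ u → deg G u ≡ d) {a : ℕ} (noHole : NoHole a G) where

  -- At least k forces can be made with initially white vertices in U only.
  Forcible : Subset n → ℕ → Set
  Forcible U k = ∃ λ W → W ⊆ U × ∣ W ∣ ≡ k × ZeroForcingSet G (∁ W)

  degIn : Subset n → Fin n → ℕ
  degIn U v = ∑ (V n) (λ u → ⟦ lookup U u ⟧ * ⟦ adj G v u ⟧)

  -- The closed neighbourhood is deleted: `v` has to be black in order to force, so it may not be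
  -- among the vertices that are forced later.
  remove : Fin n → Subset n → Subset n
  remove v U = Vec.tabulate (λ u → lookup U u ∧ not (adj G v u) ∧ not (u == v))

  private
    lookup-remove : ∀ v U u → lookup (remove v U) u ≡ lookup U u ∧ not (adj G v u) ∧ not (u == v)
    lookup-remove v U = lookup∘tabulate (λ u → lookup U u ∧ not (adj G v u) ∧ not (u == v))

    ∈-remove : ∀ {v U u} → u ∈ remove v U → u ∈ U × adj G v u ≡ false × ¬ (u ≡ v)
    ∈-remove {v} {U} {u} h =
      let e = trans (sym (lookup-remove v U u)) ([]=⇒lookup h)
          l , r = ∧-true {lookup U u} e
          l′ , r′ = ∧-true {not (adj G v u)} r
      in lookup⇒[]= u U l , not-true l′ , λ { refl → true≢false (==-refl u) (not-true r′) }

  ∣remove∣ : ∀ v U → ∣ U ∣ ≤ ∣ remove v U ∣ + suc (degIn U v)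
  ∣remove∣ v U = begin
    ∣ U ∣
      ≡⟨ card-∑ U ⟩
    ∑ (V n) (λ u → ⟦ lookup U u ⟧)
      ≤⟨ ∑-mono (V n) (λ u → bit (lookup U u) (adj G v u) (u == v)) ⟩
    ∑ (V n) (λ u → ⟦ lookup U u ∧ not (adj G v u) ∧ not (u == v) ⟧ + (⟦ u == v ⟧ * 1 + ⟦ lookup U u ⟧ * ⟦ adj G v u ⟧))
      ≡⟨ trans (∑-+ (V n) _ _) (cong (∑ (V n) (λ u → ⟦ lookup U u ∧ not (adj G v u) ∧ not (u == v) ⟧) +_)
           (trans (∑-+ (V n) _ _) (cong (_+ degIn U v) (∑-δ v (λ _ → 1))))) ⟩
    ∑ (V n) (λ u → ⟦ lookup U u ∧ not (adj G v u) ∧ not (u == v) ⟧) + suc (degIn U v)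
      ≡⟨ cong (_+ suc (degIn U v)) (trans (∑-cong (V n) (λ u → cong ⟦_⟧ (sym (lookup-remove v U u)))) (sym (card-∑ (remove v U)))) ⟩
    ∣ remove v U ∣ + suc (degIn U v) ∎
    where
    open ≤-Reasoning
    bit : ∀ s g e → ⟦ s ⟧ ≤ ⟦ s ∧ not g ∧ not e ⟧ + (⟦ e ⟧ * 1 + ⟦ s ⟧ * ⟦ g ⟧)
    bit false g     e     = z≤n
    bit true  true  true  = s≤s z≤n
    bit true  true  false = s≤s z≤n
    bit true  false true  = s≤s z≤n
    bit true  false false = s≤s z≤n

  ∑-degIn : ∀ U → ∑ (V n) (degIn U) ≡ ∣ U ∣ * d
  ∑-degIn U = begin
    ∑ (V n) (degIn U)
      ≡⟨ ∑-swap (V n) (V n) _ ⟩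
    ∑ (V n) (λ u → ∑ (V n) (λ v → ⟦ lookup U u ⟧ * ⟦ adj G v u ⟧))
      ≡⟨ ∑-cong (V n) (λ u → trans (∑-*ˡ (V n) ⟦ lookup U u ⟧ _) (cong (⟦ lookup U u ⟧ *_)
           (trans (∑-cong (V n) (λ v → cong ⟦_⟧ (symm v u))) (deg≡d u)))) ⟩
    ∑ (V n) (λ u → ⟦ lookup U u ⟧ * d)
      ≡⟨ trans (∑-*ʳ (V n) d _) (cong (_* d) (sym (card-∑ U))) ⟩
    ∣ U ∣ * d ∎
    where open ≡-Reasoning

  private
    degIn-pos : ∀ {U v} → 1 ≤ degIn U v → ∃ λ w → w ∈ U × w ∈ nbhd G v
    degIn-pos {U} {v} h with any? (λ w → (w ∈? U) ×-dec (w ∈? nbhd G v))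
    ... | yes found = found
    ... | no none = ⊥-elim (<⇒≱ h (≤-reflexive (trans (∑-cong (V n) (λ u → bit u (lookup U u) (adj G v u) refl refl)) (∑-zero (V n)))))
      where
      bit : ∀ u s g → lookup U u ≡ s → adj G v u ≡ g → ⟦ s ⟧ * ⟦ g ⟧ ≡ 0
      bit u false g     _ _ = refl
      bit u true  false _ _ = refl
      bit u true  true  e f = ⊥-elim (none (u , lookup⇒[]= u U e , lookup⇒[]= u (nbhd G v) f))

    degIn-zero : ∀ {U v u} → degIn U v ≡ 0 → u ∈ U → adj G v u ≡ false
    degIn-zero {U} {v} {u} e u∈U = ≢true⇒≡false (λ g → <⇒≱ (s≤s z≤n) (begin
      1                                                              ≡⟨ cong₂ (λ s t → ⟦ s ⟧ * ⟦ t ⟧) ([]=⇒lookup u∈U) g ⟨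
      ⟦ lookup U u ⟧ * ⟦ adj G v u ⟧                                 ≡⟨ ∑-δ u (λ w → ⟦ lookup U w ⟧ * ⟦ adj G v w ⟧) ⟨
      ∑ (V n) (λ w → ⟦ w == u ⟧ * (⟦ lookup U w ⟧ * ⟦ adj G v w ⟧))
        ≤⟨ ∑-mono (V n) (λ w → ≤-trans (*-monoˡ-≤ _ (⟦⟧≤1 (w == u))) (≤-reflexive (+-identityʳ _))) ⟩
      degIn U v                                                      ≡⟨ e ⟩
      0                                                              ∎))
      where open ≤-Reasoning

  isolated : Subset n → Subset n
  isolated U = Vec.tabulate (λ v → does (degIn U v ℕ.≟ 0))

  -- Members of `U` may themselves lack neighbours in `U`. For disjointness an a-set is taken out of
  -- `U` first and the second one from the remaining isolated vertices, hence 2a instead of a.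
  isolated-small : ∀ {U} → 2 * a ≤ ∣ U ∣ → ∣ isolated U ∣ < 2 * a
  isolated-small {U} large = ≰⇒> λ many →
    let p , p⊆U , ∣p∣ = subset-of-size U a (≤-trans (m≤m+n a (a + 0)) large)
        rest = +-cancelʳ-≤ a _ (∣ X ∩ ∁ p ∣) (≤-trans (≤-reflexive (cong (a +_) (sym (+-identityʳ a))))
                 (≤-trans many (≤-trans (∣p∣≤∣p∩∁q∣+∣q∣ X p) (≤-reflexive (cong (∣ X ∩ ∁ p ∣ +_) ∣p∣)))))
        q , q⊆ , ∣q∣ = subset-of-size (X ∩ ∁ p) a rest
    in noHole p q ∣p∣ ∣q∣ (λ u∈p u∈q → x∈∁p⇒x∉p (proj₂ (x∈p∩q⁻ X (∁ p) (q⊆ u∈q))) u∈p)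
         (λ {u} {v} u∈p v∈q v∈N → true≢false (trans (symm v u) ([]=⇒lookup v∈N))
           (degIn-zero {U} (zero-at (proj₁ (x∈p∩q⁻ X (∁ p) (q⊆ v∈q)))) (p⊆U u∈p)))
    where
    X = isolated U
    zero-at : ∀ {v} → v ∈ X → degIn U v ≡ 0
    zero-at {v} v∈X = does-true (degIn U v ℕ.≟ 0)
      (trans (sym (lookup∘tabulate (λ v → does (degIn U v ℕ.≟ 0)) v)) ([]=⇒lookup v∈X))

  -- Averaging degIn over the more than n - 2a vertices at which it is positive.
  cheap-vertex : ∀ {b c U} .{{_ : NonZero c}} → d * b + 2 * a ≤ n → 2 * a ≤ ∣ U ∣ → ∣ U ∣ ≤ c * b →
                 ∃ λ v → 1 ≤ degIn U v × degIn U v < c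
  cheap-vertex {b} {c} {U} room large small with any? (λ v → (1 ℕ.≤? degIn U v) ×-dec (degIn U v ℕ.<? c))
  ... | yes found = found
  ... | no none = ⊥-elim (<⇒≱ (isolated-small {U} large) (+-cancelˡ-≤ (d * b) (2 * a) (∣ isolated U ∣) (≤-trans room n≤)))
    where
    open ≤-Reasoning
    X = isolated U
    -- If no vertex is cheap, `degIn` takes only the value 0 and values of at least c.
    bit : ∀ v (z : Dec (degIn U v ≡ 0)) → c ≤ degIn U v + c * ⟦ does z ⟧
    bit v (yes _) = ≤-trans (≤-reflexive (sym (*-identityʳ c))) (m≤n+m (c * 1) (degIn U v))
    bit v (no ≢0) = ≤-trans (≮⇒≥ (λ <c → none (v , n≢0⇒n>0 ≢0 , <c))) (m≤m+n (degIn U v) (c * 0))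
    rearrange : ∀ c b d x → c * b * d + c * x ≡ c * (d * b + x)
    rearrange = solve-∀
    n≤ : n ≤ d * b + ∣ X ∣
    n≤ = *-cancelˡ-≤ c (begin
      c * n                                                               ≡⟨ *-comm c n ⟩
      n * c                                                               ≡⟨ ∑-V-const n c ⟨
      ∑ (V n) (λ _ → c)
        ≤⟨ ∑-mono (V n) (λ v → bit v (degIn U v ℕ.≟ 0)) ⟩
      ∑ (V n) (λ v → degIn U v + c * ⟦ does (degIn U v ℕ.≟ 0) ⟧)
        ≡⟨ trans (∑-+ (V n) _ _) (cong₂ _+_ (∑-degIn U) (∑-*ˡ (V n) c _)) ⟩
      ∣ U ∣ * d + c * ∑ (V n) (λ v → ⟦ does (degIn U v ℕ.≟ 0) ⟧)
        ≡⟨ cong (λ t → ∣ U ∣ * d + c * t) (trans (∑-cong (V n) (λ v → cong ⟦_⟧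
        (sym (lookup∘tabulate (λ v → does (degIn U v ℕ.≟ 0)) v)))) (sym (card-∑ X))) ⟩
      ∣ U ∣ * d + c * ∣ X ∣                                               ≤⟨ +-monoˡ-≤ (c * ∣ X ∣) (*-monoˡ-≤ d small) ⟩
      c * b * d + c * ∣ X ∣                                               ≡⟨ rearrange c b d ∣ X ∣ ⟩
      c * (d * b + ∣ X ∣)                                                 ∎)

  forcible-mono : ∀ {U U′ k} → U ⊆ U′ → Forcible U k → Forcible U′ k
  forcible-mono U⊆U′ (W , W⊆U , rest) = W , (λ x → U⊆U′ (W⊆U x)) , rest

  -- v forces one of its neighbours in U; the others are black from the start.
  forcible-suc : ∀ {U v k} → 1 ≤ degIn U v → Forcible (remove v U) k → Forcible U (suc k)
  forcible-suc {U} {v} {k} pos (W , W⊆ , ∣W∣ , zfs) = W ∪ ⁅ w ⁆ , sub ,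
      trans (∣p∪⁅x⁆∣ w∉W) (cong suc ∣W∣) ,
      -- `v` forces before all later choices: `W` avoids its neighbourhood, so `w` is its only white
      -- neighbour, and after this force exactly `W` is white.
      force v∈ w∈N (λ w∈∁ → x∈∁p⇒x∉p w∈∁ (q⊆p∪q W ⁅ w ⁆ (x∈⁅x⁆ w))) unique
        ◅ subst (ZeroForcingSet G) (sym (∁-∪-⁅⁆ w∉W)) zfs
    where
    w = proj₁ (degIn-pos {U} {v} pos)
    w∈U = proj₁ (proj₂ (degIn-pos {U} {v} pos))
    w∈N = proj₂ (proj₂ (degIn-pos {U} {v} pos))
    far : ∀ {x} → x ∈ W → ¬ (x ∈ nbhd G v)
    far x∈W x∈N = true≢false ([]=⇒lookup x∈N) (proj₁ (proj₂ (∈-remove {v} {U} (W⊆ x∈W))))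
    w∉W : w ∉ W
    w∉W w∈W = far w∈W w∈N
    sub : W ∪ ⁅ w ⁆ ⊆ U
    sub x∈ with x∈p∪q⁻ W ⁅ w ⁆ x∈
    ... | inj₁ x∈W = proj₁ (∈-remove {v} {U} (W⊆ x∈W))
    ... | inj₂ x∈w rewrite x∈⁅y⁆⇒x≡y w x∈w = w∈U
    v∉ : v ∉ W ∪ ⁅ w ⁆
    v∉ v∈ with x∈p∪q⁻ W ⁅ w ⁆ v∈
    ... | inj₁ v∈W = proj₂ (proj₂ (∈-remove {v} {U} (W⊆ v∈W))) refl
    ... | inj₂ v∈w = true≢false ([]=⇒lookup (subst (_∈ nbhd G v) (sym (x∈⁅y⁆⇒x≡y w v∈w)) w∈N)) (irr v)
    v∈ : v ∈ ∁ (W ∪ ⁅ w ⁆)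
    v∈ = x∉p⇒x∈∁p v∉
    unique : ∀ x → x ∈ nbhd G v → x ∉ ∁ (W ∪ ⁅ w ⁆) → x ≡ w
    unique x x∈N x∉∁ with x∈p∪q⁻ W ⁅ w ⁆ (x∉∁p⇒x∈p x∉∁)
    ... | inj₁ x∈W = ⊥-elim (far x∈W x∈N)
    ... | inj₂ x∈w = x∈⁅y⁆⇒x≡y w x∈w

  -- About b (H_{R+i} - H_R): while |U| falls from cb to (c-1)b, there is room for b/c forces that
  -- cost c vertices each.
  steps : ℕ → ℕ → ℕ → ℕ
  steps b R zero    = 0
  steps b R (suc i) = steps b R i + b / suc (R + i)

  module _ {b R : ℕ} (room : d * b + 2 * a ≤ n) (2a≤Rb : 2 * a ≤ R * b) where

    private
      2a≤ : ∀ {i m} → (R + i) * b ≤ m → 2 * a ≤ m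
      2a≤ {i} h = ≤-trans 2a≤Rb (≤-trans (*-monoˡ-≤ b (m≤m+n R i)) h)

    -- While |U| ≤ cb, each force removes at most c vertices from U.
    phase : ∀ i → (∀ U → (R + i) * b ≤ ∣ U ∣ → Forcible U (steps b R i)) →
            ∀ s U → (R + i) * b + s * suc (R + i) ≤ ∣ U ∣ → ∣ U ∣ ≤ suc (R + i) * b → Forcible U (s + steps b R i)
    phase i next zero    U ≥ ≤cb = next U (≤-trans (≤-reflexive (sym (+-identityʳ _))) ≥)
    phase i next (suc s) U ≥ ≤cb =
      let c = suc (R + i)
          v , pos , <c = cheap-vertex {b} {c} {U} room (2a≤ {i} (m+n≤o⇒m≤o _ ≥)) ≤cb
      in forcible-suc {U} {v} pos (phase i next s (remove v U)
        (+-cancelʳ-≤ c _ _ (≤-trans (≤-reflexive (move ((R + i) * b) (s * c) c)) (≤-trans ≥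
          (≤-trans (∣remove∣ v U) (+-monoʳ-≤ ∣ remove v U ∣ <c)))))
        (≤-trans (p⊆q⇒∣p∣≤∣q∣ (λ x → proj₁ (∈-remove {v} {U} x))) ≤cb))
      where
      move : ∀ p q c → p + q + c ≡ p + (c + q)
      move = solve-∀

    greedy : ∀ i U → (R + i) * b ≤ ∣ U ∣ → Forcible U (steps b R i)
    greedy zero    U _ = ⊥ , (λ x → ⊥-elim (∉⊥ x)) , ∣⊥∣≡0 n , subst (ZeroForcingSet G) (sym ∁⊥≡⊤) ε⋆
      where
      ∁⊥≡⊤ : ∁ ⊥ ≡ ⊤ {n}
      ∁⊥≡⊤ = ∣p∣≡n⇒p≡⊤ (trans (∣∁p∣≡n∸∣p∣ (⊥ {n})) (cong (n ∸_) (∣⊥∣≡0 n)))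
    greedy (suc i) U h =
      let c = suc (R + i)
          cb≤ = ≤-trans (≤-reflexive (cong (_* b) (sym (+-suc R i)))) h
          -- Trimming `U` to exactly cb vertices makes the upper bound of the phase hold at its
          -- start; the discarded vertices are simply black from the beginning.
          U′ , U′⊆U , ∣U′∣ = subset-of-size U (c * b) cb≤
      in subst (Forcible U) (+-comm (b / c) (steps b R i)) (forcible-mono U′⊆U
        (phase i (greedy i) (b / c) U′ (≤-trans (+-monoʳ-≤ ((R + i) * b) (m/n*n≤m b c))
            (≤-reflexive (trans (+-comm ((R + i) * b) b) (sym ∣U′∣))))
          (≤-reflexive ∣U′∣)))

    zeroForcingSet-small : ∀ i → (R + i) * b ≤ n → ∃ λ S → ZeroForcingSet G S × ∣ S ∣ + steps b R i ≡ n
    zeroForcingSet-small i h =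
      let W , _ , ∣W∣ , zfs = greedy i ⊤ (≤-trans h (≤-reflexive (sym (∣⊤∣≡n n))))
      in ∁ W , zfs , trans (cong (∣ ∁ W ∣ +_) (sym ∣W∣)) (∣∁p∣+∣p∣ W)

-- Rational arithmetic

*-mono-≤ˡ : ∀ {r p q} → 0ℚ ℚ.≤ r → p ℚ.≤ q → r ℚ.* p ℚ.≤ r ℚ.* q
*-mono-≤ˡ {r} 0≤r = ℚ.*-monoˡ-≤-nonNeg r {{ℚ.nonNegative 0≤r}}

*-mono-≤ʳ : ∀ {r p q} → 0ℚ ℚ.≤ r → p ℚ.≤ q → p ℚ.* r ℚ.≤ q ℚ.* r
*-mono-≤ʳ {r} 0≤r = ℚ.*-monoʳ-≤-nonNeg r {{ℚ.nonNegative 0≤r}}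

0≤* : ∀ {p q} → 0ℚ ℚ.≤ p → 0ℚ ℚ.≤ q → 0ℚ ℚ.≤ p ℚ.* q
0≤* {p} {q} 0≤p 0≤q = ℚ.≤-trans (ℚ.≤-reflexive (sym (ℚ.*-zeroʳ p))) (*-mono-≤ˡ 0≤p 0≤q)

p≤p+q : ∀ {p q} → 0ℚ ℚ.≤ q → p ℚ.≤ p ℚ.+ q
p≤p+q {p} 0≤q = ℚ.≤-trans (ℚ.≤-reflexive (sym (ℚ.+-identityʳ p))) (ℚ.+-monoʳ-≤ p 0≤q)

p+r≤q+r⇒p≤q : ∀ {p q} r → p ℚ.+ r ℚ.≤ q ℚ.+ r → p ℚ.≤ q
p+r≤q+r⇒p≤q {p} {q} r h = subst₂ ℚ._≤_ (cancel p) (cancel q) (ℚ.+-monoˡ-≤ (ℚ.- r) h)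
  where
  cancel : ∀ p → (p ℚ.+ r) ℚ.- r ≡ p
  cancel p = solve 2 (λ p r → (p :+ r) :- r := p) refl p r

private
  embed : ∀ m → toℚᵘ (ℕ→ℚ m) ℚᵘ.≃ mkℚᵘ (ℤ.+ m) 0
  embed m = ℚ.toℚᵘ-fromℚᵘ (mkℚᵘ (ℤ.+ m) 0)

  embed-recip : ∀ k → toℚᵘ (recip (suc k)) ℚᵘ.≃ mkℚᵘ (ℤ.+ 1) k
  embed-recip k = ℚ.toℚᵘ-fromℚᵘ (mkℚᵘ (ℤ.+ 1) k)

ℕ→ℚ-+ : ∀ m n → ℕ→ℚ (m + n) ≡ ℕ→ℚ m ℚ.+ ℕ→ℚ n
ℕ→ℚ-+ m n = ℚ.toℚᵘ-injective (begin
  toℚᵘ (ℕ→ℚ (m + n))               ≈⟨ embed (m + n) ⟩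
  mkℚᵘ (ℤ.+ (m + n)) 0
    ≈⟨ *≡* (cong (ℤ._* ℤ.+ 1) (sym (cong₂ ℤ._+_ (ℤ.*-identityʳ (ℤ.+ m)) (ℤ.*-identityʳ (ℤ.+ n))))) ⟩
  mkℚᵘ (ℤ.+ m) 0 ℚᵘ.+ mkℚᵘ (ℤ.+ n) 0     ≈⟨ ℚᵘ.+-cong (embed m) (embed n) ⟨
  toℚᵘ (ℕ→ℚ m) ℚᵘ.+ toℚᵘ (ℕ→ℚ n)     ≈⟨ ℚ.toℚᵘ-homo-+ (ℕ→ℚ m) (ℕ→ℚ n) ⟨
  toℚᵘ (ℕ→ℚ m ℚ.+ ℕ→ℚ n)               ∎)
  where open ℚᵘ.≃-Reasoning

ℕ→ℚ-* : ∀ m n → ℕ→ℚ (m * n) ≡ ℕ→ℚ m ℚ.* ℕ→ℚ n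
ℕ→ℚ-* m n = ℚ.toℚᵘ-injective (begin
  toℚᵘ (ℕ→ℚ (m * n))               ≈⟨ embed (m * n) ⟩
  mkℚᵘ (ℤ.+ (m * n)) 0               ≈⟨ *≡* (cong (ℤ._* ℤ.+ 1) (ℤ.pos-* m n)) ⟩
  mkℚᵘ (ℤ.+ m) 0 ℚᵘ.* mkℚᵘ (ℤ.+ n) 0     ≈⟨ ℚᵘ.*-cong (embed m) (embed n) ⟨
  toℚᵘ (ℕ→ℚ m) ℚᵘ.* toℚᵘ (ℕ→ℚ n)     ≈⟨ ℚ.toℚᵘ-homo-* (ℕ→ℚ m) (ℕ→ℚ n) ⟨
  toℚᵘ (ℕ→ℚ m ℚ.* ℕ→ℚ n)               ∎)
  where open ℚᵘ.≃-Reasoning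

ℕ→ℚ-mono : ∀ {m n} → m ≤ n → ℕ→ℚ m ℚ.≤ ℕ→ℚ n
ℕ→ℚ-mono {m} {n} m≤n = ℚ.toℚᵘ-cancel-≤ (ℚᵘ.≤-trans (ℚᵘ.≤-reflexive (embed m))
  (ℚᵘ.≤-trans (*≤* (ℤ.*-monoʳ-≤-nonNeg (ℤ.+ 1) (ℤ.+≤+ m≤n))) (ℚᵘ.≤-reflexive (ℚᵘ.≃-sym (embed n)))))

0≤ℕ→ℚ : ∀ n → 0ℚ ℚ.≤ ℕ→ℚ n
0≤ℕ→ℚ n = ℕ→ℚ-mono {0} {n} z≤n

recip-anti : ∀ {i j} → i ≤ j → recip (suc j) ℚ.≤ recip (suc i)
recip-anti {i} {j} i≤j = ℚ.toℚᵘ-cancel-≤ (ℚᵘ.≤-trans (ℚᵘ.≤-reflexive (embed-recip j))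
  (ℚᵘ.≤-trans (*≤* (ℤ.*-monoˡ-≤-nonNeg (ℤ.+ 1) (ℤ.+≤+ (s≤s i≤j)))) (ℚᵘ.≤-reflexive (ℚᵘ.≃-sym (embed-recip i)))))

0≤recip : ∀ k → 0ℚ ℚ.≤ recip (suc k)
0≤recip k = ℚ.toℚᵘ-cancel-≤ (ℚᵘ.≤-trans (*≤* (ℤ.+≤+ z≤n)) (ℚᵘ.≤-reflexive (ℚᵘ.≃-sym (embed-recip k))))

ℕ→ℚ*recip : ∀ k → ℕ→ℚ (suc k) ℚ.* recip (suc k) ≡ 1ℚ
ℕ→ℚ*recip k = ℚ.toℚᵘ-injective (begin
  toℚᵘ (ℕ→ℚ (suc k) ℚ.* recip (suc k))               ≈⟨ ℚ.toℚᵘ-homo-* (ℕ→ℚ (suc k)) (recip (suc k)) ⟩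
  toℚᵘ (ℕ→ℚ (suc k)) ℚᵘ.* toℚᵘ (recip (suc k))     ≈⟨ ℚᵘ.*-cong (embed (suc k)) (embed-recip k) ⟩
  mkℚᵘ (ℤ.+ suc k) 0 ℚᵘ.* mkℚᵘ (ℤ.+ 1) k               ≈⟨ *≡* (cong ℤ.+_ (eq k)) ⟩
  toℚᵘ 1ℚ                                          ∎)
  where
  open ℚᵘ.≃-Reasoning
  eq : ∀ k → suc k * 1 * 1 ≡ 1 * (1 * suc k)
  eq = solve-∀

positive-≥-recip : ∀ {δ} → 0ℚ ℚ.< δ → ∃ λ b → recip (suc b) ℚ.≤ δ
positive-≥-recip {mkℚ (ℤ.+ zero)  b c} (ℚ.*<* (ℤ.+<+ ()))
positive-≥-recip {mkℚ ℤ.-[1+ a ] b c} (ℚ.*<* ())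
positive-≥-recip {mkℚ (ℤ.+ suc a) b c} _ = b , ℚ.toℚᵘ-cancel-≤
  (ℚᵘ.≤-trans (ℚᵘ.≤-reflexive (embed-recip b)) (*≤* (ℤ.*-monoʳ-≤-nonNeg (ℤ.+ suc b) {ℤ.+ 1} {ℤ.+ suc a} (ℤ.+≤+ (s≤s z≤n)))))

-- Harmonic numbers and the logarithm

harmonic-scaled : ∀ Q m → (∀ j → j < m → suc j ∣ Q) → ℕ→ℚ Q ℚ.* harmonic m ≡ ℕ→ℚ (scaled Q m)
harmonic-scaled Q zero    div = ℚ.*-zeroʳ (ℕ→ℚ Q)
harmonic-scaled Q (suc m) div = begin
  ℕ→ℚ Q ℚ.* (harmonic m ℚ.+ r)              ≡⟨ ℚ.*-distribˡ-+ (ℕ→ℚ Q) (harmonic m) r ⟩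
  ℕ→ℚ Q ℚ.* harmonic m ℚ.+ ℕ→ℚ Q ℚ.* r
    ≡⟨ cong₂ ℚ._+_ (harmonic-scaled Q m (λ j j<m → div j (m<n⇒m<1+n j<m))) term ⟩
  ℕ→ℚ (scaled Q m) ℚ.+ ℕ→ℚ (Q / suc m)  ≡⟨ ℕ→ℚ-+ (scaled Q m) (Q / suc m) ⟨
  ℕ→ℚ (scaled Q m + Q / suc m)      ∎
  where
  open ≡-Reasoning
  r = recip (suc m)
  c = ℕ→ℚ (Q / suc m)
  term : ℕ→ℚ Q ℚ.* r ≡ c
  term = begin
    ℕ→ℚ Q ℚ.* r                      ≡⟨ cong (λ t → ℕ→ℚ t ℚ.* r) (m*[n/m]≡n (div m ≤-refl)) ⟨
    ℕ→ℚ (suc m * (Q / suc m)) ℚ.* r ≡⟨ cong (ℚ._* r) (ℕ→ℚ-* (suc m) (Q / suc m)) ⟩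
    ℕ→ℚ (suc m) ℚ.* c ℚ.* r            ≡⟨ solve 3 (λ a b c → a :* b :* c := b :* (a :* c)) refl (ℕ→ℚ (suc m)) c r ⟩
    c ℚ.* (ℕ→ℚ (suc m) ℚ.* r)          ≡⟨ cong (c ℚ.*_) (ℕ→ℚ*recip m) ⟩
    c ℚ.* 1ℚ                         ≡⟨ ℚ.*-identityʳ c ⟩
    c                              ∎

private
  harmonic-+suc : ∀ q l h → h ℚ.+ ℕ→ℚ (suc l) ℚ.* q ≡ (h ℚ.+ ℕ→ℚ l ℚ.* q) ℚ.+ q
  harmonic-+suc q l h = trans (cong (λ t → h ℚ.+ t ℚ.* q) (ℕ→ℚ-+ 1 l))
    (solve 3 (λ q l h → h :+ (con 1ℚ :+ l) :* q := (h :+ l :* q) :+ q) refl q (ℕ→ℚ l) h)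

  harmonic-+0 : ∀ q h → h ℚ.+ ℕ→ℚ 0 ℚ.* q ≡ h
  harmonic-+0 q h = trans (cong (λ t → h ℚ.+ t) (ℚ.*-zeroˡ q)) (ℚ.+-identityʳ h)

harmonic-≥ : ∀ q l k → (∀ j → j < l + k → q ℚ.≤ recip (suc j)) →
             harmonic k ℚ.+ ℕ→ℚ l ℚ.* q ℚ.≤ harmonic (l + k)
harmonic-≥ q zero    k f = ℚ.≤-reflexive (harmonic-+0 q (harmonic k))
harmonic-≥ q (suc l) k f = ℚ.≤-trans (ℚ.≤-reflexive (harmonic-+suc q l (harmonic k)))
  (ℚ.+-mono-≤ (harmonic-≥ q l k (λ j j< → f j (m<n⇒m<1+n j<))) (f (l + k) ≤-refl))

harmonic-≤ : ∀ q l k → (∀ j → k ≤ j → recip (suc j) ℚ.≤ q) →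
             harmonic (l + k) ℚ.≤ harmonic k ℚ.+ ℕ→ℚ l ℚ.* q
harmonic-≤ q zero    k f = ℚ.≤-reflexive (sym (harmonic-+0 q (harmonic k)))
harmonic-≤ q (suc l) k f = ℚ.≤-trans
  (ℚ.+-mono-≤ (harmonic-≤ q l k f) (f (l + k) (m≤n+m k l)))
  (ℚ.≤-reflexive (sym (harmonic-+suc q l (harmonic k))))

cancel-recip : ∀ c i → ℕ→ℚ (suc i) ℚ.* recip (suc c * suc i) ≡ recip (suc c)
cancel-recip c i = begin
  m ℚ.* x                    ≡⟨ ℚ.*-identityʳ (m ℚ.* x) ⟨
  m ℚ.* x ℚ.* 1ℚ               ≡⟨ cong (m ℚ.* x ℚ.*_) (ℕ→ℚ*recip c) ⟨
  m ℚ.* x ℚ.* (k ℚ.* r)          ≡⟨ solve 4 (λ m x k r → m :* x :* (k :* r) := k :* m :* x :* r) refl m x k r ⟩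
  k ℚ.* m ℚ.* x ℚ.* r
    ≡⟨ cong (ℚ._* r) (trans (cong (ℚ._* x) (sym (ℕ→ℚ-* (suc c) (suc i)))) (ℕ→ℚ*recip (i + c * suc i))) ⟩
  1ℚ ℚ.* r                   ≡⟨ ℚ.*-identityˡ r ⟩
  r                        ∎
  where
  open ≡-Reasoning
  m = ℕ→ℚ (suc i)
  x = recip (suc c * suc i)
  k = ℕ→ℚ (suc c)
  r = recip (suc c)

private
  H = harmonic

  -- Blockwise comparison: the m = i + 1 terms added when c grows by one are each at least the last
  -- of them, and m times this last term is exactly the next term of the harmonic sum at c. The
  -- bounds hold for every term of the sequence defining the logarithm, so inequalities between
  -- reals can later be checked term by term.
  log-lower : ∀ c i → H (suc i) ℚ.+ H (suc c) ℚ.≤ H (suc c * suc i) ℚ.+ 1ℚ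
  log-lower zero    i = ℚ.≤-reflexive (cong (λ t → H t ℚ.+ 1ℚ) (sym (+-identityʳ (suc i))))
  log-lower (suc c) i = begin
    H m ℚ.+ (H (suc c) ℚ.+ r)            ≡⟨ ℚ.+-assoc (H m) (H (suc c)) r ⟨
    H m ℚ.+ H (suc c) ℚ.+ r              ≤⟨ ℚ.+-monoˡ-≤ r (log-lower c i) ⟩
    H (suc c * m) ℚ.+ 1ℚ ℚ.+ r         ≡⟨ solve 3 (λ a b c → a :+ b :+ c := a :+ c :+ b) refl (H (suc c * m)) 1ℚ r ⟩
    H (suc c * m) ℚ.+ r ℚ.+ 1ℚ         ≡⟨ cong (λ t → H (suc c * m) ℚ.+ t ℚ.+ 1ℚ) (cancel-recip (suc c) i) ⟨
    H (suc c * m) ℚ.+ ℕ→ℚ m ℚ.* recip (suc (suc c) * m) ℚ.+ 1ℚ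
                                     ≤⟨ ℚ.+-monoˡ-≤ 1ℚ (harmonic-≥ _ m (suc c * m) (λ j j< → recip-anti (≤-pred j<))) ⟩
    H (suc (suc c) * m) ℚ.+ 1ℚ       ∎
    where
    open ℚ.≤-Reasoning
    m = suc i
    r = recip (suc (suc c))

  log-upper : ∀ c i → H (suc c * suc i) ℚ.≤ H (suc i) ℚ.+ H c
  log-upper zero    i = ℚ.≤-reflexive (trans (cong H (+-identityʳ (suc i))) (sym (ℚ.+-identityʳ (H (suc i)))))
  log-upper (suc c) i = begin
    H (suc (suc c) * m)
      ≤⟨ harmonic-≤ _ m (suc c * m) (λ j ≤j → recip-anti {i + c * m} (≤-trans (n≤1+n _) ≤j)) ⟩
    H (suc c * m) ℚ.+ ℕ→ℚ m ℚ.* recip (suc c * m)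
                                     ≡⟨ cong (λ t → H (suc c * m) ℚ.+ t) (cancel-recip c i) ⟩
    H (suc c * m) ℚ.+ r              ≤⟨ ℚ.+-monoˡ-≤ r (log-upper c i) ⟩
    H m ℚ.+ H c ℚ.+ r                    ≡⟨ ℚ.+-assoc (H m) (H c) r ⟩
    H m ℚ.+ (H c ℚ.+ r)                  ∎
    where
    open ℚ.≤-Reasoning
    m = suc i
    r = recip (suc c)

logApprox-≥ : ∀ e i → harmonic (suc e) ℚ.≤ logApprox (suc e) i ℚ.+ 1ℚ
logApprox-≥ e i = subst₂ ℚ._≤_
  (solve 2 (λ a b → (a :+ b) :- a := b) refl (H (suc i)) (H (suc e)))
  (solve 3 (λ a b c → (a :+ b) :- c := (a :- c) :+ b) refl (H (suc e * suc i)) 1ℚ (H (suc i)))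
  (ℚ.+-monoˡ-≤ (ℚ.- H (suc i)) (log-lower e i))

logApprox-≤ : ∀ e i → logApprox (suc e) i ℚ.≤ harmonic (suc e)
logApprox-≤ e i = ℚ.≤-trans (subst (logApprox (suc e) i ℚ.≤_)
  (solve 2 (λ a b → (a :+ b) :- a := b) refl (H (suc i)) (H e))
  (ℚ.+-monoˡ-≤ (ℚ.- H (suc i)) (log-upper e i))) (p≤p+q (0≤recip e))

0≤logApprox : ∀ e i → 0ℚ ℚ.≤ logApprox (suc e) i
0≤logApprox e i = subst (ℚ._≤ logApprox (suc e) i) (ℚ.+-inverseʳ (H (suc i))) (ℚ.+-monoˡ-≤ (ℚ.- H (suc i))
  (ℚ.≤-trans (ℚ.≤-trans (p≤p+q {p = H (suc i)} {q = ℕ→ℚ (e * suc i) ℚ.* 0ℚ} (ℚ.≤-reflexive (sym (ℚ.*-zeroʳ (ℕ→ℚ (e * suc i))))))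
      (harmonic-≥ 0ℚ (e * suc i) (suc i) (λ j _ → 0≤recip j)))
    (ℚ.≤-reflexive (cong H (+-comm (e * suc i) (suc i))))))

-- From counts of forces and bad graphs to rational inequalities

lower-bound : ∀ {p d n Z k h L η} → Z + k ≡ n →
  k * suc d * suc p ≤ n * (suc p + 2) * (4 * h) →
  ℕ→ℚ h ℚ.≤ L → ℕ→ℚ 2 ℚ.* recip (suc p) ℚ.≤ η →
  ℕ→ℚ n ℚ.* (1ℚ ℚ.- (1ℚ ℚ.+ η) ℚ.* ((ℕ→ℚ 4 ℚ.* L) ℚ.* recip (suc d))) ℚ.≤ ℕ→ℚ Z
lower-bound {p} {d} {n} {Z} {k} {h} {L} {η} Z+k≡n k≤ h≤L 2/p≤η = begin
  N ℚ.* (1ℚ ℚ.- (1ℚ ℚ.+ η) ℚ.* ((F ℚ.* L) ℚ.* v))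
    ≡⟨ solve 2 (λ n x → n :* (con 1ℚ :- x) := n :- n :* x) refl N ((1ℚ ℚ.+ η) ℚ.* ((F ℚ.* L) ℚ.* v)) ⟩
  N ℚ.- N ℚ.* ((1ℚ ℚ.+ η) ℚ.* ((F ℚ.* L) ℚ.* v))
    ≤⟨ ℚ.+-monoʳ-≤ N (ℚ.neg-antimono-≤ forces) ⟩
  N ℚ.- ℕ→ℚ k
    ≡⟨ cong (λ t → ℕ→ℚ t ℚ.- ℕ→ℚ k) Z+k≡n ⟨
  ℕ→ℚ (Z + k) ℚ.- ℕ→ℚ k
    ≡⟨ cong (ℚ._- ℕ→ℚ k) (ℕ→ℚ-+ Z k) ⟩
  (ℕ→ℚ Z ℚ.+ ℕ→ℚ k) ℚ.- ℕ→ℚ k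
    ≡⟨ solve 2 (λ z k → (z :+ k) :- k := z) refl (ℕ→ℚ Z) (ℕ→ℚ k) ⟩
  ℕ→ℚ Z ∎
  where
  open ℚ.≤-Reasoning
  N = ℕ→ℚ n
  F = ℕ→ℚ 4
  D = ℕ→ℚ (suc d)
  P = ℕ→ℚ (suc p)
  u = recip (suc p)
  v = recip (suc d)
  0≤u = 0≤recip p
  0≤v = 0≤recip d
  -- The quotient (P+2)/P = 1 + 2/P is the factor that η ≥ 2/P turns into 1 + η.
  1+2u : (P ℚ.+ ℕ→ℚ 2) ℚ.* u ≡ 1ℚ ℚ.+ ℕ→ℚ 2 ℚ.* u
  1+2u = trans (ℚ.*-distribʳ-+ u P (ℕ→ℚ 2)) (cong (ℚ._+ ℕ→ℚ 2 ℚ.* u) (ℕ→ℚ*recip p))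
  cast : ℕ→ℚ (k * suc d * suc p) ≡ ℕ→ℚ k ℚ.* D ℚ.* P
  cast = trans (ℕ→ℚ-* (k * suc d) (suc p)) (cong (ℚ._* P) (ℕ→ℚ-* k (suc d)))
  cast′ : ℕ→ℚ (n * (suc p + 2) * (4 * h)) ≡ N ℚ.* (P ℚ.+ ℕ→ℚ 2) ℚ.* (F ℚ.* ℕ→ℚ h)
  cast′ = trans (ℕ→ℚ-* (n * (suc p + 2)) (4 * h)) (cong₂ ℚ._*_
    (trans (ℕ→ℚ-* n (suc p + 2)) (cong (N ℚ.*_) (ℕ→ℚ-+ (suc p) 2))) (ℕ→ℚ-* 4 h))
  0≤1+2u : 0ℚ ℚ.≤ 1ℚ ℚ.+ ℕ→ℚ 2 ℚ.* u
  0≤1+2u = ℚ.≤-trans (0≤ℕ→ℚ 1) (p≤p+q (0≤* (0≤ℕ→ℚ 2) 0≤u))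
  forces : ℕ→ℚ k ℚ.≤ N ℚ.* ((1ℚ ℚ.+ η) ℚ.* ((F ℚ.* L) ℚ.* v))
  forces = begin
    ℕ→ℚ k
      ≡⟨ trans (cong (ℕ→ℚ k ℚ.*_) (cong₂ ℚ._*_ (ℕ→ℚ*recip d) (ℕ→ℚ*recip p))) (ℚ.*-identityʳ (ℕ→ℚ k)) ⟨
    ℕ→ℚ k ℚ.* ((D ℚ.* v) ℚ.* (P ℚ.* u))
      ≡⟨ solve 5 (λ k d p u v → k :* ((d :* v) :* (p :* u)) := (k :* d :* p) :* (u :* v)) refl (ℕ→ℚ k) D P u v ⟩
    (ℕ→ℚ k ℚ.* D ℚ.* P) ℚ.* (u ℚ.* v)
      ≤⟨ *-mono-≤ʳ (0≤* 0≤u 0≤v) (subst₂ ℚ._≤_ cast cast′ (ℕ→ℚ-mono k≤)) ⟩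
    (N ℚ.* (P ℚ.+ ℕ→ℚ 2) ℚ.* (F ℚ.* ℕ→ℚ h)) ℚ.* (u ℚ.* v)
      ≡⟨ solve 5 (λ n s f u v → (n :* s :* f) :* (u :* v) := n :* ((s :* u) :* (f :* v))) refl N (P ℚ.+ ℕ→ℚ 2) (F ℚ.* ℕ→ℚ h) u v ⟩
    N ℚ.* (((P ℚ.+ ℕ→ℚ 2) ℚ.* u) ℚ.* ((F ℚ.* ℕ→ℚ h) ℚ.* v))
      ≡⟨ cong (λ t → N ℚ.* (t ℚ.* ((F ℚ.* ℕ→ℚ h) ℚ.* v))) 1+2u ⟩
    N ℚ.* ((1ℚ ℚ.+ ℕ→ℚ 2 ℚ.* u) ℚ.* ((F ℚ.* ℕ→ℚ h) ℚ.* v))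
      ≤⟨ *-mono-≤ˡ (0≤ℕ→ℚ n) (*-mono-≤ˡ 0≤1+2u (*-mono-≤ʳ 0≤v (*-mono-≤ˡ (0≤ℕ→ℚ 4) h≤L))) ⟩
    N ℚ.* ((1ℚ ℚ.+ ℕ→ℚ 2 ℚ.* u) ℚ.* ((F ℚ.* L) ℚ.* v))
      ≤⟨ *-mono-≤ˡ (0≤ℕ→ℚ n) (*-mono-≤ʳ (0≤* (0≤* (0≤ℕ→ℚ 4) (ℚ.≤-trans (0≤ℕ→ℚ h) h≤L)) 0≤v) (ℚ.+-monoʳ-≤ 1ℚ 2/p≤η)) ⟩
    N ℚ.* ((1ℚ ℚ.+ η) ℚ.* ((F ℚ.* L) ℚ.* v)) ∎

-- Applied with `suc d` equal to twice the degree, with `L` and `η` terms of the sequences of the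
-- logarithm and of ε, and with `Hd` the harmonic number that dominates every such `L`.
upper-bound : ∀ {d n Z k L Hd η} → Z + k ≤ n →
  ℕ→ℚ n ℚ.* Hd ℚ.≤ ℕ→ℚ (suc d) ℚ.* ℕ→ℚ k →
  0ℚ ℚ.≤ L → L ℚ.≤ Hd → 0ℚ ℚ.≤ η →
  ℕ→ℚ Z ℚ.≤ ℕ→ℚ n ℚ.* (1ℚ ℚ.- (1ℚ ℚ.- η) ℚ.* (L ℚ.* recip (suc d)))
upper-bound {d} {n} {Z} {k} {L} {Hd} {η} Z+k≤n nH≤ 0≤L L≤H 0≤η = begin
  ℕ→ℚ Z
    ≡⟨ solve 2 (λ z k → z := (z :+ k) :- k) refl (ℕ→ℚ Z) (ℕ→ℚ k) ⟩
  (ℕ→ℚ Z ℚ.+ ℕ→ℚ k) ℚ.- ℕ→ℚ k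
    ≡⟨ cong (ℚ._- ℕ→ℚ k) (ℕ→ℚ-+ Z k) ⟨
  ℕ→ℚ (Z + k) ℚ.- ℕ→ℚ k
    ≤⟨ ℚ.+-monoˡ-≤ (ℚ.- ℕ→ℚ k) (ℕ→ℚ-mono Z+k≤n) ⟩
  N ℚ.- ℕ→ℚ k
    ≤⟨ ℚ.+-monoʳ-≤ N (ℚ.neg-antimono-≤ forces) ⟩
  N ℚ.- N ℚ.* ((1ℚ ℚ.- η) ℚ.* (L ℚ.* v))
    ≡⟨ solve 2 (λ n x → n :- n :* x := n :* (con 1ℚ :- x)) refl N ((1ℚ ℚ.- η) ℚ.* (L ℚ.* v)) ⟩
  N ℚ.* (1ℚ ℚ.- (1ℚ ℚ.- η) ℚ.* (L ℚ.* v)) ∎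
  where
  open ℚ.≤-Reasoning
  N = ℕ→ℚ n
  D = ℕ→ℚ (suc d)
  v = recip (suc d)
  0≤v = 0≤recip d
  1-η≤1 : 1ℚ ℚ.- η ℚ.≤ 1ℚ
  1-η≤1 = ℚ.≤-trans (ℚ.+-monoʳ-≤ 1ℚ (ℚ.neg-antimono-≤ 0≤η)) (ℚ.≤-reflexive (ℚ.+-identityʳ 1ℚ))
  forces : N ℚ.* ((1ℚ ℚ.- η) ℚ.* (L ℚ.* v)) ℚ.≤ ℕ→ℚ k
  forces = begin
    N ℚ.* ((1ℚ ℚ.- η) ℚ.* (L ℚ.* v))   ≤⟨ *-mono-≤ˡ (0≤ℕ→ℚ n) (*-mono-≤ʳ (0≤* 0≤L 0≤v) 1-η≤1) ⟩
    N ℚ.* (1ℚ ℚ.* (L ℚ.* v))         ≡⟨ solve 3 (λ n l v → n :* (con 1ℚ :* (l :* v)) := (n :* l) :* v) refl N L v ⟩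
    (N ℚ.* L) ℚ.* v                ≤⟨ *-mono-≤ʳ 0≤v (ℚ.≤-trans (*-mono-≤ˡ (0≤ℕ→ℚ n) L≤H) nH≤) ⟩
    (D ℚ.* ℕ→ℚ k) ℚ.* v            ≡⟨ solve 3 (λ d k v → (d :* k) :* v := (d :* v) :* k) refl D (ℕ→ℚ k) v ⟩
    (D ℚ.* v) ℚ.* ℕ→ℚ k            ≡⟨ cong (ℚ._* ℕ→ℚ k) (ℕ→ℚ*recip d) ⟩
    1ℚ ℚ.* ℕ→ℚ k                 ≡⟨ ℚ.*-identityˡ (ℕ→ℚ k) ⟩
    ℕ→ℚ k                      ∎

probability-bound : ∀ {δ b A B} → recip (suc b) ℚ.≤ δ → B * suc b ≤ A + B →
  (1ℚ ℚ.- δ) ℚ.* ℕ→ℚ (A + B) ℚ.≤ ℕ→ℚ A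
probability-bound {δ} {b} {A} {B} r≤δ B≤ = begin
  (1ℚ ℚ.- δ) ℚ.* ℕ→ℚ (A + B)           ≡⟨ solve 2 (λ δ l → (con 1ℚ :- δ) :* l := l :- δ :* l) refl δ L ⟩
  L ℚ.- δ ℚ.* L                          ≤⟨ ℚ.+-monoʳ-≤ L (ℚ.neg-antimono-≤ few) ⟩
  L ℚ.- ℕ→ℚ B                          ≡⟨ cong (ℚ._- ℕ→ℚ B) (ℕ→ℚ-+ A B) ⟩
  (ℕ→ℚ A ℚ.+ ℕ→ℚ B) ℚ.- ℕ→ℚ B            ≡⟨ solve 2 (λ z k → (z :+ k) :- k := z) refl (ℕ→ℚ A) (ℕ→ℚ B) ⟩
  ℕ→ℚ A                              ∎
  where
  open ℚ.≤-Reasoning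
  L = ℕ→ℚ (A + B)
  r = recip (suc b)
  few : ℕ→ℚ B ℚ.≤ δ ℚ.* L
  few = begin
    ℕ→ℚ B                            ≡⟨ ℚ.*-identityʳ (ℕ→ℚ B) ⟨
    ℕ→ℚ B ℚ.* 1ℚ                       ≡⟨ cong (ℕ→ℚ B ℚ.*_) (ℕ→ℚ*recip b) ⟨
    ℕ→ℚ B ℚ.* (ℕ→ℚ (suc b) ℚ.* r)        ≡⟨ ℚ.*-assoc (ℕ→ℚ B) (ℕ→ℚ (suc b)) r ⟨
    ℕ→ℚ B ℚ.* ℕ→ℚ (suc b) ℚ.* r          ≡⟨ cong (ℚ._* r) (ℕ→ℚ-* B (suc b)) ⟨
    ℕ→ℚ (B * suc b) ℚ.* r            ≤⟨ *-mono-≤ʳ (0≤recip b) (ℕ→ℚ-mono B≤) ⟩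
    L ℚ.* r                            ≤⟨ *-mono-≤ˡ (0≤ℕ→ℚ (A + B)) r≤δ ⟩
    L ℚ.* δ                            ≡⟨ ℚ.*-comm L δ ⟩
    δ ℚ.* L                            ∎

-- Choice of the parameters

suc∣! : ∀ {j d} → j < d → suc j ∣ d !
suc∣! {j} j<d = ∣-trans (m∣m*n (j !)) (m≤n⇒m!∣n! j<d)

scaled-+-≥ : ∀ Q m l {t} → l + m ≤ suc t → scaled Q m + l * (Q / suc t) ≤ scaled Q (l + m)
scaled-+-≥ Q m zero    _ = ≤-reflexive (+-identityʳ _)
scaled-+-≥ Q m (suc l) {t} h = begin
  scaled Q m + (Q / suc t + l * (Q / suc t))   ≡⟨ rotate (scaled Q m) (Q / suc t) (l * (Q / suc t)) ⟩
  scaled Q m + l * (Q / suc t) + Q / suc t     ≤⟨ +-mono-≤ (scaled-+-≥ Q m l (<⇒≤ h)) (/-monoʳ-≤ Q h) ⟩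
  scaled Q (l + m) + Q / suc (l + m)           ∎
  where
  open ≤-Reasoning
  rotate : ∀ a b c → a + (b + c) ≡ a + c + b
  rotate = solve-∀

-- Oresme's argument: the terms of the harmonic sum after the index 2ᵏ and up to 2ᵏ⁺¹ add at least
-- 1/2.
scaled-2^ : ∀ Q k → (∀ j → j < 2 ^ k → suc j ∣ Q) → k * Q ≤ 2 * scaled Q (2 ^ k)
scaled-2^ Q zero    div = z≤n
scaled-2^ Q (suc k) div with 2 ^ k in e | scaled-2^ Q k | m^n>0 2 k
... | suc m | IH | _ = begin
  Q + k * Q                                       ≤⟨ +-monoʳ-≤ Q (IH (λ j j< → div j (≤-trans j< (m≤m+n (suc m) _)))) ⟩
  Q + 2 * scaled Q (suc m)                        ≡⟨ cong (_+ 2 * scaled Q (suc m)) (m*[n/m]≡n (div t ≤-refl)) ⟨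
  suc t * (Q / suc t) + 2 * scaled Q (suc m)      ≡⟨ regroup (suc m) (Q / suc t) (scaled Q (suc m)) ⟩
  2 * (scaled Q (suc m) + suc m * (Q / suc t))
    ≤⟨ *-monoʳ-≤ 2 (scaled-+-≥ Q (suc m) (suc m) (≤-reflexive (cong (suc m +_) (sym (+-identityʳ (suc m)))))) ⟩
  2 * scaled Q (suc m + suc m)                    ≡⟨ cong (λ j → 2 * scaled Q (suc m + j)) (+-identityʳ (suc m)) ⟨
  2 * scaled Q (2 * suc m)                        ∎
  where
  open ≤-Reasoning
  t = m + (suc m + 0)
  regroup : ∀ m c s → 2 * m * c + 2 * s ≡ 2 * (s + m * c)
  regroup = solve-∀

scaled-mono : ∀ Q {m n} → m ≤ n → scaled Q m ≤ scaled Q n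
scaled-mono Q {m} {n} m≤n with m≤n⇒∃[o]m+o≡n m≤n
... | o , refl = subst (λ t → scaled Q m ≤ scaled Q t) (+-comm o m)
  (≤-trans (m≤m+n _ _) (scaled-+-≥ Q m o {o + m} (n≤1+n (o + m))))

-- The first K terms of Hₘ are at most 1, the others at most 1/K.
scaled-≤ : ∀ Q K m → K * scaled Q m ≤ (K * K + m) * Q
scaled-≤ Q K zero    = ≤-trans (≤-reflexive (*-zeroʳ K)) z≤n
scaled-≤ Q K (suc m) with suc m ≤? K
... | yes m<K = begin
  K * scaled Q (suc m)      ≤⟨ *-monoʳ-≤ K (trivial (suc m)) ⟩
  K * (suc m * Q)           ≤⟨ *-monoʳ-≤ K (*-monoˡ-≤ Q m<K) ⟩
  K * (K * Q)               ≡⟨ *-assoc K K Q ⟨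
  K * K * Q                 ≤⟨ *-monoˡ-≤ Q (m≤m+n (K * K) (suc m)) ⟩
  (K * K + suc m) * Q       ∎
  where
  open ≤-Reasoning
  trivial : ∀ m → scaled Q m ≤ m * Q
  trivial zero    = z≤n
  trivial (suc m) = ≤-trans (+-mono-≤ (trivial m) (m/n≤m Q (suc m))) (≤-reflexive (+-comm (m * Q) Q))
... | no m≮K = begin
  K * (scaled Q m + Q / suc m)          ≡⟨ *-distribˡ-+ K (scaled Q m) (Q / suc m) ⟩
  K * scaled Q m + K * (Q / suc m)      ≤⟨ +-mono-≤ (scaled-≤ Q K m) (≤-trans (*-monoˡ-≤ (Q / suc m) (<⇒≤ (≰⇒> m≮K)))
                                             (≤-trans (≤-reflexive (*-comm (suc m) (Q / suc m))) (m/n*n≤m Q (suc m)))) ⟩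
  (K * K + m) * Q + Q                   ≡⟨ collect (K * K) m Q ⟩
  (K * K + suc m) * Q                   ∎
  where
  open ≤-Reasoning
  collect : ∀ k m Q → (k + m) * Q + Q ≡ (k + suc m) * Q
  collect = solve-∀

*-/-≤ : ∀ m c k .{{_ : NonZero c}} → m / c * k ≤ m * k / c
*-/-≤ m c k = begin
  m / c * k              ≡⟨ m*n/n≡m (m / c * k) c ⟨
  m / c * k * c / c      ≤⟨ /-monoˡ-≤ c (≤-trans (≤-reflexive (rotate (m / c) k c)) (*-monoˡ-≤ k (m/n*n≤m m c))) ⟩
  m * k / c              ∎
  where
  open ≤-Reasoning
  rotate : ∀ a b c → a * b * c ≡ a * c * b
  rotate = solve-∀

-- This is ⌊H_d⌋ + 1, the integer stand-in for log d.
h[_] : ℕ → ℕ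
h[ d ] = suc ((scaled (d !) d / d !) {{d !≢0}})

module _ (d : ℕ) where
  private
    Q = d !
    P = scaled Q d
    instance
      Q≢0 : NonZero Q
      Q≢0 = d !≢0

  P≤hQ : P ≤ h[ d ] * Q
  P≤hQ = ≤-trans (≤-reflexive (m≡m%n+[m/n]*n P Q)) (+-monoˡ-≤ (P / Q * Q) (<⇒≤ (m%n<n P Q)))

  hQ≤P+Q : h[ d ] * Q ≤ P + Q
  hQ≤P+Q = ≤-trans (≤-reflexive (+-comm Q (P / Q * Q))) (+-monoˡ-≤ Q (m/n*n≤m P Q))

  h-large : ∀ k → 2 ^ (2 * k) ≤ d → k ≤ h[ d ]
  h-large k 2^≤d = *-cancelˡ-≤ 2 (*-cancelʳ-≤ (2 * k) (2 * h[ d ]) Q (begin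
    2 * k * Q                      ≤⟨ scaled-2^ Q (2 * k) (λ j j< → suc∣! (≤-trans j< 2^≤d)) ⟩
    2 * scaled Q (2 ^ (2 * k))     ≤⟨ *-monoʳ-≤ 2 (scaled-mono Q 2^≤d) ⟩
    2 * P                          ≤⟨ *-monoʳ-≤ 2 P≤hQ ⟩
    2 * (h[ d ] * Q)               ≡⟨ *-assoc 2 h[ d ] Q ⟨
    2 * h[ d ] * Q                 ∎))
    where open ≤-Reasoning

  -- Splitting the harmonic sum at 2C gives H_d ≤ 2C + d/(2C). With h ≤ H_d + 1 it follows that Ch ≤
  -- 2C² + C + d/2.
  h-small : ∀ C → 4 * C * C + 2 * C ≤ d → C * h[ d ] ≤ d
  h-small C ≤d = *-cancelˡ-≤ 2 (*-cancelʳ-≤ (2 * (C * h[ d ])) (2 * d) Q (begin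
    2 * (C * h[ d ]) * Q           ≡⟨ regroup C h[ d ] Q ⟩
    2 * C * (h[ d ] * Q)           ≤⟨ *-monoʳ-≤ (2 * C) hQ≤P+Q ⟩
    2 * C * (P + Q)                ≡⟨ *-distribˡ-+ (2 * C) P Q ⟩
    2 * C * P + 2 * C * Q          ≤⟨ +-monoˡ-≤ (2 * C * Q) (scaled-≤ Q (2 * C) d) ⟩
    (2 * C * (2 * C) + d) * Q + 2 * C * Q
                                   ≡⟨ regroup′ C d Q ⟩
    (4 * C * C + 2 * C) * Q + d * Q
                                   ≤⟨ +-monoˡ-≤ (d * Q) (*-monoˡ-≤ Q ≤d) ⟩
    d * Q + d * Q                  ≡⟨ regroup″ d Q ⟩
    2 * d * Q                      ∎))
    where
    open ≤-Reasoning
    regroup : ∀ C h Q → 2 * (C * h) * Q ≡ 2 * C * (h * Q)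
    regroup = solve-∀
    regroup′ : ∀ C d Q → (2 * C * (2 * C) + d) * Q + 2 * C * Q ≡ (4 * C * C + 2 * C) * Q + d * Q
    regroup′ = solve-∀
    regroup″ : ∀ d Q → d * Q + d * Q ≡ 2 * d * Q
    regroup″ = solve-∀

  -- The forces lost by stopping early are at most a quarter. Splitting at 64 gives 4 H_{8h} ≤ 256 +
  -- h/2, which is at most h - 1 ≤ H_d as soon as h ≥ 514.
  scaled-8h : 514 ≤ h[ d ] → 4 * scaled Q (8 * h[ d ]) ≤ P
  scaled-8h 514≤h = *-cancelˡ-≤ 16 (+-cancelʳ-≤ (16 * Q) _ _ (begin
    16 * (4 * X) + 16 * Q                 ≡⟨ cong (_+ 16 * Q) (sym (*-assoc 16 4 X)) ⟩
    64 * X + 16 * Q                       ≤⟨ +-monoˡ-≤ (16 * Q) (scaled-≤ Q 64 (8 * h[ d ])) ⟩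
    (4096 + 8 * h[ d ]) * Q + 16 * Q      ≡⟨ regroup h[ d ] Q ⟩
    (8 * 514 + 8 * h[ d ]) * Q            ≤⟨ *-monoˡ-≤ Q (+-monoˡ-≤ (8 * h[ d ]) (*-monoʳ-≤ 8 514≤h)) ⟩
    (8 * h[ d ] + 8 * h[ d ]) * Q         ≡⟨ regroup′ h[ d ] Q ⟩
    16 * (h[ d ] * Q)                     ≤⟨ *-monoʳ-≤ 16 hQ≤P+Q ⟩
    16 * (P + Q)                          ≡⟨ *-distribˡ-+ 16 P Q ⟩
    16 * P + 16 * Q                       ∎))
    where
    open ≤-Reasoning
    X = scaled Q (8 * h[ d ])
    regroup : ∀ h Q → (4096 + 8 * h) * Q + 16 * Q ≡ (4112 + 8 * h) * Q
    regroup = solve-∀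
    regroup′ : ∀ h Q → (8 * h + 8 * h) * Q ≡ 16 * (h * Q)
    regroup′ = solve-∀

≤-witness : ∀ {m n} k → m + k ≡ n → m ≤ n
≤-witness {m} k eq = ≤-trans (m≤m+n m k) (≤-reflexive eq)

-- The unit of measurement is y ≈ n/(pd): a = 2h(p+1)y, and T is slightly less than 2(p+1)(2h²+1)y.
module _ {p d h s₀ : ℕ} (split : s₀ + (2 * (h * h) + 1) ≡ h * d)
  (small : (8 * p + 6) * (2 * (h * h) + 1) ≤ h * d) (2p≤h² : 2 * p ≤ h * h) (1≤h : 1 ≤ h) (6≤d : 6 ≤ d) where

  private z = 2 * (h * h) + 1

  -- To leading order the two sides are 4p(hd)² and (4p+3)(hd)². Of the slack 3(hd)², one unit
  -- covers 2pd², one the terms linear in d, and one the replacement of s₀ = hd - z by hd.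
  leading-term : 2 * (p * d + 1) * d * z ≤ s₀ * s₀ * (4 * p + 3)
  leading-term = +-cancelʳ-≤ (x * x) _ _ (begin
    2 * (p * d + 1) * d * z + x * x
      ≡⟨ expand p d h ⟩
    4 * p * (x * x) + (2 * p * (d * d) + (4 * (h * h) * d + 2 * 1 * d)) + x * x
      ≤⟨ +-monoˡ-≤ (x * x) (+-monoʳ-≤ (4 * p * (x * x)) (+-mono-≤ (*-monoˡ-≤ (d * d) 2p≤h²) six)) ⟩
    4 * p * (x * x) + (h * h * (d * d) + h * h * (d * d)) + x * x
      ≡⟨ collect p h d ⟩
    (4 * p + 3) * (x * x)
      ≤⟨ *-monoʳ-≤ (4 * p + 3) square ⟩
    (4 * p + 3) * (s₀ * s₀ + 2 * z * x)
      ≡⟨ expand′ p (s₀ * s₀) z x ⟩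
    s₀ * s₀ * (4 * p + 3) + (8 * p + 6) * z * x
      ≤⟨ +-monoʳ-≤ (s₀ * s₀ * (4 * p + 3)) (*-monoˡ-≤ x small) ⟩
    s₀ * s₀ * (4 * p + 3) + x * x ∎)
    where
    open ≤-Reasoning
    x = h * d
    six : 4 * (h * h) * d + 2 * 1 * d ≤ h * h * (d * d)
    six = begin
      4 * (h * h) * d + 2 * 1 * d          ≤⟨ +-monoʳ-≤ (4 * (h * h) * d) (*-monoˡ-≤ d (*-monoʳ-≤ 2 (*-mono-≤ 1≤h 1≤h))) ⟩
      4 * (h * h) * d + 2 * (h * h) * d    ≡⟨ six-eq h d ⟩
      h * h * (6 * d)                      ≤⟨ *-monoʳ-≤ (h * h) (*-monoˡ-≤ d 6≤d) ⟩
      h * h * (d * d)                      ∎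
      where
      six-eq : ∀ h d → 4 * (h * h) * d + 2 * (h * h) * d ≡ h * h * (6 * d)
      six-eq = solve-∀
    square : x * x ≤ s₀ * s₀ + 2 * z * x
    square = subst (λ x → x * x ≤ s₀ * s₀ + 2 * z * x) split (≤-witness (z * z) (sq s₀ z))
      where
      sq : ∀ s z → (s + z) * (s + z) + z * z ≡ s * s + 2 * z * (s + z)
      sq = solve-∀
    expand : ∀ p d h → 2 * (p * d + 1) * d * (2 * (h * h) + 1) + (h * d) * (h * d) ≡
             4 * p * ((h * d) * (h * d)) + (2 * p * (d * d) + (4 * (h * h) * d + 2 * 1 * d)) + (h * d) * (h * d)
    expand = solve-∀
    collect : ∀ p h d → 4 * p * ((h * d) * (h * d)) + (h * h * (d * d) + h * h * (d * d)) + (h * d) * (h * d) ≡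
              (4 * p + 3) * ((h * d) * (h * d))
    collect = solve-∀
    expand′ : ∀ p s z x → (4 * p + 3) * (s + 2 * z * x) ≡ s * (4 * p + 3) + (8 * p + 6) * z * x
    expand′ = solve-∀

  module _ {n y T : ℕ}
    (1≤p : 1 ≤ p) (d-large : 32 * (suc p * suc p) * h ≤ d)
    (pdy≤n : p * d * y ≤ n) (n≤ : n ≤ (p * d + 1) * y)
    (T≤ : suc T + (3 * (d * d) + 2 * d) ≤ 2 * suc p * z * y) where

    private
      a = 2 * h * suc p * y

      -- Bounds the darts at A and B, at most 4ad, by the fraction 1/(4(p+1)) of all nd darts. The
      -- constant 32 in `d-large` is 16 times the 2 in `a`.
      a-small : 16 * suc p * a ≤ n
      a-small = begin
        16 * suc p * (2 * h * suc p * y)    ≡⟨ regroup p h y ⟩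
        32 * (suc p * suc p) * h * y        ≤⟨ *-monoˡ-≤ y d-large ⟩
        d * y                               ≤⟨ *-monoˡ-≤ y (m≤n*m d p {{>-nonZero 1≤p}}) ⟩
        p * d * y                           ≤⟨ pdy≤n ⟩
        n                                   ∎
        where
        open ≤-Reasoning
        regroup : ∀ p h y → 16 * suc p * (2 * h * suc p * y) ≡ 32 * (suc p * suc p) * h * y
        regroup = solve-∀

      ad≤nd : a * d ≤ n * d
      ad≤nd = *-monoˡ-≤ d (≤-trans (m≤n*m a (16 * suc p)) a-small)

    -- With s ≥ 2(p+1)s₀y, g ≥ nd(4p+3)/(4p+4) and n ≤ (pd+1)y inserted, all that remains is
    -- `leading-term`.
    enough-switchings : ∀ s g → a * d ≤ s + T → n * d ≤ g + 4 * (a * d) →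
      suc T * ((n * d) * (n * d)) + ((a * d) * ((d * d) * (n * d)) +
        ((a * d) * ((a * d) * (suc d * d)) + (a * d) * ((a * d) * (suc d * d)))) ≤ s * (s * g)
    enough-switchings s g ad≤ nd≤ = ≤-trans left (*-cancelˡ-≤ (4 * suc p) right)
      where
      open ≤-Reasoning
      D = n * d
      σ = 2 * suc p * s₀
      -- As ad ≤ nd, the collisions amount to at most d² + 2(d+1)d = 3d² + 2d further units of
      -- (nd)²; `T≤` sets these aside.
      left : suc T * (D * D) + ((a * d) * ((d * d) * D) + ((a * d) * ((a * d) * (suc d * d)) + (a * d) * ((a * d) * (suc d * d)))) ≤
             D * D * (2 * suc p * z * y)
      left = begin
        suc T * (D * D) + ((a * d) * ((d * d) * D) + ((a * d) * ((a * d) * (suc d * d)) + (a * d) * ((a * d) * (suc d * d))))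
          ≤⟨ +-monoʳ-≤ (suc T * (D * D)) (+-mono-≤ (*-monoˡ-≤ ((d * d) * D) ad≤nd) (+-mono-≤ second second)) ⟩
        suc T * (D * D) + (D * ((d * d) * D) + (D * (D * (suc d * d)) + D * (D * (suc d * d))))
          ≡⟨ collect T D d ⟩
        D * D * (suc T + (3 * (d * d) + 2 * d))
          ≤⟨ *-monoʳ-≤ (D * D) T≤ ⟩
        D * D * (2 * suc p * z * y) ∎
        where
        second : (a * d) * ((a * d) * (suc d * d)) ≤ D * (D * (suc d * d))
        second = *-mono-≤ ad≤nd (*-monoˡ-≤ (suc d * d) ad≤nd)
        collect : ∀ T D d → suc T * (D * D) + (D * ((d * d) * D) + (D * (D * (suc d * d)) + D * (D * (suc d * d)))) ≡
                  D * D * (suc T + (3 * (d * d) + 2 * d))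
        collect = solve-∀
      σy≤s : σ * y ≤ s
      σy≤s = +-cancelʳ-≤ (2 * suc p * z * y) _ _ (begin
        σ * y + 2 * suc p * z * y        ≡⟨ factor p s₀ z y ⟩
        2 * suc p * y * (s₀ + z)         ≡⟨ cong (2 * suc p * y *_) split ⟩
        2 * suc p * y * (h * d)          ≡⟨ regroup p y h d ⟩
        2 * h * suc p * y * d            ≤⟨ ad≤ ⟩
        s + T                            ≤⟨ +-monoʳ-≤ s (≤-trans (n≤1+n T) (m+n≤o⇒m≤o _ T≤)) ⟩
        s + 2 * suc p * z * y            ∎)
        where
        factor : ∀ p s z y → 2 * suc p * s * y + 2 * suc p * z * y ≡ 2 * suc p * y * (s + z)
        factor = solve-∀
        regroup : ∀ p y h d → 2 * suc p * y * (h * d) ≡ 2 * h * suc p * y * d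
        regroup = solve-∀
      D≤g : (4 * p + 3) * D ≤ 4 * suc p * g
      D≤g = +-cancelʳ-≤ D _ _ (begin
        (4 * p + 3) * D + D                            ≡⟨ four p D ⟩
        4 * suc p * D                                  ≤⟨ *-monoʳ-≤ (4 * suc p) nd≤ ⟩
        4 * suc p * (g + 4 * (a * d))                  ≡⟨ regroup p g a d ⟩
        4 * suc p * g + 16 * suc p * a * d             ≤⟨ +-monoʳ-≤ (4 * suc p * g) (*-monoˡ-≤ d a-small) ⟩
        4 * suc p * g + D                              ∎)
        where
        four : ∀ p D → (4 * p + 3) * D + D ≡ 4 * suc p * D
        four = solve-∀
        regroup : ∀ p g a d → 4 * suc p * (g + 4 * (a * d)) ≡ 4 * suc p * g + 16 * suc p * a * d
        regroup = solve-∀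
      right : 4 * suc p * (D * D * (2 * suc p * z * y)) ≤ 4 * suc p * (s * (s * g))
      right = begin
        4 * suc p * (D * D * (2 * suc p * z * y))
          ≡⟨ regroup₁ p n d z y ⟩
        n * (8 * (suc p * suc p) * (D * (d * z * y)))
          ≤⟨ *-monoˡ-≤ (8 * (suc p * suc p) * (D * (d * z * y))) n≤ ⟩
        (p * d + 1) * y * (8 * (suc p * suc p) * (D * (d * z * y)))
          ≡⟨ regroup₂ p d y D z ⟩
        2 * (p * d + 1) * d * z * (4 * (suc p * suc p) * (D * (y * y)))
          ≤⟨ *-monoˡ-≤ (4 * (suc p * suc p) * (D * (y * y))) leading-term ⟩
        s₀ * s₀ * (4 * p + 3) * (4 * (suc p * suc p) * (D * (y * y)))
          ≡⟨ regroup₃ s₀ p D y ⟩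
        (σ * y) * ((σ * y) * ((4 * p + 3) * D))
          ≤⟨ *-mono-≤ σy≤s (*-mono-≤ σy≤s D≤g) ⟩
        s * (s * (4 * suc p * g))
          ≡⟨ regroup₄ s p g ⟩
        4 * suc p * (s * (s * g)) ∎
        where
        regroup₁ : ∀ p n d z y → 4 * suc p * ((n * d) * (n * d) * (2 * suc p * z * y)) ≡
                   n * (8 * (suc p * suc p) * ((n * d) * (d * z * y)))
        regroup₁ = solve-∀
        regroup₂ : ∀ p d y D z → (p * d + 1) * y * (8 * (suc p * suc p) * (D * (d * z * y))) ≡
                   2 * (p * d + 1) * d * z * (4 * (suc p * suc p) * (D * (y * y)))
        regroup₂ = solve-∀
        regroup₃ : ∀ s p D y → s * s * (4 * p + 3) * (4 * (suc p * suc p) * (D * (y * y))) ≡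
                   (2 * suc p * s * y) * ((2 * suc p * s * y) * ((4 * p + 3) * D))
        regroup₃ = solve-∀
        regroup₄ : ∀ s p g → s * (s * (4 * suc p * g)) ≡ 4 * suc p * (s * (s * g))
        regroup₄ = solve-∀

-- Assembling the two bounds

length-filter-¬ : {A : Set} {P : Pred A 0ℓ} (P? : Decidable P) (xs : List A) →
                  length (filter (λ x → ¬? (P? x)) xs) + ∑ xs (λ x → ⟦ does (P? x) ⟧) ≡ length xs
length-filter-¬ P? [] = refl
length-filter-¬ P? (x ∷ xs) with does (P? x)
... | true  = trans (+-suc _ _) (cong suc (length-filter-¬ P? xs))
... | false = cong suc (length-filter-¬ P? xs)

n<2^n : ∀ n → n < 2 ^ n
n<2^n zero    = s≤s z≤n
n<2^n (suc n) = ≤-trans (+-mono-≤ (m^n>0 2 n) (n<2^n n)) (≤-reflexive (cong (2 ^ n +_) (sym (+-identityʳ (2 ^ n)))))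

-- h is close to log d, and p ≥ 2/ε.
module Asymptotics (e p₋ : ℕ) (3≤p₋ : 3 ≤ p₋)
  (d-large : 32 * (suc (suc p₋) * suc (suc p₋)) * h[ suc e ] ≤ suc e)
  (514≤h : 514 ≤ h[ suc e ]) (2p+4≤h : 2 * suc p₋ + 4 ≤ h[ suc e ]) where

  private
    d = suc e
    p = suc p₋
    h = h[ d ]
    Q = d !
    P = scaled Q d
    M = p * d * Q
    instance
      Q≢0 : NonZero Q
      Q≢0 = d !≢0
      M≢0 : NonZero M
      M≢0 = m*n≢0 (p * d) Q

    1≤h : 1 ≤ h
    1≤h = s≤s z≤n

    h≤d : ∀ c → c ≤ 32 * (suc p * suc p) → c * h ≤ d
    h≤d c c≤ = ≤-trans (*-monoˡ-≤ h c≤) d-large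

    8h≤d : 8 * h ≤ d
    8h≤d = h≤d 8 (≤-trans (≤-witness {8} {32} 24 refl) (m≤m*n 32 (suc p * suc p)))
    [8p+6]z≤hd : (8 * p + 6) * (2 * (h * h) + 1) ≤ h * d
    [8p+6]z≤hd = begin
      (8 * p + 6) * (2 * (h * h) + 1)        ≤⟨ *-monoʳ-≤ (8 * p + 6) (+-monoʳ-≤ (2 * (h * h)) (*-mono-≤ 1≤h 1≤h)) ⟩
      (8 * p + 6) * (2 * (h * h) + h * h)    ≡⟨ regroup p h ⟩
      h * ((24 * p + 18) * h)
        ≤⟨ *-monoʳ-≤ h (h≤d (24 * p + 18) (≤-witness (32 * (p * p) + 40 * p + 14) (compare p))) ⟩
      h * d                                  ∎
      where
      open ≤-Reasoning
      regroup : ∀ p h → (8 * p + 6) * (2 * (h * h) + h * h) ≡ h * ((24 * p + 18) * h)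
      regroup = solve-∀
      compare : ∀ p → 24 * p + 18 + (32 * (p * p) + 40 * p + 14) ≡ 32 * (suc p * suc p)
      compare = solve-∀

    2p≤h² : 2 * p ≤ h * h
    2p≤h² = ≤-trans (≤-trans (m≤m+n (2 * p) 4) 2p+4≤h) (m≤m*n h h)

    6≤d : 6 ≤ d
    6≤d = ≤-trans (≤-trans (≤-witness {6} {514} 508 refl) 514≤h) (≤-trans (m≤n*m h 8) 8h≤d)

    z≤hd : 2 * (h * h) + 1 ≤ h * d
    z≤hd = ≤-trans (m≤n*m _ (8 * p + 6)) [8p+6]z≤hd

    s₀ = h * d ∸ (2 * (h * h) + 1)

    split : s₀ + (2 * (h * h) + 1) ≡ h * d
    split = m∸n+n≡m z≤hd

  -- The first summand pays for the constant terms of `T` and for the collisions, `M` for the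
  -- remainder of n modulo `M`, and 2 p₋ + 2 for the rounding in `2p[q+1]≤`. The holed graphs will
  -- be a fraction of at most 2⁻ᵍ.
  threshold : ℕ → ℕ
  threshold g = ((suc (d + (2 * p * Q + g)) + (3 * (d * d) + 2 * d)) + M + (2 * p₋ + 2)) * M

  module Size (g n : ℕ) (n-large : threshold g ≤ n) where

    private
      q = n / M
      -- About n/(pd), rounded down to a multiple of d! so that the quotients `b / c` with c ≤ d
      -- below lose nothing to rounding.
      y = Q * q
      Y₀ = suc (d + (2 * p * Q + g)) + (3 * (d * d) + 2 * d)
      Y = Y₀ + M + (2 * p₋ + 2)

      Y≤q : Y ≤ q
      Y≤q = ≤-trans (≤-reflexive (sym (m*n/n≡m Y M))) (/-monoˡ-≤ M n-large)

      Y₀+M≤q : Y₀ + M ≤ q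
      Y₀+M≤q = m+n≤o⇒m≤o (Y₀ + M) Y≤q

      Y₀≤q : Y₀ ≤ q
      Y₀≤q = m+n≤o⇒m≤o Y₀ Y₀+M≤q

      q≤y : q ≤ y
      q≤y = m≤n*m q Q

      Mq≡ : p * d * y ≡ q * M
      Mq≡ = rearrange p d Q q
        where
        rearrange : ∀ p d Q q → p * d * (Q * q) ≡ q * (p * d * Q)
        rearrange = solve-∀

      pdy≤n : p * d * y ≤ n
      pdy≤n = ≤-trans (≤-reflexive Mq≡) (m/n*n≤m n M)

      n≤pdy+M : n ≤ p * d * y + M
      n≤pdy+M = ≤-trans (≤-reflexive (m≡m%n+[m/n]*n n M)) (≤-trans (≤-reflexive (+-comm (n % M) (q * M)))
        (+-mono-≤ (≤-reflexive (sym Mq≡)) (<⇒≤ (m%n<n n M))))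

      M≤y : M ≤ y
      M≤y = ≤-trans (m+n≤o⇒n≤o Y₀ Y₀+M≤q) q≤y

      n≤[pd+1]y : n ≤ (p * d + 1) * y
      n≤[pd+1]y = ≤-trans n≤pdy+M (≤-trans (+-monoʳ-≤ (p * d * y) M≤y) (≤-reflexive (collect (p * d) y)))
        where
        collect : ∀ x y → x * y + y ≡ (x + 1) * y
        collect = solve-∀

    a : ℕ
    a = 2 * h * suc p * y

    private
      -- This is 2/d times the upper bound pdy + M for n. The next line chooses `k` so that the
      -- requirement of `exponent-balance` is met with equality.
      c = 2 * p * y + 2 * p * Q
      k = c + h * (2 * a) + g
      T = d + k

      2n≤dc : 2 * n ≤ d * c
      2n≤dc = ≤-trans (*-monoʳ-≤ 2 n≤pdy+M) (≤-reflexive (expand p d y Q))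
        where
        expand : ∀ p d y Q → 2 * (p * d * y + p * d * Q) ≡ d * (2 * p * y + 2 * p * Q)
        expand = solve-∀

      T≤ : suc T + (3 * (d * d) + 2 * d) ≤ 2 * suc p * (2 * (h * h) + 1) * y
      T≤ = begin
        suc T + (3 * (d * d) + 2 * d)
          ≡⟨ regroup d p h y Q g ⟩
        2 * p * y + 4 * (h * h) * suc p * y + (suc (d + (2 * p * Q + g)) + (3 * (d * d) + 2 * d))
          ≤⟨ +-monoʳ-≤ (2 * p * y + 4 * (h * h) * suc p * y) (≤-trans Y₀≤q (≤-trans q≤y (m≤n*m y 2))) ⟩
        2 * p * y + 4 * (h * h) * suc p * y + 2 * y
          ≡⟨ collect p h y ⟩
        2 * suc p * (2 * (h * h) + 1) * y ∎
        where
        open ≤-Reasoning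
        regroup : ∀ d p h y Q g → suc (d + (2 * p * y + 2 * p * Q + h * (2 * (2 * h * suc p * y)) + g)) + (3 * (d * d) + 2 * d) ≡
                  2 * p * y + 4 * (h * h) * suc p * y + (suc (d + (2 * p * Q + g)) + (3 * (d * d) + 2 * d))
        regroup = solve-∀
        collect : ∀ p h y → 2 * p * y + 4 * (h * h) * suc p * y + 2 * y ≡ 2 * suc p * (2 * (h * h) + 1) * y
        collect = solve-∀

      n>0 : 0 < n
      n>0 = ≤-trans (m≤n*m 1 (p * d)) (≤-trans (*-monoʳ-≤ (p * d) (≤-trans (m+n≤o⇒m≤o 1 Y₀≤q) q≤y)) pdy≤n)

      instance
        nd≢0 : NonZero ((n * d) * (n * d))
        nd≢0 = m*n≢0 (n * d) (n * d) {{m*n≢0 n d {{>-nonZero n>0}}}} {{m*n≢0 n d {{>-nonZero n>0}}}}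

    few-holed : #holed {n} d a * 2 ^ g ≤ length (𝒢 n d)
    few-holed = exponent-balance e {#holed {n} d a} {length (𝒢 n d)} {n} {a} {h} {c} {g} {k}
      (union-bound {n} d a T (enough-switchings {p} {d} {h} {s₀} split [8p+6]z≤hd 2p≤h² 1≤h 6≤d {n} {y} {T}
        (s≤s z≤n) d-large pdy≤n n≤[pd+1]y T≤))
      (≤-exp d Q h (λ j → suc∣!) (P≤hQ d)) 2n≤dc ≤-refl

    private
      -- That is (p-1)y, while n/d is about py: the dy vertices given up make room for 2a =
      -- 4h(p+1)y. With R = 8h the bound 2a ≤ Rb amounts to p + 1 ≤ 2(p-1).
      b = Q * (p₋ * q)
      R = 8 * h
      i = d ∸ R

      R+i≡d : R + i ≡ d
      R+i≡d = m+[n∸m]≡n 8h≤d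

      room : d * b + 2 * a ≤ n
      room = begin
        d * (Q * (p₋ * q)) + 2 * (2 * h * suc p * (Q * q))      ≡⟨ regroup d Q p₋ q h ⟩
        d * p₋ * (Q * q) + 4 * suc p * h * (Q * q)              ≤⟨ +-monoʳ-≤ (d * p₋ * (Q * q)) (*-monoˡ-≤ (Q * q)
          (h≤d (4 * suc p) (≤-trans (*-monoˡ-≤ (suc p) {4} {32} (≤-witness 28 refl)) (*-monoʳ-≤ 32 (m≤m*n (suc p) (suc p)))))) ⟩
        d * p₋ * (Q * q) + d * (Q * q)                          ≡⟨ collect d p₋ (Q * q) ⟩
        p * d * y                                               ≤⟨ pdy≤n ⟩
        n                                                       ∎
        where
        open ≤-Reasoning
        regroup : ∀ d Q r q h → d * (Q * (r * q)) + 2 * (2 * h * suc (suc r) * (Q * q)) ≡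
                  d * r * (Q * q) + 4 * suc (suc r) * h * (Q * q)
        regroup = solve-∀
        collect : ∀ d r y → d * r * y + d * y ≡ suc r * d * y
        collect = solve-∀

      2a≤Rb : 2 * a ≤ R * b
      2a≤Rb = begin
        2 * (2 * h * suc p * (Q * q))       ≡⟨ regroup h p₋ Q q ⟩
        (p₋ + 2) * (4 * h * (Q * q))        ≤⟨ *-monoˡ-≤ (4 * h * (Q * q)) (+-monoʳ-≤ p₋ (≤-trans (n≤1+n 2) 3≤p₋)) ⟩
        (p₋ + p₋) * (4 * h * (Q * q))       ≡⟨ collect h p₋ Q q ⟩
        8 * h * (Q * (p₋ * q))              ∎
        where
        open ≤-Reasoning
        regroup : ∀ h r Q q → 2 * (2 * h * suc (suc r) * (Q * q)) ≡ (r + 2) * (4 * h * (Q * q))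
        regroup = solve-∀
        collect : ∀ h r Q q → (r + r) * (4 * h * (Q * q)) ≡ 8 * h * (Q * (r * q))
        collect = solve-∀

      [R+i]b≤n : (R + i) * b ≤ n
      [R+i]b≤n = ≤-trans (≤-reflexive (cong (_* b) R+i≡d)) (m+n≤o⇒m≤o _ room)

    module _ {G : Digraph n} (simple : Simple G) (regular : Regular d G) (noHole : NoHole a G) where

      private
        irr  = simple⇒irreflexive {G = G} simple
        symm = simple⇒symmetric {G = G} simple
        dg   = regular⇒deg {G = G} regular
        open Greedy {G = G} irr symm {d} dg {a} noHole

        m = steps b R i

        steps-≥ : ∀ i → p₋ * q * scaled Q (R + i) ≤ steps b R i + p₋ * q * scaled Q R
        steps-≥ zero    = ≤-reflexive (cong (λ t → p₋ * q * scaled Q t) (+-identityʳ R))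
        steps-≥ (suc i) = begin
          p₋ * q * scaled Q (R + suc i)                              ≡⟨ cong (λ t → p₋ * q * scaled Q t) (+-suc R i) ⟩
          p₋ * q * (scaled Q (R + i) + Q / suc (R + i))
            ≡⟨ expand (p₋ * q) (scaled Q (R + i)) (Q / suc (R + i)) ⟩
          p₋ * q * scaled Q (R + i) + Q / suc (R + i) * (p₋ * q)
            ≤⟨ +-mono-≤ (steps-≥ i) (*-/-≤ Q (suc (R + i)) (p₋ * q)) ⟩
          steps b R i + p₋ * q * scaled Q R + b / suc (R + i)        ≡⟨ rotate (steps b R i) _ (b / suc (R + i)) ⟩
          steps b R (suc i) + p₋ * q * scaled Q R                    ∎
          where
          open ≤-Reasoning
          expand : ∀ r s c → r * (s + c) ≡ r * s + c * r
          expand = solve-∀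
          rotate : ∀ a b c → a + b + c ≡ a + c + b
          rotate = solve-∀

        -- The early stop of the greedy process costs at most a quarter of the harmonic sum, by
        -- `scaled-8h`.
        4m≥ : 3 * p₋ * q * P ≤ 4 * m
        4m≥ = +-cancelʳ-≤ (p₋ * q * P) _ _ (begin
          3 * p₋ * q * P + p₋ * q * P            ≡⟨ four p₋ q P ⟩
          4 * (p₋ * q * P)                       ≡⟨ cong (λ t → 4 * (p₋ * q * scaled Q t)) R+i≡d ⟨
          4 * (p₋ * q * scaled Q (R + i))        ≤⟨ *-monoʳ-≤ 4 (steps-≥ i) ⟩
          4 * (m + p₋ * q * scaled Q R)          ≡⟨ expand m (p₋ * q) (scaled Q R) ⟩
          4 * m + p₋ * q * (4 * scaled Q R)      ≤⟨ +-monoʳ-≤ (4 * m) (*-monoʳ-≤ (p₋ * q) (scaled-8h d 514≤h)) ⟩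
          4 * m + p₋ * q * P                     ∎)
          where
          open ≤-Reasoning
          four : ∀ r q P → 3 * r * q * P + r * q * P ≡ 4 * (r * q * P)
          four = solve-∀
          expand : ∀ m r s → 4 * (m + r * s) ≡ 4 * m + r * (4 * s)
          expand = solve-∀

        -- The factors 3/4 and (p-1)/p have a product above 1/2 because p ≥ 4; the surplus pays for
        -- q + 1 in place of q.
        2p[q+1]≤ : 2 * p * suc q ≤ 3 * p₋ * q
        2p[q+1]≤ = begin
          2 * suc p₋ * suc q                   ≡⟨ expand p₋ q ⟩
          2 * p₋ * q + 2 * q + (2 * p₋ + 2)    ≤⟨ +-monoʳ-≤ (2 * p₋ * q + 2 * q) (m+n≤o⇒n≤o (Y₀ + M) Y≤q) ⟩
          2 * p₋ * q + 2 * q + q               ≡⟨ collect p₋ q ⟩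
          2 * p₋ * q + 3 * q                   ≤⟨ +-monoʳ-≤ (2 * p₋ * q) (*-monoˡ-≤ q 3≤p₋) ⟩
          2 * p₋ * q + p₋ * q                  ≡⟨ collect′ p₋ q ⟩
          3 * p₋ * q                           ∎
          where
          open ≤-Reasoning
          expand : ∀ r q → 2 * suc r * suc q ≡ 2 * r * q + 2 * q + (2 * r + 2)
          expand = solve-∀
          collect : ∀ r q → 2 * r * q + 2 * q + q ≡ 2 * r * q + 3 * q
          collect = solve-∀
          collect′ : ∀ r q → 2 * r * q + r * q ≡ 3 * r * q
          collect′ = solve-∀

        many-forces : n * P ≤ 2 * d * m * Q
        many-forces = *-cancelˡ-≤ 2 (begin
          2 * (n * P)                        ≤⟨ *-monoʳ-≤ 2 (*-monoˡ-≤ P n≤pdy+M) ⟩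
          2 * ((p * d * y + M) * P)          ≡⟨ regroup p d Q q P ⟩
          2 * p * suc q * (d * Q * P)        ≤⟨ *-monoˡ-≤ (d * Q * P) 2p[q+1]≤ ⟩
          3 * p₋ * q * (d * Q * P)           ≡⟨ regroup′ p₋ q d Q P ⟩
          3 * p₋ * q * P * (d * Q)           ≤⟨ *-monoˡ-≤ (d * Q) 4m≥ ⟩
          4 * m * (d * Q)                    ≡⟨ regroup″ m d Q ⟩
          2 * (2 * d * m * Q)                ∎)
          where
          open ≤-Reasoning
          regroup : ∀ p d Q q P → 2 * ((p * d * (Q * q) + p * d * Q) * P) ≡ 2 * p * suc q * (d * Q * P)
          regroup = solve-∀
          regroup′ : ∀ r q d Q P → 3 * r * q * (d * Q * P) ≡ 3 * r * q * P * (d * Q)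
          regroup′ = solve-∀
          regroup″ : ∀ m d Q → 4 * m * (d * Q) ≡ 2 * (2 * d * m * Q)
          regroup″ = solve-∀

        QH≡P : ℕ→ℚ Q ℚ.* harmonic d ≡ ℕ→ℚ P
        QH≡P = harmonic-scaled Q d (λ j → suc∣!)

        instance
          Q-pos : ℚ.Positive (ℕ→ℚ Q)
          Q-pos = ℚ.normalize-pos Q 1

        many-forcesℚ : ℕ→ℚ n ℚ.* harmonic d ℚ.≤ ℕ→ℚ (2 * d) ℚ.* ℕ→ℚ m
        many-forcesℚ = ℚ.*-cancelˡ-≤-pos (ℕ→ℚ Q) (subst₂ ℚ._≤_ left right (ℕ→ℚ-mono many-forces))
          where
          left : ℕ→ℚ (n * P) ≡ ℕ→ℚ Q ℚ.* (ℕ→ℚ n ℚ.* harmonic d)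
          left = trans (ℕ→ℚ-* n P) (trans (cong (ℕ→ℚ n ℚ.*_) (sym QH≡P))
            (trans (sym (ℚ.*-assoc (ℕ→ℚ n) (ℕ→ℚ Q) (harmonic d))) (trans (cong (ℚ._* harmonic d) (ℚ.*-comm (ℕ→ℚ n) (ℕ→ℚ Q)))
              (ℚ.*-assoc (ℕ→ℚ Q) (ℕ→ℚ n) (harmonic d)))))
          right : ℕ→ℚ (2 * d * m * Q) ≡ ℕ→ℚ Q ℚ.* (ℕ→ℚ (2 * d) ℚ.* ℕ→ℚ m)
          right = trans (ℕ→ℚ-* (2 * d * m) Q) (trans (ℚ.*-comm (ℕ→ℚ (2 * d * m)) (ℕ→ℚ Q)) (cong (ℕ→ℚ Q ℚ.*_) (ℕ→ℚ-* (2 * d) m)))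

        -- One unit is for h ≤ H_d + 1 and one for H_d ≤ log d + 1, so `h₋` lies below the
        -- logarithm.
        h₋ = h ∸ 2

        h₋+2≡h : h₋ + 2 ≡ h
        h₋+2≡h = m∸n+n≡m {h} {2} (≤-trans (≤-witness {2} {514} 512 refl) 514≤h)

        h₋≤log : ∀ j → ℕ→ℚ h₋ ℚ.≤ logApprox d j
        h₋≤log j = p+r≤q+r⇒p≤q 1ℚ (ℚ.≤-trans (ℚ.*-cancelˡ-≤-pos (ℕ→ℚ Q) (subst₂ ℚ._≤_ left (sym QH≡P) (ℕ→ℚ-mono below))) (logApprox-≥ e j))
          where
          below : Q * suc h₋ ≤ P
          below = +-cancelʳ-≤ Q _ _ (≤-trans (≤-reflexive (trans (shift Q h₋) (cong (_* Q) h₋+2≡h))) (hQ≤P+Q d))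
            where
            shift : ∀ Q x → Q * suc x + Q ≡ (x + 2) * Q
            shift = solve-∀
          left : ℕ→ℚ (Q * suc h₋) ≡ ℕ→ℚ Q ℚ.* (ℕ→ℚ h₋ ℚ.+ 1ℚ)
          left = trans (ℕ→ℚ-* Q (suc h₋)) (cong (ℕ→ℚ Q ℚ.*_) (trans (cong ℕ→ℚ (+-comm 1 h₋)) (ℕ→ℚ-+ h₋ 1)))

        -- `a` is built from `h`, but the comparison with the logarithm needs `h₋`. The exchange
        -- raises p + 1 to p + 2, which is possible as h ≥ 2p + 4, and explains why ε is compared
        -- with 2/p instead of 1/p.
        few-forces : ∀ {f} → f ≤ 2 * a → f * d * p ≤ n * (p + 2) * (4 * h₋)
        few-forces {f} f≤2a = begin
          f * d * p                                  ≤⟨ *-monoˡ-≤ p (*-monoˡ-≤ d f≤2a) ⟩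
          2 * (2 * h * suc p * y) * d * p            ≡⟨ regroup h p y d ⟩
          p * d * y * (4 * (h * suc p))              ≤⟨ *-mono-≤ pdy≤n (*-monoʳ-≤ 4 h[p+1]≤) ⟩
          n * (4 * ((p + 2) * h₋))                   ≡⟨ regroup′ n p h₋ ⟩
          n * (p + 2) * (4 * h₋)                     ∎
          where
          open ≤-Reasoning
          regroup : ∀ h p y d → 2 * (2 * h * suc p * y) * d * p ≡ p * d * y * (4 * (h * suc p))
          regroup = solve-∀
          regroup′ : ∀ n p x → n * (4 * ((p + 2) * x)) ≡ n * (p + 2) * (4 * x)
          regroup′ = solve-∀
          h[p+1]≤ : h * suc p ≤ (p + 2) * h₋
          h[p+1]≤ = begin
            h * suc p                          ≡⟨ cong (_* suc p) h₋+2≡h ⟨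
            (h₋ + 2) * suc p                   ≡⟨ expand h₋ p ⟩
            h₋ * suc p + (2 * p + 2)
              ≤⟨ +-monoʳ-≤ (h₋ * suc p) (+-cancelʳ-≤ 2 _ _ (≤-trans (≤-reflexive (+-assoc (2 * p) 2 2)) (≤-trans 2p+4≤h (≤-reflexive (sym h₋+2≡h))))) ⟩
            h₋ * suc p + h₋                    ≡⟨ collect h₋ p ⟩
            (p + 2) * h₋                       ∎
            where
            expand : ∀ x p → (x + 2) * suc p ≡ x * suc p + (2 * p + 2)
            expand = solve-∀
            collect : ∀ x p → x * suc p + x ≡ (p + 2) * x
            collect = solve-∀

      zeroForcingNumber-bounds : (ε : ℝ) → (∃ λ N → ∀ j → N ≤ j → ℕ→ℚ 2 ℚ.* recip p ℚ.≤ seq ε j) →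
        ∃ λ (Z : ℕ) → IsZeroForcingNumber G Z
          × (ℕ→ℝ n *ᴿ (1ℝ -ᴿ (1ℝ +ᴿ ε) *ᴿ ((ℕ→ℝ 4 *ᴿ log d) /ᴿ d)) ≤ᴿ ℕ→ℝ Z)
          × (ℕ→ℝ Z ≤ᴿ ℕ→ℝ n *ᴿ (1ℝ -ᴿ (1ℝ -ᴿ ε) *ᴿ (log d /ᴿ (2 * d))))
      zeroForcingNumber-bounds ε (N , ε-large) = Z , isZ ,
          -- Both inequalities hold between the terms themselves from index N on, so the tolerance η
          -- is merely added.
          (λ η 0<η → N , λ j N≤j → ℚ.≤-trans
            (lower-bound {p₋} {e} {n} {Z} {n ∸ Z} {h₋} {logApprox d j} {seq ε j} (m+[n∸m]≡n Z≤n)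
              (few-forces (m≤n+o⇒m∸n≤o n Z (<⇒≤ n<Z+2a))) (h₋≤log j) (ε-large j N≤j))
            (p≤p+q (ℚ.<⇒≤ 0<η))) ,
          (λ η 0<η → N , λ j N≤j → ℚ.≤-trans
            -- `e + (d + 0)` is the predecessor of `2 * d`.
            (upper-bound {e + (d + 0)} {n} {Z} {m} {logApprox d j} {harmonic d} {seq ε j} Z+m≤n many-forcesℚ
              (0≤logApprox e j) (logApprox-≤ e j) (ℚ.≤-trans (0≤* (0≤ℕ→ℚ 2) (0≤recip p₋)) (ε-large j N≤j)))
            (p≤p+q (ℚ.<⇒≤ 0<η)))
        where
        Z = proj₁ (zeroForcingNumber G)
        isZ = proj₂ (zeroForcingNumber G)
        attained = proj₁ isZ
        n<Z+2a : n < Z + 2 * a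
        n<Z+2a = subst (λ t → n < t + 2 * a) (proj₂ (proj₂ attained))
          (zeroForcingSet-large G noHole (proj₁ (proj₂ attained)))
        small = zeroForcingSet-small {b} {R} room 2a≤Rb i [R+i]b≤n
        Z+m≤n : Z + m ≤ n
        Z+m≤n = ≤-trans (+-monoˡ-≤ m (proj₂ isZ (proj₁ small) (proj₁ (proj₂ small)))) (≤-reflexive (proj₂ (proj₂ small)))
        Z≤n : Z ≤ n
        Z≤n = m+n≤o⇒m≤o Z Z+m≤n

mainTheorem1 : (ε : ℝ) → 0ℝ <ᴿ ε →
    ∃ λ (d₀ : ℕ) → (d : ℕ) → .{{_ : NonZero d}} → d₀ ≤ d →
    AsymptoticallyAlmostSurely d (λ {n} G →
    ∃ λ (Z : ℕ) → IsZeroForcingNumber G Z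
    × (ℕ→ℝ n *ᴿ (1ℝ -ᴿ (1ℝ +ᴿ ε) *ᴿ ((ℕ→ℝ 4 *ᴿ log d) /ᴿ d)) ≤ᴿ ℕ→ℝ Z)
    × (ℕ→ℝ Z ≤ᴿ ℕ→ℝ n *ᴿ (1ℝ -ᴿ (1ℝ -ᴿ ε) *ᴿ (log d /ᴿ (2 * d)) {{m*n≢0 2 d}})))
mainTheorem1 ε (ε₀ , 0<ε₀ , N , ε₀≤ε) = d₀ , go
  where
  r : ℕ
  r = proj₁ (positive-≥-recip 0<ε₀)
  -- This gives p = 2(r+2), so that 2/p = 1/(r+2) is below 1/(r+1) ≤ ε₀, and p₋ ≥ 3 for every r.
  p₋ = suc (suc r * 2)
  p = suc p₋
  C = 32 * (suc p * suc p)
  h₀ = 514 + (2 * p + 4)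
  -- The first summand makes Ch ≤ d by `h-small`, the second makes h ≥ h₀ by `h-large`.
  d₀ = (4 * C * C + 2 * C) + 2 ^ (2 * h₀)
  2/p≤ε : ∀ j → N ≤ j → ℕ→ℚ 2 ℚ.* recip p ℚ.≤ seq ε j
  2/p≤ε j N≤j = ℚ.≤-trans (ℚ.≤-reflexive (cancel-recip (suc r) 1)) (ℚ.≤-trans (recip-anti (n≤1+n r))
    (ℚ.≤-trans (proj₂ (positive-≥-recip 0<ε₀)) (ℚ.≤-trans (ℚ.≤-reflexive (sym (ℚ.+-identityˡ ε₀))) (ε₀≤ε j N≤j))))
  go : (d : ℕ) → .{{_ : NonZero d}} → d₀ ≤ d → AsymptoticallyAlmostSurely d _
  -- With 1/(b+1) ≤ δ the choice g = b suffices: the holed graphs form a fraction of at most 2⁻ᵇ ≤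
  -- 1/(b+1).
  go (suc e) d₀≤d δ 0<δ = threshold b , λ n n-large _ →
      let open Size b n n-large
          good? = λ (G : Digraph n) → ¬? (holed? a G)
          total = length-filter-¬ (holed? a) (𝒢 n (suc e))
      in filter good? (𝒢 n (suc e)) , filter-⊆ good? (𝒢 n (suc e)) ,
         All.zipWith (λ {G} ((s , reg) , ¬holed) → zeroForcingNumber-bounds {G} s reg (¬holed⇒noHole {G = G} ¬holed) ε (N , 2/p≤ε))
           (filter⁺ good? (all-filter (λ G → simple? G ×-dec regular? (suc e) G) (allDigraphs n)) , all-filter good? (𝒢 n (suc e))) ,
         subst (λ t → (1ℚ ℚ.- δ) ℚ.* ℕ→ℚ t ℚ.≤ ℕ→ℚ (length (filter good? (𝒢 n (suc e))))) total
           (probability-bound {δ} {b} {length (filter good? (𝒢 n (suc e)))} {#holed {n} (suc e) a} (proj₂ (positive-≥-recip 0<δ))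
             (≤-trans (*-monoʳ-≤ (#holed {n} (suc e) a) (n<2^n b)) (≤-trans few-holed (≤-reflexive (sym total)))))
    where
    b = proj₁ (positive-≥-recip 0<δ)
    h₀≤h = h-large (suc e) h₀ (≤-trans (m≤n+m _ (4 * C * C + 2 * C)) d₀≤d)
    open Asymptotics e p₋ (s≤s (s≤s (s≤s z≤n))) (h-small (suc e) C (m+n≤o⇒m≤o _ d₀≤d))
      (m+n≤o⇒m≤o 514 h₀≤h) (m+n≤o⇒n≤o 514 h₀≤h)
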